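{- Let $h\ge 1$ be an integer and let $Q=\prod P$ be the product of all monic irreducible $P\in\mathbb F_q[T]$ with $|P|\le q^{2h}$. Then for every $\varepsilon>0$, \[m_5(Q;h)\ll_{\varepsilon} |Q|\,q^{(2+\varepsilon)h}.\]
   Context: $\mathbb F_q$ is a finite field with $q$ elements (fixed). For nonzero $F\in\mathbb F_q[T]$ set $|F|=q^{\deg F}$, and $|0|=0$. For monic $Q$, $\phi(Q)$ is the number of polynomials $A$ with $\deg A<\deg Q$ and $\gcd(A,Q)=1$. For $F\in\mathbb F_q[T]$ let $I(F,h)=\{G\in\mathbb F_q[T]:|F-G|<q^h\}$, and \[m_5(Q;h)=\sum_{F \bmod Q}\Big(\#\{G\in I(F,h):\gcd(G,Q)=1\}-\frac{q^h\phi(Q)}{|Q|}\Big)^5,\] where $F$ ranges over polynomials with $\deg F<\deg Q$. The implied constant depends only on $\varepsilon$ and $q$. -}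

module Defs where

open import Level using (0ℓ)
open import Data.Nat as ℕ using (ℕ; zero; suc; NonZero; _<_; _<?_; _∸_)
open import Data.Nat.Properties using (m^n≢0)
open import Data.Integer as ℤ using (ℤ; +_)
open import Data.Rational as ℚ using (ℚ; _/_)
open import Data.List using (List; []; _∷_; length; map; concatMap; filter; reverse; sum)
open import Data.List.Membership.Propositional using (_∈_)
open import Data.List.Relation.Unary.All using (All)
open import Data.List.Relation.Unary.Any using (here; there)
open import Data.List.Relation.Unary.Unique.Propositional using (Unique)
open import Data.Product using (Σ; ∃; _×_; _,_)
open import Data.Sum using (_⊎_)
open import Relation.Nullary using (¬_; Dec; yes; no)
open import Relation.Binary.PropositionalEquality using (_≡_; _≢_)
open import Algebra.Structures using (IsCommutativeRing)

_^Q_ : ℚ → ℕ → ℚ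
x ^Q zero = ℚ.1ℚ
x ^Q suc n = x ℚ.* (x ^Q n)

record FiniteField : Set₁ where
  field
    Carrier : Set
    _+_ _*_ : Carrier → Carrier → Carrier
    -_      : Carrier → Carrier
    0# 1#   : Carrier
    isCommutativeRing : IsCommutativeRing _≡_ _+_ _*_ -_ 0# 1#
    0≢1     : 0# ≢ 1#
    inverse : ∀ x → x ≢ 0# → ∃ λ y → x * y ≡ 1#
    _≟_     : (x y : Carrier) → Dec (x ≡ y)
    elements : List Carrier
    elements-unique   : Unique elements
    elements-complete : ∀ x → x ∈ elements

module Poly (𝔽 : FiniteField) where
  open FiniteField 𝔽 renaming (_+_ to _+F_; _*_ to _*F_; -_ to -F_)

  q : ℕ
  q = length elements

  instance
    q-nonZero : NonZero q
    q-nonZero with elements | elements-complete 0#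
    ... | _ ∷ _ | _ = _

  -- Polynomials over F_q: coefficient lists, constant term first.
  -- Trailing zero coefficients are allowed; equality is _≈P_ below.
  Pol : Set
  Pol = List Carrier

  _+P_ : Pol → Pol → Pol
  [] +P g = g
  (a ∷ f) +P [] = a ∷ f
  (a ∷ f) +P (b ∷ g) = (a +F b) ∷ (f +P g)

  -P_ : Pol → Pol
  -P f = map -F_ f

  _-P_ : Pol → Pol → Pol
  f -P g = f +P (-P g)

  _*P_ : Pol → Pol → Pol
  [] *P g = []
  (a ∷ f) *P g = map (a *F_) g +P (0# ∷ (f *P g))

  1P : Pol
  1P = 1# ∷ []

  private
    dropZeros : List Carrier → List Carrier
    dropZeros [] = []
    dropZeros (a ∷ f) with a ≟ 0#
    ... | yes _ = dropZeros f
    ... | no  _ = a ∷ f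

  normalize : Pol → Pol
  normalize f = reverse (dropZeros (reverse f))

  _≈P_ : Pol → Pol → Set
  f ≈P g = normalize f ≡ normalize g

  -- number of coefficients of the normal form (= deg + 1, and 0 for f = 0)
  size : Pol → ℕ
  size f = length (normalize f)

  -- deg f for nonzero f (we only use it for Q; deg 0 := 0 by convention)
  deg : Pol → ℕ
  deg f = size f ∸ 1

  ∣_∣P : Pol → ℕ
  ∣ f ∣P with size f
  ... | zero  = 0
  ... | suc d = q ℕ.^ d

  Monic : Pol → Set
  Monic f = ∃ λ g → normalize f ≡ g Data.List.++ (1# ∷ [])

  _∣P_ : Pol → Pol → Set
  d ∣P f = ∃ λ a → (a *P d) ≈P f

  IsUnit : Pol → Set
  IsUnit u = u ∣P 1P

  Coprime : Pol → Pol → Set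
  Coprime A B = ∀ D → D ∣P A → D ∣P B → IsUnit D

  Irreducible : Pol → Set
  Irreducible P = ¬ (size P ≡ 0) × ¬ IsUnit P
                × (∀ A B → (A *P B) ≈P P → IsUnit A ⊎ IsUnit B)

  prodP : List Pol → Pol
  prodP [] = 1P
  prodP (P ∷ Ps) = P *P prodP Ps

  -- all coefficient lists of length n: the polynomials of degree < n,
  -- each listed exactly once
  allPol : ℕ → List Pol
  allPol zero = [] ∷ []
  allPol (suc n) = concatMap (λ a → map (a ∷_) (allPol n)) elements

  IsPrimorial : ℕ → Pol → Set
  IsPrimorial h Q = Σ (List Pol) λ Ps →
      Unique Ps
    × (∀ P → P ∈ Ps → normalize P ≡ P × Monic P × Irreducible P
                     × ∣ P ∣P ℕ.≤ q ℕ.^ (2 ℕ.* h))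
    × (∀ P → Monic P → Irreducible P → ∣ P ∣P ℕ.≤ q ℕ.^ (2 ℕ.* h)
           → normalize P ∈ Ps)
    × Q ≡ prodP Ps

  module Counting (coprime? : ∀ A B → Dec (Coprime A B)) where

    φ : Pol → ℕ
    φ Q = length (filter (λ A → coprime? A Q) (allPol (deg Q)))

    -- #{G ∈ I(F,h) : gcd(G,Q) = 1}; every G ∈ I(F,h) has fewer than
    -- deg Q + h coefficients when deg F < deg Q, so we search allPol (deg Q + h)
    N : Pol → ℕ → Pol → ℕ
    N Q h F = length (filter (λ G → coprime? G Q)
                (filter (λ G → ∣ F -P G ∣P <? q ℕ.^ h) (allPol (deg Q ℕ.+ h))))

    m₅ : Pol → ℕ → ℚ
    m₅ Q h = Data.List.foldr ℚ._+_ ℚ.0ℚ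
      (map (λ F → ((+ N Q h F / 1) ℚ.- (_/_ (+ (q ℕ.^ h ℕ.* φ Q)) (q ℕ.^ deg Q)
                     {{m^n≢0 q (deg Q)}})) ^Q 5)
           (allPol (deg Q)))

-- Let H = q ^ h, m = deg Q. Poisson summation on F_q[T]/(Q), with X standing for the frequency X/Q, writes
-- |Q| (#{G ∈ I(F,h) : gcd(G,Q) = 1} − H φ(Q)/|Q|) as H times a sum over nonzero X of degree < m − h, weighted by
-- numbers of absolute value at most ∏_{P ∣ X} |P|. Hence m₅ is bounded by the sum of ∏ 1/d(Xᵢ) over X₁ + … + X₅ = 0,
-- where d(X) is the norm of the reduced denominator of X/Q.
--
-- Up to factors O(H^ε), the sum of 1/(d(X₁) d(X₂)) over X₁ + X₂ = Y is at most 1/d(Y), and if one restricts to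
-- d(Y) ≤ d(X₁) a further factor H is saved: fractions with denominators of bounded degree are well spaced.
-- Choosing the smallest denominator as Y bounds the three-variable sum by H^(-2). For five variables put
-- Y = X₁ + X₂, Z = X₄ + X₅ and assume d(Y) ≤ d(Z): merging X₄, X₅ into Z, and then Z, X₃ into −Y with a saving of H,
-- leaves the three-variable sum, in total H^(-3); the case Y = 0 is H^(-1) H^(-2).
module Submission where

open import Defs
open import Level using (0ℓ)
open import Algebra.Bundles using (CommutativeSemiring; CommutativeRing)
import Algebra.Properties.Ring
open import Data.Bool as Bool using (Bool; true; false; if_then_else_)
open import Data.Empty using (⊥-elim)
open import Data.Integer using (+_)
open import Data.Integer as ℤ using (ℤ; 0ℤ; 1ℤ)
import Data.Integer.Properties as ℤ
import Data.Integer.Tactic.RingSolver as ℤ-Solver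
open import Data.List using (List; []; _∷_; _++_; _∷ʳ_; length; map; concatMap; filter; foldr; reverse; drop; upTo; initLast; _∷ʳ′_)
import Data.List.Properties as List
open import Data.List.Membership.Propositional using (_∈_; find)
open import Data.List.Membership.Propositional.Properties
  using (∈-map⁺; ∈-map⁻; ∈-filter⁺; ∈-filter⁻; ∈-concatMap⁺; ∈-concatMap⁻; ∈-upTo⁺)
open import Data.List.Membership.Propositional.Properties.WithK using (unique∧set⇒bag)
open import Data.List.Relation.Binary.BagAndSetEquality using (∼bag⇒↭)
open import Data.List.Relation.Binary.Disjoint.Propositional using (Disjoint)
open import Data.List.Relation.Binary.Permutation.Propositional as ↭ using (_↭_)
open import Data.List.Relation.Unary.All as All using (All; []; _∷_)
open import Data.List.Relation.Unary.AllPairs using (AllPairs; []; _∷_)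
import Data.List.Relation.Unary.AllPairs.Properties as AllPairs
open import Data.List.Relation.Unary.Any as Any using (Any; here; there; any?)
open import Data.List.Relation.Unary.Unique.Propositional using (Unique)
import Data.List.Relation.Unary.Unique.Propositional.Properties as Unique
open import Data.Nat using (ℕ; _≤_; _*_; _^_)
open import Data.Nat as ℕ using (_+_; >-nonZero; zero; suc; _<_; z≤n; s≤s; _∸_; ⌊_/2⌋; ⌈_/2⌉)
import Data.Nat.DivMod as ℕ
import Data.Nat.Properties as ℕ
open import Data.Nat.Properties
  using (≤-trans; ≤-reflexive; ≤-refl; ≤-pred; <⇒≤; <⇒≱; ≰⇒>; ≮⇒≥; *-monoʳ-≤; *-monoˡ-≤; *-mono-≤; +-mono-≤; +-monoʳ-≤; +-monoˡ-≤;
    m≤m+n; m≤n+m; ^-monoˡ-≤; ^-monoʳ-≤; ^-monoʳ-<; m^n≢0; m^n>0; ^-distribˡ-+-*; ^-*-assoc; n≮0; ≤-<-trans; m≤n⇒m≤1+n; m∸n≤m)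
open import Data.Nat.Tactic.RingSolver using (solve-∀)
open import Data.Product using (∃; _×_; _,_; proj₁; proj₂)
open import Data.Product.Properties using (≡-dec)
open import Data.Rational using (ℚ; ∣_∣; _/_)
import Data.Rational as ℚ
import Data.Rational.Properties as ℚ
import Data.Rational.Unnormalised as ℚᵘ
import Data.Rational.Unnormalised.Properties as ℚᵘ
open import Data.Sum as Sum using (_⊎_; inj₁; inj₂)
open import Function using (_∘_; id)
open import Function.Bundles using (mk⇔)
open import Relation.Nullary using (¬_; Dec; yes; no; does)
open import Relation.Nullary.Decidable using (map′; _×-dec_; ¬?)
open import Relation.Binary.PropositionalEquality as ≡
  using (_≡_; _≢_; refl; cong; cong₂; sym; trans; subst; subst₂)


-- Prescribing which primes divide X and Y + X fixes X modulo a divisor of Q and leaves it free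
-- modulo the complement, of degree `freeDegree X`. If this degree is at least h, spacing allows
-- q^(`freeDegree X` - h) such X, and H is saved at once. The obstacle is a degree below h: one X
-- per class is then all that spacing gives. There, of the primes dividing Y but not X, only the
-- total degree k is prescribed. The larger class has at most q^(`freeDegree′ X` + 2k - h) members,
-- while at each of these primes the weight is κ² in place of |P|², a factor q^(-2k) in total; the
-- two effects cancel and 1/H remains. The condition d(Y) ≤ d(X) guarantees `freeDegree′ X` + 2k ≥
-- h.
--
-- Each merging turns the numerator κ carried by the primes into κ(κ + 2), so bounds are proved for
-- general κ. The factors O(H^ε) are products of 1 + μ/|P| and of μ over sets of primes; primes of
-- degree at most M cost a constant, larger ones a small power of H.
--
-- A sum Λ of characters, integral but not multiplicative, replaces a single one; so powers of the
-- deviation are expanded one factor at a time, with a shift in the argument of Λ.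

-- Bijections and injections between duplicate-free lists

module _ {A B : Set} where

  map-unique : {f : A → B} {xs : List A} →
    (∀ {x y} → x ∈ xs → y ∈ xs → f x ≡ f y → x ≡ y) → Unique xs → Unique (map f xs)
  map-unique inj [] = []
  map-unique {f} {x ∷ xs} inj (x∉ ∷ u) =
    All.tabulate distinct ∷ map-unique (λ p q → inj (there p) (there q)) u
    where
    distinct : ∀ {z} → z ∈ map f xs → f x ≢ z
    distinct z∈ fx≡z with ∈-map⁻ f z∈
    ... | y , y∈ , z≡fy = All.lookup x∉ y∈ (inj (here refl) (there y∈) (trans fx≡z z≡fy))

  -- Both lists are duplicate-free, so having the same members makes them permutations of each
  -- other. Every change of summation variable below rests on this.
  map-↭ : {xs : List A} {ys : List B} (φ : A → B) (ψ : B → A) → Unique xs → Unique ys →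
    (∀ {x} → x ∈ xs → φ x ∈ ys) → (∀ {y} → y ∈ ys → ψ y ∈ xs) →
    (∀ {x} → x ∈ xs → ψ (φ x) ≡ x) → (∀ {y} → y ∈ ys → φ (ψ y) ≡ y) → map φ xs ↭ ys
  map-↭ {xs} {ys} φ ψ u v φ∈ ψ∈ ψφ φψ =
    ∼bag⇒↭ (unique∧set⇒bag (map-unique inj u) v (mk⇔ to from))
    where
    inj : ∀ {x y} → x ∈ xs → y ∈ xs → φ x ≡ φ y → x ≡ y
    inj p q e = trans (sym (ψφ p)) (trans (cong ψ e) (ψφ q))
    to : ∀ {z} → z ∈ map φ xs → z ∈ ys
    to z∈ with ∈-map⁻ φ z∈
    ... | x , x∈ , z≡φx = subst (_∈ ys) (sym z≡φx) (φ∈ x∈)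
    from : ∀ {z} → z ∈ ys → z ∈ map φ xs
    from z∈ = subst (_∈ map φ xs) (φψ z∈) (∈-map⁺ φ (ψ∈ z∈))

module _ {A : Set} where

  private
    remove : {x : A} {xs : List A} → x ∈ xs → List A
    remove {xs = _ ∷ xs} (here _) = xs
    remove {xs = y ∷ _} (there p) = y ∷ remove p

    length-remove : {x : A} {xs : List A} (p : x ∈ xs) → length xs ≡ suc (length (remove p))
    length-remove (here _) = refl
    length-remove (there p) = cong suc (length-remove p)

    ∈-remove : {x y : A} {xs : List A} (p : x ∈ xs) → y ∈ xs → x ≢ y → y ∈ remove p
    ∈-remove (here refl) (here refl) x≢y = ⊥-elim (x≢y refl)
    ∈-remove (here _) (there q) _ = q
    ∈-remove (there p) (here e) _ = here e
    ∈-remove (there p) (there q) x≢y = there (∈-remove p q x≢y)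

  unique-⊆⇒length-≤ : {xs ys : List A} → Unique xs → (∀ {x} → x ∈ xs → x ∈ ys) →
    length xs ≤ length ys
  unique-⊆⇒length-≤ [] _ = z≤n
  unique-⊆⇒length-≤ {x ∷ xs} {ys} (x∉ ∷ u) sub = subst (suc (length xs) ≤_)
    (sym (length-remove (sub (here refl))))
    (s≤s (unique-⊆⇒length-≤ u λ p → ∈-remove (sub (here refl)) (sub (there p)) (All.lookup x∉ p)))

-- Identities and finite sums over commutative semirings

module SemiringIdentities (R : CommutativeSemiring 0ℓ 0ℓ) where
  open CommutativeSemiring R renaming (_+_ to _⊕_; _*_ to _·_; refl to ≈-refl; sym to ≈-sym; trans to ≈-trans)
  open import Algebra.Solver.Ring.NaturalCoefficients.Default R

  +-rotate : ∀ y z n → (y ⊕ z) ⊕ n ≈ z ⊕ (y ⊕ n)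
  +-rotate = solve 3 (λ y z n → (y :+ z) :+ n := z :+ (y :+ n)) ≈-refl

  +-rearrange : ∀ u v w x → u ⊕ (v ⊕ (w ⊕ x)) ≈ (w ⊕ u) ⊕ (v ⊕ x)
  +-rearrange = solve 4 (λ u v w x → u :+ (v :+ (w :+ x)) := (w :+ u) :+ (v :+ x)) ≈-refl

  +-cancel-middle : ∀ u v w x → u ⊕ x ≈ 0# → ((u ⊕ v) ⊕ w) ⊕ x ≈ v ⊕ w
  +-cancel-middle u v w x u+x≈0 = ≈-trans
    (solve 4 (λ u v w x → ((u :+ v) :+ w) :+ x := (v :+ w) :+ (u :+ x)) ≈-refl u v w x)
    (≈-trans (+-congˡ u+x≈0) (+-identityʳ _))

  bezout-step : ∀ v m b r u n → v · (m · b ⊕ r) ⊕ (u ⊕ n) · b ≈ (u · b ⊕ v · r) ⊕ (v · m ⊕ n) · b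
  bezout-step = solve 6 (λ v m b r u n →
    v :* (m :* b :+ r) :+ (u :+ n) :* b := (u :* b :+ v :* r) :+ (v :* m :+ n) :* b) ≈-refl

  factorˡ : ∀ e u p v g → (e · u) · p ⊕ (e · v) · g ≈ e · (u · p ⊕ v · g)
  factorˡ = solve 5 (λ e u p v g → (e :* u) :* p :+ (e :* v) :* g := e :* (u :* p :+ v :* g)) ≈-refl

  split-multiple : ∀ c d r x e → (c · d ⊕ r) · (x · e) ≈ (c · x) · (e · d) ⊕ (r · e) · x
  split-multiple = solve 5 (λ c d r x e →
    (c :* d :+ r) :* (x :* e) := (c :* x) :* (e :* d) :+ (r :* e) :* x) ≈-refl

  move-left : ∀ p e d r → ((p · e) · d) · r ≈ (e · d) · (p · r)
  move-left = solve 4 (λ p e d r → ((p :* e) :* d) :* r := (e :* d) :* (p :* r)) ≈-refl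

  move-right : ∀ p e d r → (e · (p · d)) · r ≈ (e · d) · (p · r)
  move-right = solve 4 (λ p e d r → (e :* (p :* d)) :* r := (e :* d) :* (p :* r)) ≈-refl

  factorʳ : ∀ u b p v a → (u · b) · p ⊕ v · (a · b) ≈ (u · p ⊕ v · a) · b
  factorʳ = solve 5 (λ u b p v a → (u :* b) :* p :+ v :* (a :* b) := (u :* p :+ v :* a) :* b) ≈-refl

  factorʳ′ : ∀ u p r v g → u · (p · r) ⊕ (r · v) · g ≈ (u · p ⊕ v · g) · r
  factorʳ′ = solve 5 (λ u p r v g → u :* (p :* r) :+ (r :* v) :* g := (u :* p :+ v :* g) :* r) ≈-refl

module Summation (R : CommutativeSemiring 0ℓ 0ℓ) where
  open CommutativeSemiring R renaming (_+_ to _⊕_; _*_ to _·_; refl to ≈-refl; sym to ≈-sym; trans to ≈-trans)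
  import Relation.Binary.Reasoning.Setoid setoid as ≈-Reasoning
  open ≈-Reasoning

  private variable A B C : Set

  ∑ : List A → (A → Carrier) → Carrier
  ∑ [] f = 0#
  ∑ (x ∷ xs) f = f x ⊕ ∑ xs f

  ∏ : List A → (A → Carrier) → Carrier
  ∏ [] f = 1#
  ∏ (x ∷ xs) f = f x · ∏ xs f

  ⟦_⟧ : {P : Set} → Dec P → Carrier
  ⟦ d ⟧ = if does d then 1# else 0#

  ⟦⟧-true : {P : Set} (d : Dec P) → P → ⟦ d ⟧ ≈ 1#
  ⟦⟧-true (yes _) p = ≈-refl
  ⟦⟧-true (no ¬p) p = ⊥-elim (¬p p)

  ⟦⟧-false : {P : Set} (d : Dec P) → ¬ P → ⟦ d ⟧ ≈ 0#
  ⟦⟧-false (yes p) ¬p = ⊥-elim (¬p p)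
  ⟦⟧-false (no _) ¬p = ≈-refl

  ⟦⟧-⇔ : {P Q : Set} (d : Dec P) (e : Dec Q) → (P → Q) → (Q → P) → ⟦ d ⟧ ≈ ⟦ e ⟧
  ⟦⟧-⇔ (yes p) e f g = ≈-sym (⟦⟧-true e (f p))
  ⟦⟧-⇔ (no ¬p) e f g = ≈-sym (⟦⟧-false e (¬p ∘ g))

  ∑-cong-∈ : {f g : A → Carrier} (xs : List A) → (∀ {x} → x ∈ xs → f x ≈ g x) → ∑ xs f ≈ ∑ xs g
  ∑-cong-∈ [] _ = ≈-refl
  ∑-cong-∈ (x ∷ xs) e = +-cong (e (here refl)) (∑-cong-∈ xs (e ∘ there))

  ∑-cong : {f g : A → Carrier} (xs : List A) → (∀ x → f x ≈ g x) → ∑ xs f ≈ ∑ xs g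
  ∑-cong xs e = ∑-cong-∈ xs (λ {x} _ → e x)

  ∏-cong-∈ : {f g : A → Carrier} (xs : List A) → (∀ {x} → x ∈ xs → f x ≈ g x) → ∏ xs f ≈ ∏ xs g
  ∏-cong-∈ [] _ = ≈-refl
  ∏-cong-∈ (x ∷ xs) e = *-cong (e (here refl)) (∏-cong-∈ xs (e ∘ there))

  ∏-cong : {f g : A → Carrier} (xs : List A) → (∀ x → f x ≈ g x) → ∏ xs f ≈ ∏ xs g
  ∏-cong xs e = ∏-cong-∈ xs (λ {x} _ → e x)

  ∑-0 : (xs : List A) → ∑ xs (λ _ → 0#) ≈ 0#
  ∑-0 [] = ≈-refl
  ∑-0 (x ∷ xs) = ≈-trans (+-identityˡ _) (∑-0 xs)

  private
    interchange : ∀ a b c d → (a ⊕ b) ⊕ (c ⊕ d) ≈ (a ⊕ c) ⊕ (b ⊕ d)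
    interchange a b c d = begin
      (a ⊕ b) ⊕ (c ⊕ d)  ≈⟨ +-assoc a b _ ⟩
      a ⊕ (b ⊕ (c ⊕ d))  ≈⟨ +-congˡ (≈-sym (+-assoc b c d)) ⟩
      a ⊕ ((b ⊕ c) ⊕ d)  ≈⟨ +-congˡ (+-congʳ (+-comm b c)) ⟩
      a ⊕ ((c ⊕ b) ⊕ d)  ≈⟨ +-congˡ (+-assoc c b d) ⟩
      a ⊕ (c ⊕ (b ⊕ d))  ≈⟨ ≈-sym (+-assoc a c _) ⟩
      (a ⊕ c) ⊕ (b ⊕ d)  ∎

    interchange* : ∀ a b c d → (a · b) · (c · d) ≈ (a · c) · (b · d)
    interchange* a b c d = begin
      (a · b) · (c · d)  ≈⟨ *-assoc a b _ ⟩
      a · (b · (c · d))  ≈⟨ *-congˡ (≈-sym (*-assoc b c d)) ⟩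
      a · ((b · c) · d)  ≈⟨ *-congˡ (*-congʳ (*-comm b c)) ⟩
      a · ((c · b) · d)  ≈⟨ *-congˡ (*-assoc c b d) ⟩
      a · (c · (b · d))  ≈⟨ ≈-sym (*-assoc a c _) ⟩
      (a · c) · (b · d)  ∎

  ∑-+ : (xs : List A) (f g : A → Carrier) → ∑ xs (λ x → f x ⊕ g x) ≈ ∑ xs f ⊕ ∑ xs g
  ∑-+ [] f g = ≈-sym (+-identityˡ 0#)
  ∑-+ (x ∷ xs) f g = ≈-trans (+-congˡ (∑-+ xs f g)) (interchange _ _ _ _)

  ∏-* : (xs : List A) (f g : A → Carrier) → ∏ xs (λ x → f x · g x) ≈ ∏ xs f · ∏ xs g
  ∏-* [] f g = ≈-sym (*-identityˡ 1#)
  ∏-* (x ∷ xs) f g = ≈-trans (*-congˡ (∏-* xs f g)) (interchange* _ _ _ _)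

  ∑-*ˡ : (c : Carrier) (xs : List A) (f : A → Carrier) → ∑ xs (λ x → c · f x) ≈ c · ∑ xs f
  ∑-*ˡ c [] f = ≈-sym (zeroʳ c)
  ∑-*ˡ c (x ∷ xs) f = ≈-trans (+-congˡ (∑-*ˡ c xs f)) (≈-sym (distribˡ c _ _))

  ∑-*ʳ : (c : Carrier) (xs : List A) (f : A → Carrier) → ∑ xs (λ x → f x · c) ≈ ∑ xs f · c
  ∑-*ʳ c xs f = ≈-trans (∑-cong xs (λ x → *-comm (f x) c)) (≈-trans (∑-*ˡ c xs f) (*-comm c _))

  ∑-swap : (xs : List A) (ys : List B) (f : A → B → Carrier) →
    ∑ xs (λ x → ∑ ys (f x)) ≈ ∑ ys (λ y → ∑ xs (λ x → f x y))
  ∑-swap [] ys f = ≈-sym (∑-0 ys)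
  ∑-swap (x ∷ xs) ys f = ≈-trans (+-congˡ (∑-swap xs ys f)) (≈-sym (∑-+ ys (f x) _))

  ∑-++ : (xs ys : List A) (f : A → Carrier) → ∑ (xs ++ ys) f ≈ ∑ xs f ⊕ ∑ ys f
  ∑-++ [] ys f = ≈-sym (+-identityˡ _)
  ∑-++ (x ∷ xs) ys f = ≈-trans (+-congˡ (∑-++ xs ys f)) (≈-sym (+-assoc _ _ _))

  ∑-map : (g : A → B) (xs : List A) (f : B → Carrier) → ∑ (map g xs) f ≈ ∑ xs (f ∘ g)
  ∑-map g [] f = ≈-refl
  ∑-map g (x ∷ xs) f = +-congˡ (∑-map g xs f)

  ∑-concatMap : (g : A → List B) (xs : List A) (f : B → Carrier) →
    ∑ (concatMap g xs) f ≈ ∑ xs (λ x → ∑ (g x) f)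
  ∑-concatMap g [] f = ≈-refl
  ∑-concatMap g (x ∷ xs) f = ≈-trans (∑-++ (g x) _ f) (+-congˡ (∑-concatMap g xs f))

  ∑-↭ : {xs ys : List A} (f : A → Carrier) → xs ↭ ys → ∑ xs f ≈ ∑ ys f
  ∑-↭ f ↭.refl = ≈-refl
  ∑-↭ f (↭.prep x p) = +-congˡ (∑-↭ f p)
  ∑-↭ f (↭.swap {xs} {ys} x y p) = begin
    f x ⊕ (f y ⊕ ∑ xs f)  ≈⟨ ≈-sym (+-assoc _ _ _) ⟩
    (f x ⊕ f y) ⊕ ∑ xs f  ≈⟨ +-cong (+-comm _ _) (∑-↭ f p) ⟩
    (f y ⊕ f x) ⊕ ∑ ys f  ≈⟨ +-assoc _ _ _ ⟩
    f y ⊕ (f x ⊕ ∑ ys f)  ∎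
  ∑-↭ f (↭.trans p p′) = ≈-trans (∑-↭ f p) (∑-↭ f p′)

  ∑-reindex : {xs : List A} {ys : List B} (φ : A → B) (f : B → Carrier) → map φ xs ↭ ys →
    ∑ xs (f ∘ φ) ≈ ∑ ys f
  ∑-reindex {xs = xs} φ f p = ≈-trans (≈-sym (∑-map φ xs f)) (∑-↭ f p)

  ∑-filter : {P : A → Set} (P? : ∀ x → Dec (P x)) (xs : List A) (f : A → Carrier) →
    ∑ (filter P? xs) f ≈ ∑ xs (λ x → ⟦ P? x ⟧ · f x)
  ∑-filter P? [] f = ≈-refl
  ∑-filter P? (x ∷ xs) f with does (P? x)
  ... | true = +-cong (≈-sym (*-identityˡ _)) (∑-filter P? xs f)
  ... | false = ≈-trans (∑-filter P? xs f)
    (≈-trans (≈-sym (+-identityˡ _)) (+-congʳ (≈-sym (zeroˡ _))))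

  ∑-kronecker : {xs : List A} (_≟_ : (x y : A) → Dec (x ≡ y)) (f : A → Carrier) {x : A} →
    Unique xs → x ∈ xs → ∑ xs (λ y → ⟦ y ≟ x ⟧ · f y) ≈ f x
  ∑-kronecker {xs = y ∷ ys} _≟_ f {x} (y∉ ∷ u) (here refl) = begin
    ⟦ x ≟ x ⟧ · f x ⊕ ∑ ys (λ y → ⟦ y ≟ x ⟧ · f y)
      ≈⟨ +-cong (≈-trans (*-congʳ (⟦⟧-true (x ≟ x) refl)) (*-identityˡ _))
         (≈-trans (∑-cong-∈ ys λ {z} z∈ → ≈-trans (*-congʳ (⟦⟧-false (z ≟ x)
            (λ e → All.lookup y∉ z∈ (sym e)))) (zeroˡ _)) (∑-0 ys)) ⟩
    f x ⊕ 0#  ≈⟨ +-identityʳ _ ⟩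
    f x ∎
  ∑-kronecker {xs = y ∷ ys} _≟_ f {x} (y∉ ∷ u) (there p) = begin
    ⟦ y ≟ x ⟧ · f y ⊕ ∑ ys (λ y → ⟦ y ≟ x ⟧ · f y)
      ≈⟨ +-cong (≈-trans (*-congʳ (⟦⟧-false (y ≟ x) (All.lookup y∉ p))) (zeroˡ _))
         (∑-kronecker _≟_ f u p) ⟩
    0# ⊕ f x  ≈⟨ +-identityˡ _ ⟩
    f x ∎

  choices : (A → List C) → List A → List (List C)
  choices al [] = [] ∷ []
  choices al (p ∷ ps) = concatMap (λ c → map (c ∷_) (choices al ps)) (al p)

  ∏zip : (A → C → Carrier) → List A → List C → Carrier
  ∏zip loc (p ∷ ps) (c ∷ cs) = loc p c · ∏zip loc ps cs
  ∏zip loc _ _ = 1#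

  -- Distributivity, read as an Euler product: a sum over all assignments of local data factors over
  -- the primes.
  ∑-choices : (al : A → List C) (loc : A → C → Carrier) (ps : List A) →
    ∑ (choices al ps) (∏zip loc ps) ≈ ∏ ps (λ p → ∑ (al p) (loc p))
  ∑-choices al loc [] = +-identityʳ 1#
  ∑-choices al loc (p ∷ ps) = begin
    ∑ (concatMap (λ c → map (c ∷_) (choices al ps)) (al p)) (∏zip loc (p ∷ ps))
      ≈⟨ ∑-concatMap _ (al p) _ ⟩
    ∑ (al p) (λ c → ∑ (map (c ∷_) (choices al ps)) (∏zip loc (p ∷ ps)))
      ≈⟨ ∑-cong (al p) (λ c → ≈-trans (∑-map (c ∷_) (choices al ps) _)
           (≈-trans (∑-*ˡ (loc p c) (choices al ps) _) (*-congˡ (∑-choices al loc ps)))) ⟩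
    ∑ (al p) (λ c → loc p c · ∏ ps (λ p → ∑ (al p) (loc p)))
      ≈⟨ ∑-*ʳ _ (al p) (loc p) ⟩
    ∑ (al p) (loc p) · ∏ ps (λ p → ∑ (al p) (loc p)) ∎

  ∏zip-map : (loc : A → C → Carrier) (col : A → C) (ps : List A) →
    ∏zip loc ps (map col ps) ≈ ∏ ps (λ p → loc p (col p))
  ∏zip-map loc col [] = ≈-refl
  ∏zip-map loc col (p ∷ ps) = *-congˡ (∏zip-map loc col ps)

  map∈choices : (al : A → List C) (col : A → C) (ps : List A) →
    (∀ {p} → p ∈ ps → col p ∈ al p) → map col ps ∈ choices al ps
  map∈choices al col [] _ = here refl
  map∈choices al col (p ∷ ps) h =
    ∈-concatMap⁺ (λ c → map (c ∷_) (choices al ps))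
      (Any.map (λ { refl → ∈-map⁺ _ (map∈choices al col ps (h ∘ there)) }) (h (here refl)))

open Summation ℕ.+-*-commutativeSemiring public
module Σℤ = Summation (CommutativeRing.commutativeSemiring ℤ.+-*-commutativeRing)

module _ {A : Set} where

  ∑-mono-∈ : {f g : A → ℕ} (xs : List A) → (∀ {x} → x ∈ xs → f x ≤ g x) → ∑ xs f ≤ ∑ xs g
  ∑-mono-∈ [] _ = z≤n
  ∑-mono-∈ (x ∷ xs) e = +-mono-≤ (e (here refl)) (∑-mono-∈ xs (e ∘ there))

  ∏-mono-∈ : {f g : A → ℕ} (xs : List A) → (∀ {x} → x ∈ xs → f x ≤ g x) → ∏ xs f ≤ ∏ xs g
  ∏-mono-∈ [] _ = ≤-refl
  ∏-mono-∈ (x ∷ xs) e = *-mono-≤ (e (here refl)) (∏-mono-∈ xs (e ∘ there))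

  term≤∑ : (f : A → ℕ) {xs : List A} {x : A} → x ∈ xs → f x ≤ ∑ xs f
  term≤∑ f (here refl) = m≤m+n _ _
  term≤∑ f {y ∷ _} (there p) = ≤-trans (term≤∑ f p) (m≤n+m _ (f y))

  ∑-const : (c : ℕ) (xs : List A) → ∑ xs (λ _ → c) ≡ length xs * c
  ∑-const c [] = refl
  ∑-const c (x ∷ xs) = cong (c ℕ.+_) (∑-const c xs)

  length-filter : {P : A → Set} (P? : ∀ x → Dec (P x)) (xs : List A) →
    length (filter P? xs) ≡ ∑ xs (λ x → ⟦ P? x ⟧)
  length-filter P? [] = refl
  length-filter P? (x ∷ xs) with does (P? x)
  ... | true = cong suc (length-filter P? xs)
  ... | false = length-filter P? xs

  ∣∑∣≤∑∣∣ : (xs : List A) (f : A → ℤ) → ℤ.∣ Σℤ.∑ xs f ∣ ≤ ∑ xs (λ x → ℤ.∣ f x ∣)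
  ∣∑∣≤∑∣∣ [] f = z≤n
  ∣∑∣≤∑∣∣ (x ∷ xs) f = ≤-trans (ℤ.∣i+j∣≤∣i∣+∣j∣ (f x) _) (+-monoʳ-≤ _ (∣∑∣≤∑∣∣ xs f))

  ∑-+-homo : (xs : List A) (f : A → ℕ) → Σℤ.∑ xs (λ x → + f x) ≡ + ∑ xs f
  ∑-+-homo [] f = refl
  ∑-+-homo (x ∷ xs) f = cong (λ z → + f x ℤ.+ z) (∑-+-homo xs f)

module _ {A K : Set} where

  -- The list `ks` of keys may contain repetitions, hence an inequality.
  ∑-split : (_≟_ : (k l : K) → Dec (k ≡ l)) (key : A → K) (ks : List K) (xs : List A)
    (u : A → ℕ) → (∀ {x} → x ∈ xs → key x ∈ ks) →
    ∑ xs u ≤ ∑ ks (λ k → ∑ (filter (λ x → key x ≟ k) xs) u)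
  ∑-split _≟_ key ks xs u key∈ = begin
    ∑ xs u
      ≤⟨ ∑-mono-∈ xs (λ {x} x∈ → ≤-trans (≤-reflexive (sym (trans
           (cong (_* u x) (⟦⟧-true (key x ≟ key x) refl)) (ℕ.*-identityˡ (u x)))))
           (term≤∑ (λ k → ⟦ key x ≟ k ⟧ * u x) (key∈ x∈))) ⟩
    ∑ xs (λ x → ∑ ks (λ k → ⟦ key x ≟ k ⟧ * u x))
      ≡⟨ ∑-swap xs ks _ ⟩
    ∑ ks (λ k → ∑ xs (λ x → ⟦ key x ≟ k ⟧ * u x))
      ≡⟨ ∑-cong ks (λ k → sym (∑-filter (λ x → key x ≟ k) xs u)) ⟩
    ∑ ks (λ k → ∑ (filter (λ x → key x ≟ k) xs) u) ∎
    where open ℕ.≤-Reasoning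

module _ {A : Set} {P Q : A → Set} (P? : ∀ x → Dec (P x)) (Q? : ∀ x → Dec (Q x)) where

  ∑-cover : (∀ x → P x ⊎ Q x) → (xs : List A) (u : A → ℕ) →
    ∑ xs u ≤ ∑ (filter P? xs) u + ∑ (filter Q? xs) u
  ∑-cover cover xs u = begin
    ∑ xs u
      ≤⟨ ∑-mono-∈ xs (λ {x} _ → pointwise x (cover x)) ⟩
    ∑ xs (λ x → ⟦ P? x ⟧ * u x + ⟦ Q? x ⟧ * u x)
      ≡⟨ ∑-+ xs _ _ ⟩
    ∑ xs (λ x → ⟦ P? x ⟧ * u x) + ∑ xs (λ x → ⟦ Q? x ⟧ * u x)
      ≡⟨ cong₂ _+_ (sym (∑-filter P? xs u)) (sym (∑-filter Q? xs u)) ⟩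
    ∑ (filter P? xs) u + ∑ (filter Q? xs) u ∎
    where
    open ℕ.≤-Reasoning
    one : {R : Set} (d : Dec R) → R → ∀ k → k ≤ ⟦ d ⟧ * k
    one d r k = ≤-reflexive (sym (trans (cong (_* k) (⟦⟧-true d r)) (ℕ.*-identityˡ k)))
    pointwise : ∀ x → P x ⊎ Q x → u x ≤ ⟦ P? x ⟧ * u x + ⟦ Q? x ⟧ * u x
    pointwise x (inj₁ p) = ≤-trans (one (P? x) p (u x)) (m≤m+n _ _)
    pointwise x (inj₂ r) = ≤-trans (one (Q? x) r (u x)) (m≤n+m _ _)

⟦⟧-guard : {P : Set} (d : Dec P) {a b : ℕ} → (P → a ≤ b) → ⟦ d ⟧ * a ≤ ⟦ d ⟧ * b
⟦⟧-guard (yes p) a≤b = *-monoʳ-≤ 1 (a≤b p)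
⟦⟧-guard (no _) _ = z≤n

-- Polynomials over the finite field

module Polynomials (𝔽 : FiniteField) where
  open FiniteField 𝔽 public
    renaming (Carrier to F; _+_ to _+F_; _*_ to _*F_; -_ to -F_)
  open Poly 𝔽 public

  fieldRing : CommutativeRing 0ℓ 0ℓ
  fieldRing = record { isCommutativeRing = isCommutativeRing }

  module F where
    open CommutativeRing fieldRing public hiding (refl; sym; trans)
    open Algebra.Properties.Ring ring public using (-0#≈0#)

  coef : Pol → ℕ → F
  coef [] _ = 0#
  coef (a ∷ f) zero = a
  coef (a ∷ f) (suc i) = coef f i

  infix 4 _≋_
  -- Trailing zeros are invisible to this equality; the record wrapper lets unification recover both
  -- sides from a proof.
  record _≋_ (f g : Pol) : Set where
    constructor ≋-intro
    field at : ∀ i → coef f i ≡ coef g i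
  open _≋_ public

  ≋-refl : ∀ {f} → f ≋ f
  ≋-refl .at i = refl

  ≋-sym : ∀ {f g} → f ≋ g → g ≋ f
  ≋-sym p .at i = sym (p .at i)

  ≋-trans : ∀ {f g h} → f ≋ g → g ≋ h → f ≋ h
  ≋-trans p r .at i = trans (p .at i) (r .at i)

  ≋-reflexive : ∀ {f g} → f ≡ g → f ≋ g
  ≋-reflexive refl = ≋-refl

  ∷-cong : ∀ {a b f g} → a ≡ b → f ≋ g → (a ∷ f) ≋ (b ∷ g)
  ∷-cong e p .at zero = e
  ∷-cong e p .at (suc i) = p .at i

  scale : F → Pol → Pol
  scale a f = map (a *F_) f

  coef-+ : ∀ f g i → coef (f +P g) i ≡ coef f i +F coef g i
  coef-+ [] g i = sym (F.+-identityˡ _)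
  coef-+ (a ∷ f) [] i = sym (F.+-identityʳ _)
  coef-+ (a ∷ f) (b ∷ g) zero = refl
  coef-+ (a ∷ f) (b ∷ g) (suc i) = coef-+ f g i

  coef-scale : ∀ a f i → coef (scale a f) i ≡ a *F coef f i
  coef-scale a [] i = sym (F.zeroʳ a)
  coef-scale a (b ∷ f) zero = refl
  coef-scale a (b ∷ f) (suc i) = coef-scale a f i

  coef-neg : ∀ f i → coef (-P f) i ≡ -F coef f i
  coef-neg [] i = sym F.-0#≈0#
  coef-neg (a ∷ f) zero = refl
  coef-neg (a ∷ f) (suc i) = coef-neg f i

  +-cong : ∀ {f f′ g g′} → f ≋ f′ → g ≋ g′ → (f +P g) ≋ (f′ +P g′)
  +-cong {f} {f′} {g} {g′} p r .at i =
    trans (coef-+ f g i) (trans (cong₂ _+F_ (p .at i) (r .at i)) (sym (coef-+ f′ g′ i)))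

  scale-cong : ∀ {a b f g} → a ≡ b → f ≋ g → scale a f ≋ scale b g
  scale-cong {a} {b} {f} {g} refl p .at i =
    trans (coef-scale a f i) (trans (cong (a *F_) (p .at i)) (sym (coef-scale a g i)))

  neg-cong : ∀ {f g} → f ≋ g → (-P f) ≋ (-P g)
  neg-cong {f} {g} p .at i = trans (coef-neg f i) (trans (cong -F_ (p .at i)) (sym (coef-neg g i)))

  +-assoc : ∀ f g h → ((f +P g) +P h) ≋ (f +P (g +P h))
  +-assoc f g h .at i = trans (coef-+ (f +P g) h i) (trans (cong (_+F _) (coef-+ f g i))
    (trans (F.+-assoc _ _ _) (trans (cong (_ +F_) (sym (coef-+ g h i))) (sym (coef-+ f (g +P h) i)))))

  +-comm : ∀ f g → (f +P g) ≋ (g +P f)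
  +-comm f g .at i = trans (coef-+ f g i) (trans (F.+-comm _ _) (sym (coef-+ g f i)))

  +-identityʳ : ∀ f → (f +P []) ≋ f
  +-identityʳ f .at i = trans (coef-+ f [] i) (F.+-identityʳ _)

  +-inverseʳ : ∀ f → (f -P f) ≋ []
  +-inverseʳ f .at i = trans (coef-+ f (-P f) i)
    (trans (cong (coef f i +F_) (coef-neg f i)) (F.-‿inverseʳ (coef f i)))

  +-interchange : ∀ a b c d → ((a +P b) +P (c +P d)) ≋ ((a +P c) +P (b +P d))
  +-interchange a b c d = ≋-trans (+-assoc a b _) (≋-trans (+-cong (≋-refl {a})
    (≋-trans (≋-sym (+-assoc b c d)) (≋-trans (+-cong (+-comm b c) ≋-refl) (+-assoc c b d))))
    (≋-sym (+-assoc a c _)))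

  scale-+ : ∀ a f g → scale a (f +P g) ≋ (scale a f +P scale a g)
  scale-+ a f g .at i = trans (coef-scale a (f +P g) i) (trans (cong (a *F_) (coef-+ f g i))
    (trans (F.distribˡ a _ _) (sym (trans (coef-+ (scale a f) _ i)
      (cong₂ _+F_ (coef-scale a f i) (coef-scale a g i))))))

  scale-scale : ∀ a b f → scale a (scale b f) ≋ scale (a *F b) f
  scale-scale a b f .at i = trans (coef-scale a (scale b f) i) (trans (cong (a *F_) (coef-scale b f i))
    (trans (sym (F.*-assoc a b _)) (sym (coef-scale _ f i))))

  scale-0 : ∀ f → scale 0# f ≋ []
  scale-0 f .at i = trans (coef-scale 0# f i) (F.zeroˡ _)

  scale-1 : ∀ f → scale 1# f ≋ f
  scale-1 f .at i = trans (coef-scale 1# f i) (F.*-identityˡ _)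

  0∷-zero : ∀ {f} → f ≋ [] → (0# ∷ f) ≋ []
  0∷-zero p .at zero = refl
  0∷-zero p .at (suc i) = p .at i

  0∷-+ : ∀ f g → (0# ∷ (f +P g)) ≋ ((0# ∷ f) +P (0# ∷ g))
  0∷-+ f g = ∷-cong (sym (F.+-identityˡ 0#)) ≋-refl

  0∷-scale : ∀ a f → (0# ∷ scale a f) ≋ scale a (0# ∷ f)
  0∷-scale a f = ∷-cong (sym (F.zeroʳ a)) ≋-refl

  *-congʳ : ∀ f {g g′} → g ≋ g′ → (f *P g) ≋ (f *P g′)
  *-congʳ [] p = ≋-refl
  *-congʳ (a ∷ f) p = +-cong (scale-cong refl p) (∷-cong refl (*-congʳ f p))

  *-zeroʳ : ∀ f → (f *P []) ≋ []
  *-zeroʳ [] = ≋-refl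
  *-zeroʳ (a ∷ f) = 0∷-zero (*-zeroʳ f)

  *-distribˡ : ∀ f g h → (f *P (g +P h)) ≋ ((f *P g) +P (f *P h))
  *-distribˡ [] g h = ≋-refl
  *-distribˡ (a ∷ f) g h = ≋-trans
    (+-cong (scale-+ a g h) (≋-trans (∷-cong refl (*-distribˡ f g h)) (0∷-+ (f *P g) (f *P h))))
    (+-interchange (scale a g) (scale a h) _ _)

  *-∷ : ∀ f b g → (f *P (b ∷ g)) ≋ (scale b f +P (0# ∷ (f *P g)))
  *-∷ [] b g = ≋-sym (0∷-zero ≋-refl)
  *-∷ (a ∷ f) b g .at zero = cong (_+F 0#) (F.*-comm a b)
  *-∷ (a ∷ f) b g .at (suc i) = begin
    coef (scale a g +P (f *P (b ∷ g))) i
      ≡⟨ trans (coef-+ (scale a g) _ i) (cong (_ +F_) (trans (*-∷ f b g .at i) (coef-+ (scale b f) _ i))) ⟩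
    coef (scale a g) i +F (coef (scale b f) i +F coef (0# ∷ (f *P g)) i)
      ≡⟨ trans (sym (F.+-assoc _ _ _)) (trans (cong (_+F coef (0# ∷ (f *P g)) i)
           (F.+-comm (coef (scale a g) i) (coef (scale b f) i))) (F.+-assoc _ _ _)) ⟩
    coef (scale b f) i +F (coef (scale a g) i +F coef (0# ∷ (f *P g)) i)
      ≡⟨ cong (_ +F_) (sym (coef-+ (scale a g) _ i)) ⟩
    coef (scale b f) i +F coef ((a ∷ f) *P g) i
      ≡⟨ sym (coef-+ (scale b f) _ i) ⟩
    coef (scale b f +P ((a ∷ f) *P g)) i ∎
    where open ≡.≡-Reasoning

  *-comm : ∀ f g → (f *P g) ≋ (g *P f)
  *-comm [] g = ≋-sym (*-zeroʳ g)
  *-comm (a ∷ f) g = ≋-trans (+-cong (≋-refl {scale a g}) (∷-cong refl (*-comm f g)))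
    (≋-sym (*-∷ g a f))

  *-cong : ∀ {f f′ g g′} → f ≋ f′ → g ≋ g′ → (f *P g) ≋ (f′ *P g′)
  *-cong {f} {f′} {g} {g′} p r = ≋-trans (*-congʳ f r)
    (≋-trans (*-comm f g′) (≋-trans (*-congʳ g′ p) (*-comm g′ f′)))

  *-distribʳ : ∀ h f g → ((f +P g) *P h) ≋ ((f *P h) +P (g *P h))
  *-distribʳ h f g = ≋-trans (*-comm (f +P g) h)
    (≋-trans (*-distribˡ h f g) (+-cong (*-comm h f) (*-comm h g)))

  scale-* : ∀ a f g → (scale a f *P g) ≋ scale a (f *P g)
  scale-* a [] g = ≋-refl
  scale-* a (b ∷ f) g = ≋-trans
    (+-cong (≋-sym (scale-scale a b g))
      (≋-trans (∷-cong refl (scale-* a f g)) (0∷-scale a (f *P g))))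
    (≋-sym (scale-+ a (scale b g) _))

  0∷-* : ∀ f g → ((0# ∷ f) *P g) ≋ (0# ∷ (f *P g))
  0∷-* f g = +-cong (scale-0 g) ≋-refl

  *-assoc : ∀ f g h → ((f *P g) *P h) ≋ (f *P (g *P h))
  *-assoc [] g h = ≋-refl
  *-assoc (a ∷ f) g h = ≋-trans (*-distribʳ h (scale a g) _)
    (+-cong (scale-* a g h) (≋-trans (0∷-* (f *P g) h) (∷-cong refl (*-assoc f g h))))

  *-identityˡ : ∀ f → (1P *P f) ≋ f
  *-identityˡ f = ≋-trans (+-cong (scale-1 f) (0∷-zero ≋-refl)) (+-identityʳ f)

  polynomialRing : CommutativeRing 0ℓ 0ℓ
  polynomialRing = record
    { Carrier = Pol ; _≈_ = _≋_ ; _+_ = _+P_ ; _*_ = _*P_ ; -_ = -P_ ; 0# = [] ; 1# = 1P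
    ; isCommutativeRing = record
      { isRing = record
        { +-isAbelianGroup = record
          { isGroup = record
            { isMonoid = record
              { isSemigroup = record
                { isMagma = record
                  { isEquivalence = record { refl = ≋-refl ; sym = ≋-sym ; trans = ≋-trans }
                  ; ∙-cong = +-cong }
                ; assoc = +-assoc }
              ; identity = (λ _ → ≋-refl) , +-identityʳ }
            ; inverse = (λ f → ≋-trans (+-comm (-P f) f) (+-inverseʳ f)) , +-inverseʳ
            ; ⁻¹-cong = neg-cong }
          ; comm = +-comm }
        ; *-cong = *-cong
        ; *-assoc = *-assoc
        ; *-identity = *-identityˡ , λ f → ≋-trans (*-comm f 1P) (*-identityˡ f)
        ; distrib = *-distribˡ , *-distribʳ }
      ; *-comm = *-comm } }

  module P where
    open CommutativeRing polynomialRing public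
    open Algebra.Properties.Ring ring public using (-‿distribˡ-*; -0#≈0#; -‿involutive)
    open import Algebra.Properties.AbelianGroup +-abelianGroup public using (⁻¹-∙-comm)
    open SemiringIdentities commutativeSemiring public
    open import Relation.Binary.Reasoning.Setoid setoid public

  -- Degree below `n`, with 0 included for every `n`; this avoids a convention for the degree of 0.
  record Small (n : ℕ) (f : Pol) : Set where
    constructor small-intro
    field vanish : ∀ {i} → n ≤ i → coef f i ≡ 0#
  open Small public

  Small-[] : ∀ {n} → Small n []
  Small-[] .vanish _ = refl

  Small-resp : ∀ {n f g} → f ≋ g → Small n f → Small n g
  Small-resp p s .vanish n≤i = trans (sym (p .at _)) (s .vanish n≤i)

  Small-mono : ∀ {m n f} → m ≤ n → Small m f → Small n f
  Small-mono m≤n s .vanish n≤i = s .vanish (≤-trans m≤n n≤i)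

  Small-+ : ∀ {n f g} → Small n f → Small n g → Small n (f +P g)
  Small-+ {f = f} {g} s t .vanish n≤i = trans (coef-+ f g _)
    (trans (cong₂ _+F_ (s .vanish n≤i) (t .vanish n≤i)) (F.+-identityˡ 0#))

  Small-neg : ∀ {n f} → Small n f → Small n (-P f)
  Small-neg {f = f} s .vanish n≤i = trans (coef-neg f _) (trans (cong -F_ (s .vanish n≤i)) F.-0#≈0#)

  Small-scale : ∀ {n f} a → Small n f → Small n (scale a f)
  Small-scale {f = f} a s .vanish n≤i = trans (coef-scale a f _) (trans (cong (a *F_) (s .vanish n≤i)) (F.zeroʳ a))

  Small-length : ∀ f → Small (length f) f
  Small-length [] .vanish _ = refl
  Small-length (a ∷ f) .vanish (s≤s p) = Small-length f .vanish p

  Small-0 : ∀ {f} → Small 0 f → f ≋ []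
  Small-0 s .at i = s .vanish z≤n

  Small-∷ : ∀ {n a f} → Small n f → Small (suc n) (a ∷ f)
  Small-∷ s .vanish (s≤s p) = s .vanish p

  Small-tail : ∀ {n a f} → Small (suc n) (a ∷ f) → Small n f
  Small-tail s .vanish p = s .vanish (s≤s p)

  Small-* : ∀ f {g m n} → Small (suc m) f → Small (suc n) g → Small (suc (m + n)) (f *P g)
  -- With both degrees bounded, a single term of the convolution reaches index `m + n`.
  coef-* : ∀ f {g m n} → Small (suc m) f → Small (suc n) g →
    coef (f *P g) (m + n) ≡ coef f m *F coef g n

  Small-* [] s t = Small-[]
  Small-* (a ∷ f) {g} {zero} {n} s t = Small-+ (Small-scale a t)
    (Small-resp (≋-sym (0∷-zero (*-cong {f} {[]} (Small-0 (Small-tail s)) (≋-refl {g})))) Small-[])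
  Small-* (a ∷ f) {g} {suc m} {n} s t = Small-+
    (Small-mono (s≤s (m≤n+m n (suc m))) (Small-scale a t))
    (Small-∷ (Small-* f (Small-tail s) t))

  coef-* [] {g} {m} {n} s t = sym (F.zeroˡ _)
  coef-* (a ∷ f) {g} {zero} {n} s t = trans (coef-+ (scale a g) _ n)
    (trans (cong₂ _+F_ (coef-scale a g n)
      (0∷-zero (*-cong {f} {[]} (Small-0 (Small-tail s)) (≋-refl {g})) .at n)) (F.+-identityʳ _))
  coef-* (a ∷ f) {g} {suc m} {n} s t = trans (coef-+ (scale a g) _ (suc (m + n)))
    (trans (cong₂ _+F_ (Small-scale a t .vanish (s≤s (m≤n+m n m))) (coef-* f (Small-tail s) t))
      (F.+-identityˡ _))

  *F-nonzero : ∀ {a b} → a ≢ 0# → b ≢ 0# → a *F b ≢ 0#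
  *F-nonzero {a} {b} a≢0 b≢0 ab≡0 with inverse a a≢0
  ... | c , ac≡1 = b≢0 (begin
    b                ≡⟨ sym (F.*-identityˡ b) ⟩
    1# *F b          ≡⟨ cong (_*F b) (trans (sym ac≡1) (F.*-comm a c)) ⟩
    (c *F a) *F b    ≡⟨ F.*-assoc c a b ⟩
    c *F (a *F b)    ≡⟨ cong (c *F_) ab≡0 ⟩
    c *F 0#          ≡⟨ F.zeroʳ c ⟩
    0#               ∎)
    where open ≡.≡-Reasoning

  record Top (f : Pol) (j : ℕ) : Set where
    constructor top
    field
      leading : coef f j ≢ 0#
      bound : Small (suc j) f
  open Top public

  zero⊎top : ∀ f → f ≋ [] ⊎ ∃ (Top f)
  zero⊎top [] = inj₁ ≋-refl
  zero⊎top (a ∷ f) with zero⊎top f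
  ... | inj₂ (j , t) = inj₂ (suc j , top (leading t) (Small-∷ (bound t)))
  ... | inj₁ f≋[] with a ≟ 0#
  ...   | yes a≡0 = inj₁ (≋-trans (∷-cong a≡0 f≋[]) (0∷-zero ≋-refl))
  ...   | no a≢0 = inj₂ (0 , top a≢0 (Small-∷ (Small-resp (≋-sym f≋[]) Small-[])))

  top≢0 : ∀ {f j} → Top f j → ¬ f ≋ []
  top≢0 t p = leading t (p .at _)

  top-< : ∀ {f j n} → Top f j → Small n f → j < n
  top-< {n = n} t s = ≰⇒> λ n≤j → leading t (s .vanish n≤j)

  top-unique : ∀ {f i j} → Top f i → Top f j → i ≡ j
  top-unique t u = ℕ.≤-antisym (≤-pred (top-< t (bound u))) (≤-pred (top-< u (bound t)))

  top-resp : ∀ {f g j} → f ≋ g → Top f j → Top g j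
  top-resp p t = top (λ e → leading t (trans (p .at _) e)) (Small-resp p (bound t))

  top-* : ∀ {f g i j} → Top f i → Top g j → Top (f *P g) (i + j)
  top-* {f} {g} t u = top
    (λ e → *F-nonzero (leading t) (leading u) (trans (sym (coef-* f (bound t) (bound u))) e))
    (Small-* f (bound t) (bound u))

  _≋0? : ∀ f → Dec (f ≋ [])
  f ≋0? with zero⊎top f
  ... | inj₁ p = yes p
  ... | inj₂ (_ , t) = no (top≢0 t)

  record MonicOfDegree (d : ℕ) (f : Pol) : Set where
    constructor monicOfDegree
    field
      leading≡1 : coef f d ≡ 1#
      small : Small (suc d) f
  open MonicOfDegree public

  monic-top : ∀ {d f} → MonicOfDegree d f → Top f d
  monic-top m = top (λ e → 0≢1 (trans (sym e) (leading≡1 m))) (small m)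

  1P-monic : MonicOfDegree 0 1P
  1P-monic = monicOfDegree refl (Small-∷ Small-[])

  *-monic : ∀ {d e f g} → MonicOfDegree d f → MonicOfDegree e g → MonicOfDegree (d + e) (f *P g)
  *-monic {f = f} m n = monicOfDegree
    (trans (coef-* f (small m) (small n))
      (trans (cong₂ _*F_ (leading≡1 m) (leading≡1 n)) (F.*-identityˡ 1#)))
    (Small-* f (small m) (small n))

  -- Degrees add, a field having no zero divisors, so a nonzero multiple of M has degree at least d.
  Small-multiple : ∀ {d M} c → MonicOfDegree d M → Small d (c *P M) → c ≋ []
  Small-multiple {d} c m s with zero⊎top c
  ... | inj₁ p = p
  ... | inj₂ (j , t) = ⊥-elim (ℕ.<-irrefl refl
    (≤-<-trans (m≤n+m d j) (top-< (top-* t (monic-top m)) s)))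

  -- Horner's scheme: after dividing the tail, `a ∷ r` has degree at most d, and subtracting one
  -- scalar multiple of M removes its coefficient at d.
  divMod : ∀ {d M} → MonicOfDegree d M → ∀ f → ∃ λ c → ∃ λ r → f ≋ ((c *P M) +P r) × Small d r
  divMod m [] = [] , [] , ≋-refl , Small-[]
  divMod {d} {M} m (a ∷ f) with divMod m f
  ... | c , r , f≋cM+r , s = (b ∷ c) , (a ∷ r) -P scale b M , eq , small′
    where
    b = coef (a ∷ r) d
    eq : (a ∷ f) ≋ (((b ∷ c) *P M) +P ((a ∷ r) -P scale b M))
    eq = P.begin
      a ∷ f
        P.≈⟨ ∷-cong (sym (F.+-identityˡ a)) f≋cM+r ⟩
      (0# ∷ (c *P M)) +P (a ∷ r)
        P.≈⟨ P.+-congˡ {0# ∷ (c *P M)} (≋-sym (+-identityʳ (a ∷ r))) ⟩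
      (0# ∷ (c *P M)) +P ((a ∷ r) +P [])
        P.≈⟨ P.+-congˡ {0# ∷ (c *P M)} (P.+-congˡ {a ∷ r} (≋-sym (+-inverseʳ (scale b M)))) ⟩
      (0# ∷ (c *P M)) +P ((a ∷ r) +P (scale b M -P scale b M))
        P.≈⟨ P.+-rearrange (0# ∷ (c *P M)) (a ∷ r) (scale b M) (-P scale b M) ⟩
      (scale b M +P (0# ∷ (c *P M))) +P ((a ∷ r) -P scale b M) P.∎
    small′ : Small d ((a ∷ r) -P scale b M)
    small′ .vanish {i} d≤i with ℕ.m≤n⇒m<n∨m≡n d≤i
    ... | inj₁ d<i = Small-+ (Small-∷ {a = a} s) (Small-neg (Small-scale b (small m))) .vanish d<i
    ... | inj₂ refl = trans (coef-+ (a ∷ r) (-P scale b M) d) (trans (cong (b +F_)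
      (trans (coef-neg (scale b M) d) (cong -F_ (trans (coef-scale b M d)
        (trans (cong (b *F_) (leading≡1 m)) (F.*-identityʳ b)))))) (F.-‿inverseʳ b))

  ≋⇒≡ : ∀ {f g} → length f ≡ length g → f ≋ g → f ≡ g
  ≋⇒≡ {[]} {[]} _ _ = refl
  ≋⇒≡ {a ∷ f} {b ∷ g} e p =
    cong₂ _∷_ (p .at 0) (≋⇒≡ (ℕ.suc-injective e) (≋-intro λ i → p .at (suc i)))

  -- Canonical representative in `allPol n`, padded or cut to exactly `n` coefficients; between such
  -- lists `≋` amounts to `≡`.
  trunc : ℕ → Pol → Pol
  trunc zero f = []
  trunc (suc n) [] = 0# ∷ trunc n []
  trunc (suc n) (a ∷ f) = a ∷ trunc n f

  length-trunc : ∀ n f → length (trunc n f) ≡ n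
  length-trunc zero f = refl
  length-trunc (suc n) [] = cong suc (length-trunc n [])
  length-trunc (suc n) (a ∷ f) = cong suc (length-trunc n f)

  trunc-≋ : ∀ n {f} → Small n f → trunc n f ≋ f
  trunc-≋ zero s = ≋-sym (Small-0 s)
  trunc-≋ (suc n) {[]} s = 0∷-zero (trunc-≋ n Small-[])
  trunc-≋ (suc n) {a ∷ f} s = ∷-cong refl (trunc-≋ n (Small-tail s))

  ∈-allPol⁺ : ∀ {n f} → length f ≡ n → f ∈ allPol n
  ∈-allPol⁺ {zero} {[]} _ = here refl
  ∈-allPol⁺ {suc n} {a ∷ f} e = ∈-concatMap⁺ (λ a → map (a ∷_) (allPol n))
    (Any.map (λ { refl → ∈-map⁺ _ (∈-allPol⁺ (ℕ.suc-injective e)) }) (elements-complete a))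

  ∈-allPol⁻ : ∀ {n f} → f ∈ allPol n → length f ≡ n
  ∈-allPol⁻ {zero} (here refl) = refl
  ∈-allPol⁻ {suc n} {f} f∈ with Any.satisfied (∈-concatMap⁻ (λ a → map (a ∷_) (allPol n)) {xs = elements} f∈)
  ... | a , f∈′ with ∈-map⁻ (a ∷_) f∈′
  ...   | g , g∈ , refl = cong suc (∈-allPol⁻ g∈)

  trunc∈ : ∀ n f → trunc n f ∈ allPol n
  trunc∈ n f = ∈-allPol⁺ (length-trunc n f)

  ∈-Small : ∀ {n f} → f ∈ allPol n → Small n f
  ∈-Small {n} {f} f∈ = subst (λ k → Small k f) (∈-allPol⁻ f∈) (Small-length f)

  ∈-≋⇒≡ : ∀ {n f g} → f ∈ allPol n → g ∈ allPol n → f ≋ g → f ≡ g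
  ∈-≋⇒≡ {n} p r = ≋⇒≡ (trans (∈-allPol⁻ {n} p) (sym (∈-allPol⁻ {n} r)))

  allPol-unique : ∀ n → Unique (allPol n)
  allPol-unique zero = [] ∷ []
  allPol-unique (suc n) = go elements-unique
    where
    disjoint : ∀ {a as} → All (a ≢_) as →
      Disjoint (map (a ∷_) (allPol n)) (concatMap (λ a → map (a ∷_) (allPol n)) as)
    disjoint {a} {as} a∉ (p , r) with ∈-map⁻ (a ∷_) p | ∈-concatMap⁻ (λ a → map (a ∷_) (allPol n)) {xs = as} r
    ... | f , _ , refl | r′ = All.lookupAny a∉ r′ .proj₁ (sym (∷-head (All.lookupAny a∉ r′ .proj₂)))
      where
      ∷-head : ∀ {b} → (a ∷ f) ∈ map (b ∷_) (allPol n) → b ≡ a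
      ∷-head {b} m with ∈-map⁻ (b ∷_) m
      ... | _ , _ , refl = refl
    go : ∀ {as} → Unique as → Unique (concatMap (λ a → map (a ∷_) (allPol n)) as)
    go [] = []
    go (a∉ ∷ u) = Unique.++⁺ (Unique.map⁺ (λ e → List.∷-injectiveʳ e) (allPol-unique n)) (go u) (disjoint a∉)

  length-allPol : ∀ n → length (allPol n) ≡ q ^ n
  length-allPol zero = refl
  length-allPol (suc n) = go elements
    where
    go : ∀ as → length (concatMap (λ a → map (a ∷_) (allPol n)) as) ≡ length as * q ^ n
    go [] = refl
    go (a ∷ as) = trans (List.length-++ (map (a ∷_) (allPol n)))
      (cong₂ _+_ (trans (List.length-map (a ∷_) (allPol n)) (length-allPol n)) (go as))

  2≤q : 2 ≤ q
  2≤q = unique-⊆⇒length-≤ {xs = 0# ∷ 1# ∷ []} ((0≢1 ∷ []) ∷ [] ∷ [])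
    λ { {x} _ → elements-complete x }

  private
    normalize-∷ʳ-0 : ∀ f {a} → a ≡ 0# → normalize (f ∷ʳ a) ≡ normalize f
    normalize-∷ʳ-0 f {a} a≡0 rewrite List.reverse-++ f (a ∷ []) with a ≟ 0#
    ... | yes _ = refl
    ... | no a≢0 = ⊥-elim (a≢0 a≡0)

    normalize-∷ʳ : ∀ f {a} → a ≢ 0# → normalize (f ∷ʳ a) ≡ f ∷ʳ a
    normalize-∷ʳ f {a} a≢0 rewrite List.reverse-++ f (a ∷ []) with a ≟ 0#
    ... | yes a≡0 = ⊥-elim (a≢0 a≡0)
    ... | no _ = trans (List.unfold-reverse a (reverse f)) (cong (_∷ʳ a) (List.reverse-involutive f))

    ∷ʳ-0 : ∀ f {a} → a ≡ 0# → (f ∷ʳ a) ≋ f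
    ∷ʳ-0 [] refl = 0∷-zero ≋-refl
    ∷ʳ-0 (b ∷ f) e = ∷-cong refl (∷ʳ-0 f e)

    ∷ʳ-top : ∀ f {a} → a ≢ 0# → Top (f ∷ʳ a) (length f)
    ∷ʳ-top [] a≢0 = top a≢0 (Small-∷ Small-[])
    ∷ʳ-top (b ∷ f) a≢0 = top (leading (∷ʳ-top f a≢0)) (Small-∷ (bound (∷ʳ-top f a≢0)))

    -- Induction on the length with the last entry split off, because `normalize` strips zeros from
    -- the leading end.
    normalize-view : ∀ n f → length f ≡ n →
      normalize f ≋ f × (normalize f ≡ [] ⊎ ∃ λ g → ∃ λ a → a ≢ 0# × normalize f ≡ g ∷ʳ a)
    normalize-view n f e with initLast f
    normalize-view n .[] e | [] = ≋-refl , inj₁ refl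
    normalize-view zero .(g ∷ʳ a) e | g ∷ʳ′ a =
      ⊥-elim (ℕ.1+n≢0 (trans (sym (trans (List.length-++ g) (ℕ.+-comm _ 1))) e))
    normalize-view (suc n) .(g ∷ʳ a) e | g ∷ʳ′ a with a ≟ 0#
    ... | no a≢0 = ≋-reflexive (normalize-∷ʳ g a≢0) , inj₂ (g , a , a≢0 , normalize-∷ʳ g a≢0)
    ... | yes a≡0 rewrite normalize-∷ʳ-0 g a≡0
      with normalize-view n g (ℕ.suc-injective (trans (sym (trans (List.length-++ g) (ℕ.+-comm _ 1))) e))
    ...   | p , v = ≋-trans p (≋-sym (∷ʳ-0 g a≡0)) , v

  normalize-≋ : ∀ f → normalize f ≋ f
  normalize-≋ f = normalize-view _ f refl .proj₁

  size-zero : ∀ {f} → f ≋ [] → size f ≡ 0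
  size-zero {f} p with normalize-view _ f refl
  ... | r , inj₁ e = cong length e
  ... | r , inj₂ (g , a , a≢0 , e) = ⊥-elim (top≢0 (∷ʳ-top g a≢0)
    (≋-trans (≋-reflexive (sym e)) (≋-trans r p)))

  size-top : ∀ {f j} → Top f j → size f ≡ suc j
  size-top {f} {j} t with normalize-view _ f refl
  ... | r , inj₁ e = ⊥-elim (top≢0 t (≋-trans (≋-sym r) (≋-reflexive e)))
  ... | r , inj₂ (g , a , a≢0 , e) = trans (cong length e) (trans (List.length-++ g)
    (trans (ℕ.+-comm _ 1) (cong suc (top-unique
      (top-resp (≋-trans (≋-reflexive (sym e)) r) (∷ʳ-top g a≢0)) t))))

  ≈P⇒≋ : ∀ {f g} → f ≈P g → f ≋ g
  ≈P⇒≋ {f} {g} e = ≋-trans (≋-sym (normalize-≋ f)) (≋-trans (≋-reflexive e) (normalize-≋ g))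

  ≋⇒≈P : ∀ {f g} → f ≋ g → f ≈P g
  ≋⇒≈P {f} {g} p = ≋⇒≡ size-eq (≋-trans (normalize-≋ f) (≋-trans p (≋-sym (normalize-≋ g))))
    where
    size-eq : size f ≡ size g
    size-eq with zero⊎top f
    ... | inj₁ r = trans (size-zero r) (sym (size-zero (≋-trans (≋-sym p) r)))
    ... | inj₂ (j , t) = trans (size-top t) (sym (size-top (top-resp p t)))

  Monic⇒monicOfDegree : ∀ {f} → Monic f → ∃ λ d → MonicOfDegree d f
  Monic⇒monicOfDegree {f} (g , e) = length g , monicOfDegree
    (trans (f≋ .at (length g)) (last-coef g)) (Small-resp (≋-sym f≋) (bound (∷ʳ-top g 1≢0)))
    where
    1≢0 = λ e → 0≢1 (sym e)
    f≋ : f ≋ g ∷ʳ 1#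
    f≋ = ≋-trans (≋-sym (normalize-≋ f)) (≋-reflexive e)
    last-coef : ∀ g → coef (g ∷ʳ 1#) (length g) ≡ 1#
    last-coef [] = refl
    last-coef (_ ∷ g) = last-coef g

  ∣∣P-top : ∀ {f j} → Top f j → ∣ f ∣P ≡ q ^ j
  ∣∣P-top {f} t with size f | size-top t
  ... | _ | refl = refl

  ∣∣P-zero : ∀ {f} → f ≋ [] → ∣ f ∣P ≡ 0
  ∣∣P-zero {f} p with size f | size-zero p
  ... | _ | refl = refl

  ∣∣P<⇒Small : ∀ {f h} → ∣ f ∣P < q ^ h → Small h f
  ∣∣P<⇒Small {f} {h} lt with zero⊎top f
  ... | inj₁ p = Small-resp (≋-sym p) Small-[]
  ... | inj₂ (j , t) = Small-mono (≰⇒> λ h≤j → <⇒≱ lt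
    (subst (q ^ h ≤_) (sym (∣∣P-top t)) (^-monoʳ-≤ q h≤j))) (bound t)

  Small⇒∣∣P< : ∀ {f h} → Small h f → ∣ f ∣P < q ^ h
  Small⇒∣∣P< {f} {h} s with zero⊎top f
  ... | inj₁ p = subst (_< q ^ h) (sym (∣∣P-zero p)) (m^n>0 q h)
  ... | inj₂ (j , t) = subst (_< q ^ h) (sym (∣∣P-top t)) (^-monoʳ-< q 2≤q (top-< t s))

-- Divisibility, Bezout relations and primes

module Primes (𝔽 : FiniteField) where
  open Polynomials 𝔽 public

  infix 4 _∣_
  record _∣_ (D Z : Pol) : Set where
    constructor divides
    field
      quotient : Pol
      equality : (quotient *P D) ≋ Z
  open _∣_ public

  ∣-refl : ∀ {D} → D ∣ D
  ∣-refl {D} = divides 1P (*-identityˡ D)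

  ∣-reflexive : ∀ {D Z} → D ≋ Z → D ∣ Z
  ∣-reflexive {D} p = divides 1P (≋-trans (*-identityˡ D) p)

  ∣-resp : ∀ {D Y Z} → Y ≋ Z → D ∣ Y → D ∣ Z
  ∣-resp p (divides a e) = divides a (≋-trans e p)

  ∣-[] : ∀ {D} → D ∣ []
  ∣-[] = divides [] ≋-refl

  ∣-*ˡ : ∀ {D Z} A → D ∣ Z → D ∣ A *P Z
  ∣-*ˡ {D} A (divides a e) = divides (A *P a) (≋-trans (*-assoc A a D) (*-congʳ A e))

  ∣-trans : ∀ {D E Z} → D ∣ E → E ∣ Z → D ∣ Z
  ∣-trans d (divides a e) = ∣-resp e (∣-*ˡ a d)

  ∣-+ : ∀ {D Y Z} → D ∣ Y → D ∣ Z → D ∣ Y +P Z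
  ∣-+ {D} (divides a e) (divides b f) = divides (a +P b) (≋-trans (*-distribʳ D a b) (+-cong e f))

  ∣-neg : ∀ {D Z} → D ∣ Z → D ∣ -P Z
  ∣-neg {D} (divides a e) = divides (-P a) (≋-trans (≋-sym (P.-‿distribˡ-* a D)) (neg-cong e))

  ∣-- : ∀ {D Y Z} → D ∣ Y → D ∣ Z → D ∣ Y -P Z
  ∣-- d e = ∣-+ d (∣-neg e)

  ∣-+-cancel : ∀ {D Y Z} → D ∣ Y → D ∣ Y +P Z → D ∣ Z
  ∣-+-cancel {D} {Y} {Z} d e = ∣-resp
    (P.trans (P.+-rotate Y Z (-P Y))
      (P.trans (P.+-congˡ {Z} (+-inverseʳ Y)) (+-identityʳ Z)))
    (∣-- e d)

  ∣P⇒∣ : ∀ {D Z} → D ∣P Z → D ∣ Z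
  ∣P⇒∣ (a , e) = divides a (≈P⇒≋ e)

  ∣⇒∣P : ∀ {D Z} → D ∣ Z → D ∣P Z
  ∣⇒∣P (divides a e) = a , ≋⇒≈P e

  monic-∣? : ∀ {d M} → MonicOfDegree d M → ∀ Z → Dec (M ∣ Z)
  monic-∣? {d} {M} m Z with divMod m Z
  ... | c , r , e , s with r ≋0?
  ...   | yes r≋0 = yes (divides c (≋-sym (≋-trans e (≋-trans (P.+-congˡ {c *P M} r≋0) (+-identityʳ _)))))
  ...   | no r≢0 = no λ M∣Z → r≢0 (remainder-zero
            (∣-+-cancel (divides c ≋-refl) (∣-resp e M∣Z)))
    where
    remainder-zero : M ∣ r → r ≋ []
    remainder-zero (divides a e′) = ≋-trans (≋-sym e′)
      (*-cong {a} {[]} (Small-multiple a m (Small-resp (≋-sym e′) s)) (≋-refl {M}))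

  record Bezout (A B : Pol) : Set where
    constructor bezout
    field
      gcd u v : Pol
      gcd∣ˡ : gcd ∣ A
      gcd∣ʳ : gcd ∣ B
      combination : ((u *P A) +P (v *P B)) ≋ gcd

  -- Euclid's algorithm; `n` bounds the number of coefficients of B and drops with every remainder.
  find-bezout : ∀ n A B → Small n B → Bezout A B
  find-bezout n A B s with zero⊎top B
  ... | inj₁ B≋0 = bezout A 1P [] ∣-refl (∣-resp (≋-sym B≋0) ∣-[])
    (≋-trans (+-identityʳ _) (*-identityˡ A))
  find-bezout zero A B s | inj₂ (j , t) = ⊥-elim (top≢0 t (Small-0 s))
  find-bezout (suc n) A B s | inj₂ (j , t) with inverse (coef B j) (leading t)
  -- Division needs a monic divisor, so B is first divided by its leading coefficient.
  ... | c , bc≡1 with divMod {j} {scale c B} (monicOfDegree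
          (trans (coef-scale c B j) (trans (F.*-comm c _) bc≡1)) (Small-scale c (bound t))) A
  ...   | k , r , A≋ , r-small with find-bezout n B r (Small-mono (≤-pred (top-< t s)) r-small)
  ...     | bezout D u v D∣B D∣r comb = bezout D v (u -P (v *P scale c k)) D∣A D∣B comb′
    where
    A≋′ : A ≋ ((scale c k *P B) +P r)
    A≋′ = ≋-trans A≋ (P.+-congʳ {r} (≋-trans (*-comm k (scale c B)) (≋-trans (scale-* c B k)
      (≋-trans (scale-cong refl (*-comm B k)) (≋-sym (scale-* c k B))))))
    D∣A : D ∣ A
    D∣A = ∣-resp (≋-sym A≋′) (∣-+ (∣-*ˡ (scale c k) D∣B) D∣r)
    m = scale c k
    comb′ : ((v *P A) +P ((u -P (v *P m)) *P B)) ≋ D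
    comb′ = P.begin
      (v *P A) +P ((u +P (-P (v *P m))) *P B)
        P.≈⟨ P.+-congʳ {(u +P (-P (v *P m))) *P B} (*-congʳ v A≋′) ⟩
      (v *P ((m *P B) +P r)) +P ((u +P (-P (v *P m))) *P B)
        P.≈⟨ P.bezout-step v m B r u (-P (v *P m)) ⟩
      ((u *P B) +P (v *P r)) +P (((v *P m) +P (-P (v *P m))) *P B)
        P.≈⟨ P.+-congˡ {(u *P B) +P (v *P r)} (*-cong {(v *P m) -P (v *P m)} {[]} (+-inverseʳ (v *P m)) (≋-refl {B})) ⟩
      ((u *P B) +P (v *P r)) +P []
        P.≈⟨ +-identityʳ _ ⟩
      (u *P B) +P (v *P r)
        P.≈⟨ comb ⟩
      D P.∎

  record Prime : Set where
    field
      pol : Pol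
      degree : ℕ
      monic : MonicOfDegree degree pol
      nonUnit : ¬ pol ∣ 1P
      irreducible : ∀ A B → (A *P B) ≋ pol → (A ∣ 1P) ⊎ (B ∣ 1P)

    norm : ℕ
    norm = q ^ degree

    1≤degree : 1 ≤ degree
    1≤degree with degree | monic
    ... | suc _ | _ = s≤s z≤n
    ... | zero | m = ⊥-elim (nonUnit (∣-reflexive eq))
      where
      eq : pol ≋ 1P
      eq .at zero = leading≡1 m
      eq .at (suc i) = small m .vanish (s≤s z≤n)

    _∣?_ : ∀ Z → Dec (pol ∣ Z)
    _∣?_ = monic-∣? monic

  open Prime public

  Distinct : Prime → Prime → Set
  Distinct p r = ¬ pol p ≋ pol r

  -- By irreducibility the gcd of p and G is a unit or an associate of p, and in the second case p
  -- would divide G.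
  prime-bezout : ∀ p {G} → ¬ pol p ∣ G → ∃ λ u → ∃ λ v → ((u *P pol p) +P (v *P G)) ≋ 1P
  prime-bezout p {G} p∤G with find-bezout _ (pol p) G (Small-length G)
  ... | bezout D u v (divides c cD≋p) D∣G comb with irreducible p c D cD≋p
  ...   | inj₁ (divides c′ c′c≋1) = ⊥-elim (p∤G (∣-trans (divides c′ (P.begin
            c′ *P pol p     P.≈⟨ *-congʳ c′ (≋-sym cD≋p) ⟩
            c′ *P (c *P D)  P.≈⟨ ≋-sym (*-assoc c′ c D) ⟩
            (c′ *P c) *P D  P.≈⟨ *-cong c′c≋1 (≋-refl {D}) ⟩
            1P *P D         P.≈⟨ *-identityˡ D ⟩
            D               P.∎)) D∣G))
  ...   | inj₂ (divides e eD≋1) = (e *P u) , (e *P v) , (P.begin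
            ((e *P u) *P pol p) +P ((e *P v) *P G)
              P.≈⟨ P.factorˡ e u (pol p) v G ⟩
            e *P ((u *P pol p) +P (v *P G))
              P.≈⟨ *-congʳ e comb ⟩
            e *P D  P.≈⟨ eD≋1 ⟩
            1P P.∎)

  -- Multiply the Bezout relation of p and A by B.
  euclid : ∀ p {A B} → pol p ∣ A *P B → ¬ pol p ∣ A → pol p ∣ B
  euclid p {A} {B} p∣AB p∤A with prime-bezout p p∤A
  ... | u , v , comb = ∣-resp (P.begin
      ((u *P B) *P pol p) +P (v *P (A *P B))
        P.≈⟨ P.factorʳ u B (pol p) v A ⟩
      ((u *P pol p) +P (v *P A)) *P B  P.≈⟨ *-cong comb (≋-refl {B}) ⟩
      1P *P B                          P.≈⟨ *-identityˡ B ⟩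
      B                                P.∎)
    (∣-+ (divides (u *P B) ≋-refl) (∣-*ˡ v p∣AB))

  ∏P : List Prime → Pol
  ∏P rs = prodP (map pol rs)

  ∏P-monic : ∀ rs → MonicOfDegree (∑ rs degree) (∏P rs)
  ∏P-monic [] = 1P-monic
  ∏P-monic (p ∷ rs) = *-monic (monic p) (∏P-monic rs)

  ∈⇒∣∏P : ∀ {p rs} → p ∈ rs → pol p ∣ ∏P rs
  ∈⇒∣∏P {p} {_ ∷ rs} (here refl) = divides (∏P rs) (*-comm (∏P rs) (pol p))
  ∈⇒∣∏P {p} {r ∷ rs} (there p∈) = ∣-*ˡ (pol r) (∈⇒∣∏P p∈)

  -- The cofactor is a unit, hence a constant, and comparing the leading coefficients, both 1, shows
  -- that it is 1.
  prime∣prime⇒≋ : ∀ p r → pol p ∣ pol r → pol p ≋ pol r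
  prime∣prime⇒≋ p r (divides c cp≋r) with irreducible r c (pol p) cp≋r
  ... | inj₂ p∣1 = ⊥-elim (nonUnit p p∣1)
  ... | inj₁ (divides c′ c′c≋1) with zero⊎top c | zero⊎top c′
  ...   | inj₁ c≋0 | _ = ⊥-elim (top≢0 (monic-top 1P-monic)
            (≋-trans (≋-sym c′c≋1) (≋-trans (*-congʳ c′ c≋0) (*-zeroʳ c′))))
  ...   | inj₂ _ | inj₁ c′≋0 = ⊥-elim (top≢0 (monic-top 1P-monic)
            (≋-trans (≋-sym c′c≋1) (*-cong c′≋0 (≋-refl {c}))))
  ...   | inj₂ (j , t) | inj₂ (j′ , t′) = ≋-trans (≋-sym (*-identityˡ (pol p)))
            (≋-trans (*-cong {1P} {c} 1≋c (≋-refl {pol p})) cp≋r)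
    where
    j≡0 : j ≡ 0
    j≡0 = ℕ.m+n≡0⇒n≡0 j′ (top-unique (top-* t′ t) (top-resp (≋-sym c′c≋1) (monic-top 1P-monic)))
    c-small : Small 1 c
    c-small = subst (λ k → Small (suc k) c) j≡0 (bound t)
    degree≡ : degree p ≡ degree r
    degree≡ = trans (cong (_+ degree p) (sym j≡0))
      (top-unique (top-* t (monic-top (monic p))) (top-resp (≋-sym cp≋r) (monic-top (monic r))))
    c₀≡1 : coef c 0 ≡ 1#
    c₀≡1 = begin
      coef c 0                             ≡⟨ sym (F.*-identityʳ _) ⟩
      coef c 0 *F 1#                       ≡⟨ cong (coef c 0 *F_) (sym (leading≡1 (monic p))) ⟩
      coef c 0 *F coef (pol p) (degree p)  ≡⟨ sym (coef-* c c-small (small (monic p))) ⟩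
      coef (c *P pol p) (degree p)         ≡⟨ cp≋r .at (degree p) ⟩
      coef (pol r) (degree p)              ≡⟨ cong (coef (pol r)) degree≡ ⟩
      coef (pol r) (degree r)              ≡⟨ leading≡1 (monic r) ⟩
      1#                                   ∎
      where open ≡.≡-Reasoning
    1≋c : 1P ≋ c
    1≋c .at zero = sym c₀≡1
    1≋c .at (suc i) = sym (c-small .vanish (s≤s z≤n))

  ∤∏P : ∀ p rs → All (Distinct p) rs → ¬ pol p ∣ ∏P rs
  ∤∏P p [] [] = nonUnit p
  ∤∏P p (r ∷ rs) (p≢r ∷ p≢rs) p∣ with p ∣? pol r
  ... | yes p∣r = p≢r (prime∣prime⇒≋ p r p∣r)
  ... | no p∤r = ∤∏P p rs p≢rs (euclid p {pol r} {∏P rs} p∣ p∤r)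

  -- Since p cannot divide `∏P rs`, it divides the cofactor of `∏P rs` in Z.
  ∏P-∷∣ : ∀ p rs Z → All (Distinct p) rs → pol p ∣ Z → ∏P rs ∣ Z → ∏P (p ∷ rs) ∣ Z
  ∏P-∷∣ p rs Z p≢ p∣Z R∣Z = divides b (≋-trans (≋-sym (*-assoc b (pol p) (∏P rs)))
      (≋-trans (*-cong bp≋a (≋-refl {∏P rs})) aR≋Z))
    where
    a = quotient R∣Z
    aR≋Z : (a *P ∏P rs) ≋ Z
    aR≋Z = equality R∣Z
    p∣a : pol p ∣ a
    p∣a = euclid p {∏P rs} {a} (∣-resp {pol p} {Z} (≋-trans (≋-sym aR≋Z) (*-comm a (∏P rs))) p∣Z)
      (∤∏P p rs p≢)
    b = quotient p∣a
    bp≋a : (b *P pol p) ≋ a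
    bp≋a = equality p∣a

  ∏P∣ : ∀ rs Z → AllPairs Distinct rs → (∀ {p} → p ∈ rs → pol p ∣ Z) → ∏P rs ∣ Z
  ∏P∣ [] Z _ _ = divides Z (≋-trans (*-comm Z 1P) (*-identityˡ Z))
  ∏P∣ (p ∷ rs) Z (p≢ ∷ ds) all∣ = ∏P-∷∣ p rs Z p≢ (all∣ (here refl)) (∏P∣ rs Z ds (all∣ ∘ there))

  divisorDegree : List Prime → Pol → ℕ
  divisorDegree rs Z = ∑ rs (λ p → ⟦ p ∣? Z ⟧ * degree p)

  -- The product of the primes of `rs` dividing Z divides Z, so a nonzero Z has at least that
  -- degree. Every spacing argument for frequencies rests on this.
  Small-divisorDegree : ∀ {rs Z} → AllPairs Distinct rs → Small (divisorDegree rs Z) Z → Z ≋ []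
  Small-divisorDegree {rs} {Z} ds s = ≋-trans (≋-sym (equality M∣Z)) (*-cong {quotient M∣Z} {[]}
    (Small-multiple (quotient M∣Z) (∏P-monic (filter (_∣? Z) rs))
      (Small-resp (≋-sym (equality M∣Z)) (subst (λ k → Small k Z) (sym (∑-filter (_∣? Z) rs degree)) s)))
    (≋-refl {∏P (filter (_∣? Z) rs)}))
    where
    M∣Z : ∏P (filter (_∣? Z) rs) ∣ Z
    M∣Z = ∏P∣ (filter (_∣? Z) rs) Z (AllPairs.filter⁺ (_∣? Z) ds)
      (λ p∈ → ∈-filter⁻ (_∣? Z) {xs = rs} p∈ .proj₂)

  coprime⇒∤ : ∀ {G Q rs} → Q ≋ ∏P rs → Coprime G Q → ∀ {p} → p ∈ rs → ¬ pol p ∣ G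
  coprime⇒∤ Q≋ cop {p} p∈ p∣G = nonUnit p (∣P⇒∣ (cop (pol p) (∣⇒∣P p∣G)
    (∣⇒∣P (∣-resp (≋-sym Q≋) (∈⇒∣∏P p∈)))))

  -- A common divisor D is stripped of one prime after another: with R the product of the remaining
  -- primes, D divides p R and G, and the Bezout relation of p and G multiplied by R shows that D
  -- divides R.
  ∤⇒coprime : ∀ {G Q rs} → Q ≋ ∏P rs → (∀ {p} → p ∈ rs → ¬ pol p ∣ G) → Coprime G Q
  ∤⇒coprime {G} {Q} {rs} Q≋ ∤G D D∣G D∣Q = ∣⇒∣P (go rs ∤G (∣-resp Q≋ (∣P⇒∣ D∣Q)))
    where
    go : ∀ rs → (∀ {p} → p ∈ rs → ¬ pol p ∣ G) → D ∣ ∏P rs → D ∣ 1P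
    go [] _ d = d
    go (p ∷ rs) ∤G d with prime-bezout p (∤G (here refl))
    ... | u , v , comb = go rs (∤G ∘ there) (∣-resp (P.begin
        (u *P (pol p *P ∏P rs)) +P ((∏P rs *P v) *P G)
          P.≈⟨ P.factorʳ′ u (pol p) (∏P rs) v G ⟩
        ((u *P pol p) +P (v *P G)) *P ∏P rs  P.≈⟨ *-cong comb (≋-refl {∏P rs}) ⟩
        1P *P ∏P rs                          P.≈⟨ *-identityˡ (∏P rs) ⟩
        ∏P rs                                P.∎)
      (∣-+ (∣-*ˡ u d) (∣-*ˡ (∏P rs *P v) (∣P⇒∣ D∣G))))

  -- The product of 1 + μ/|P| over any set `b` of primes is at most L, cleared of denominators. The
  -- set will consist of the divisors of some frequency Y.
  ProductBound : List Prime → ℕ → ℕ → Set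
  ProductBound rs μ L = ∀ (b : Prime → Bool) →
    ∏ rs (λ p → if b p then norm p + μ else 1) ≤ L * ∏ rs (λ p → if b p then norm p else 1)

  -- A divisor-function bound: μ to the number of prime factors, for divisors of Q of degree below
  -- h.
  PowerBound : List Prime → ℕ → ℕ → ℕ → Set
  PowerBound rs h μ Γ = ∀ (b : Prime → Bool) →
    ∑ rs (λ p → if b p then degree p else 0) < h → ∏ rs (λ p → if b p then μ else 1) ≤ Γ

-- Polynomials of bounded degree and the additive character sum

module Vectors (𝔽 : FiniteField) where
  open Primes 𝔽 public

  length-+P : ∀ f g → length f ≡ length g → length (f +P g) ≡ length f
  length-+P [] [] e = refl
  length-+P (a ∷ f) (b ∷ g) e = cong suc (length-+P f g (ℕ.suc-injective e))

  +P∈ : ∀ {n f g} → f ∈ allPol n → g ∈ allPol n → (f +P g) ∈ allPol n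
  +P∈ {n} {f} {g} f∈ g∈ = ∈-allPol⁺ (trans
    (length-+P f g (trans (∈-allPol⁻ {n} f∈) (sym (∈-allPol⁻ {n} g∈)))) (∈-allPol⁻ {n} f∈))

  -P∈ : ∀ {n f} → f ∈ allPol n → (-P f) ∈ allPol n
  -P∈ {n} {f} f∈ = ∈-allPol⁺ (trans (List.length-map _ f) (∈-allPol⁻ {n} f∈))

  scale∈ : ∀ {n f} a → f ∈ allPol n → scale a f ∈ allPol n
  scale∈ {n} {f} a f∈ = ∈-allPol⁺ (trans (List.length-map _ f) (∈-allPol⁻ {n} f∈))

  add-sub : ∀ f g → ((f +P g) -P g) ≋ f
  add-sub f g = ≋-trans (+-assoc f g (-P g)) (≋-trans (+-cong (≋-refl {f}) (+-inverseʳ g)) (+-identityʳ f))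

  sub-add : ∀ f g → ((f -P g) +P g) ≋ f
  sub-add f g = ≋-trans (+-assoc f (-P g) g) (≋-trans (+-cong (≋-refl {f})
    (≋-trans (+-comm (-P g) g) (+-inverseʳ g))) (+-identityʳ f))

  shift-↭ : ∀ {n Y} → Y ∈ allPol n → map (_+P Y) (allPol n) ↭ allPol n
  shift-↭ {n} {Y} Y∈ = map-↭ (_+P Y) (_-P Y) (allPol-unique n) (allPol-unique n)
    (λ f∈ → +P∈ {n} f∈ Y∈) (λ f∈ → +P∈ {n} f∈ (-P∈ {n} Y∈))
    (λ {f} f∈ → ∈-≋⇒≡ {n} (+P∈ {n} (+P∈ {n} f∈ Y∈) (-P∈ {n} Y∈)) f∈ (add-sub f Y))
    (λ {f} f∈ → ∈-≋⇒≡ {n} (+P∈ {n} (+P∈ {n} f∈ (-P∈ {n} Y∈)) Y∈) f∈ (sub-add f Y))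

  cancel-∸ : ∀ f g → f ≋ g → (f -P g) ≋ []
  cancel-∸ f g p = ≋-trans (+-cong p (≋-refl { -P g})) (+-inverseʳ g)

  ∸-zero⇒≋ : ∀ {f g} → (f -P g) ≋ [] → f ≋ g
  ∸-zero⇒≋ {f} {g} p = ≋-trans (≋-sym (sub-add f g)) (+-cong {f -P g} {[]} p (≋-refl {g}))

  -- The difference of the remainders is a multiple of M of degree below d, hence 0.
  divMod-unique : ∀ {d M} → MonicOfDegree d M → ∀ {c r c′ r′} →
    ((c *P M) +P r) ≋ ((c′ *P M) +P r′) → Small d r → Small d r′ → c ≋ c′ × r ≋ r′
  divMod-unique {d} {M} m {c} {r} {c′} {r′} eq s s′ = c≋c′ , r≋r′
    where
    diff : ((c -P c′) *P M) ≋ (r′ -P r)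
    diff = P.begin
      (c -P c′) *P M
        P.≈⟨ *-distribʳ M c (-P c′) ⟩
      (c *P M) +P ((-P c′) *P M)
        P.≈⟨ +-cong (≋-sym (add-sub (c *P M) r)) (≋-sym (P.-‿distribˡ-* c′ M)) ⟩
      (((c *P M) +P r) -P r) +P (-P (c′ *P M))
        P.≈⟨ P.+-congʳ { -P (c′ *P M)} (P.+-congʳ { -P r} eq) ⟩
      (((c′ *P M) +P r′) -P r) +P (-P (c′ *P M))
        P.≈⟨ P.+-cancel-middle (c′ *P M) r′ (-P r) (-P (c′ *P M)) (+-inverseʳ (c′ *P M)) ⟩
      r′ -P r P.∎
    c≋c′ : c ≋ c′
    c≋c′ = ∸-zero⇒≋ (Small-multiple (c -P c′) m (Small-resp (≋-sym diff) (Small-+ s′ (Small-neg s))))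
    r≋r′ : r ≋ r′
    r≋r′ = ≋-sym (∸-zero⇒≋ (≋-trans (≋-sym diff) (*-cong {c -P c′} {[]} (cancel-∸ c c′ c≋c′) (≋-refl {M}))))

  monomial : ℕ → Pol
  monomial zero = 1P
  monomial (suc k) = 0# ∷ monomial k

  monomial-monic : ∀ k → MonicOfDegree k (monomial k)
  monomial-monic zero = 1P-monic
  monomial-monic (suc k) = monicOfDegree (leading≡1 (monomial-monic k)) (Small-∷ (small (monomial-monic k)))

  Small? : ∀ n f → Dec (Small n f)
  Small? n f with zero⊎top f
  ... | inj₁ p = yes (Small-resp (≋-sym p) Small-[])
  ... | inj₂ (j , t) = map′ (λ j<n → Small-mono j<n (bound t)) (top-< t) (j ℕ.<? n)

  -- The sum of the nontrivial additive characters of the field; it is integral, so no roots of unity are needed.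
  Λ : F → ℤ
  Λ s = + q ℤ.* Σℤ.⟦ s ≟ 0# ⟧ ℤ.- 1ℤ

  ∑Λ : Σℤ.∑ elements Λ ≡ 0ℤ
  ∑Λ = begin
    Σℤ.∑ elements Λ
      ≡⟨ Σℤ.∑-+ elements (λ s → + q ℤ.* Σℤ.⟦ s ≟ 0# ⟧) (λ _ → ℤ.- 1ℤ) ⟩
    Σℤ.∑ elements (λ s → + q ℤ.* Σℤ.⟦ s ≟ 0# ⟧) ℤ.+ Σℤ.∑ elements (λ _ → ℤ.- 1ℤ)
      ≡⟨ cong₂ ℤ._+_
           (trans (Σℤ.∑-cong elements (λ s → ℤ.*-comm (+ q) Σℤ.⟦ s ≟ 0# ⟧))
             (Σℤ.∑-kronecker _≟_ (λ _ → + q) elements-unique (elements-complete 0#)))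
           (go elements) ⟩
    + q ℤ.+ ℤ.- (+ q)
      ≡⟨ ℤ.+-inverseʳ (+ q) ⟩
    0ℤ ∎
    where
    open ≡.≡-Reasoning
    go : (as : List F) → Σℤ.∑ as (λ _ → ℤ.- 1ℤ) ≡ ℤ.- (+ length as)
    go [] = refl
    go (a ∷ as) = trans (cong (λ z → (ℤ.- 1ℤ) ℤ.+ z) (go as)) (sym (ℤ.neg-distrib-+ 1ℤ (+ length as)))

  -- The map a ↦ s + a c permutes the field.
  ∑Λ-line : ∀ s {c} → c ≢ 0# → Σℤ.∑ elements (λ a → Λ (s +F (a *F c))) ≡ 0ℤ
  ∑Λ-line s {c} c≢0 with inverse c c≢0
  ... | d , cd≡1 = trans (Σℤ.∑-reindex (λ a → s +F (a *F c)) Λ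
      (map-↭ (λ a → s +F (a *F c)) (λ t → (t +F (-F s)) *F d) elements-unique elements-unique
        (λ _ → elements-complete _) (λ _ → elements-complete _) (λ {a} _ → left a) (λ {t} _ → right t))) ∑Λ
    where
    open ≡.≡-Reasoning
    left : ∀ a → ((s +F (a *F c)) +F (-F s)) *F d ≡ a
    left a = begin
      ((s +F (a *F c)) +F (-F s)) *F d  ≡⟨ cong (λ z → (z +F (-F s)) *F d) (F.+-comm s _) ⟩
      (((a *F c) +F s) +F (-F s)) *F d  ≡⟨ cong (_*F d) (trans (F.+-assoc _ s (-F s))
                                              (trans (cong ((a *F c) +F_) (F.-‿inverseʳ s)) (F.+-identityʳ _))) ⟩
      (a *F c) *F d                     ≡⟨ F.*-assoc a c d ⟩
      a *F (c *F d)                     ≡⟨ cong (a *F_) cd≡1 ⟩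
      a *F 1#                           ≡⟨ F.*-identityʳ a ⟩
      a                                 ∎
    right : ∀ t → s +F (((t +F (-F s)) *F d) *F c) ≡ t
    right t = begin
      s +F (((t +F (-F s)) *F d) *F c)  ≡⟨ cong (s +F_) (trans (F.*-assoc _ d c)
                                              (trans (cong (_ *F_) (trans (F.*-comm d c) cd≡1)) (F.*-identityʳ _))) ⟩
      s +F (t +F (-F s))                ≡⟨ F.+-comm s _ ⟩
      (t +F (-F s)) +F s                ≡⟨ trans (F.+-assoc t _ s) (cong (t +F_) (F.-‿inverseˡ s)) ⟩
      t +F 0#                           ≡⟨ F.+-identityʳ t ⟩
      t                                 ∎

-- Poisson summation modulo Q

module Fourier (𝔽 : FiniteField) (rs : List (Primes.Prime 𝔽))
  (distinct : AllPairs (Primes.Distinct 𝔽) rs) where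
  open Vectors 𝔽

  Q : Pol
  Q = ∏P rs

  m : ℕ
  m = ∑ rs degree

  Q-monic : MonicOfDegree m Q
  Q-monic = ∏P-monic rs

  -- The residue of f / Q at infinity.
  residue : Pol → F
  residue f = coef (divMod Q-monic f .proj₂ .proj₁) (m ∸ 1)

  residue-unique : ∀ {f} c r → f ≋ ((c *P Q) +P r) → Small m r → residue f ≡ coef r (m ∸ 1)
  residue-unique {f} c r e s with divMod Q-monic f
  ... | c′ , r′ , e′ , s′ = divMod-unique Q-monic {c′} {r′} {c} {r} (≋-trans (≋-sym e′) e) s′ s .proj₂ .at (m ∸ 1)

  residue-small : ∀ {f} → Small m f → residue f ≡ coef f (m ∸ 1)
  residue-small {f} s = residue-unique [] f ≋-refl s

  residue-cong : ∀ {f g} → f ≋ g → residue f ≡ residue g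
  residue-cong {f} {g} p with divMod Q-monic g
  ... | c , r , e , s = residue-unique c r (≋-trans p e) s

  residue-+ : ∀ f g → residue (f +P g) ≡ residue f +F residue g
  residue-+ f g with divMod Q-monic f | divMod Q-monic g
  ... | c , r , e , s | c′ , r′ , e′ , s′ = trans
    (residue-unique (c +P c′) (r +P r′)
      (≋-trans (+-cong e e′) (≋-trans (+-interchange (c *P Q) r (c′ *P Q) r′)
        (P.+-congʳ {r +P r′} (≋-sym (*-distribʳ Q c c′))))) (Small-+ s s′))
    (coef-+ r r′ (m ∸ 1))

  residue-scale : ∀ a f → residue (scale a f) ≡ a *F residue f
  residue-scale a f with divMod Q-monic f
  ... | c , r , e , s = trans
    (residue-unique (scale a c) (scale a r)
      (≋-trans (scale-cong refl e) (≋-trans (scale-+ a (c *P Q) r)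
        (P.+-congʳ {scale a r} (≋-sym (scale-* a c Q))))) (Small-scale a s))
    (coef-scale a r (m ∸ 1))

  residue-∣ : ∀ {f} → Q ∣ f → residue f ≡ 0#
  residue-∣ (divides a e) = residue-unique a [] (≋-trans (≋-sym e) (≋-sym (+-identityʳ _))) Small-[]

  -- Since `Λ` is not multiplicative, its value at a sum does not factor. Instead `s` is kept
  -- arbitrary, so that an identity can be applied again with `s` enlarged by a further residue.
  χ : Pol → F → Pol → ℤ
  χ A s X = Λ (s +F residue (A *P X))

  average-zero : ∀ A d s → (∀ {X} → X ∈ allPol d → residue (A *P X) ≡ 0#) →
    Σℤ.∑ (allPol d) (λ X → χ A s X) ≡ + (q ^ d) ℤ.* Λ s
  average-zero A d s vanish = trans
    (Σℤ.∑-cong-∈ (allPol d) (λ X∈ → trans (cong (λ z → Λ (s +F z)) (vanish X∈)) (cong Λ (F.+-identityʳ s))))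
    (trans (go (allPol d)) (cong (λ k → + k ℤ.* Λ s) (length-allPol d)))
    where
    go : (xs : List Pol) → Σℤ.∑ xs (λ _ → Λ s) ≡ + length xs ℤ.* Λ s
    go [] = refl
    go (x ∷ xs) = trans (cong (λ z → Λ s ℤ.+ z) (go xs)) (sym (trans (ℤ.*-distribʳ-+ (Λ s) 1ℤ (+ length xs))
      (cong (ℤ._+ (+ length xs ℤ.* Λ s)) (ℤ.*-identityˡ (Λ s)))))

  -- Translation by each scalar multiple of X₀ permutes `allPol d`; averaged over these multiples,
  -- the argument of `Λ` runs through the whole field, where `Λ` sums to 0.
  average-nonzero : ∀ A d s {X₀} → X₀ ∈ allPol d → residue (A *P X₀) ≢ 0# →
    Σℤ.∑ (allPol d) (λ X → χ A s X) ≡ 0ℤ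
  average-nonzero A d s {X₀} X₀∈ nz = ℤ.*-cancelˡ-≡ (+ q) _ _ (begin
    + q ℤ.* Σℤ.∑ (allPol d) g
      ≡⟨ constant elements ⟩
    Σℤ.∑ elements (λ a → Σℤ.∑ (allPol d) g)
      ≡⟨ Σℤ.∑-cong elements (λ a → sym (Σℤ.∑-reindex (_+P scale a X₀) g (shift-↭ {d} (scale∈ {d} a X₀∈)))) ⟩
    Σℤ.∑ elements (λ a → Σℤ.∑ (allPol d) (λ X → g (X +P scale a X₀)))
      ≡⟨ Σℤ.∑-swap elements (allPol d) _ ⟩
    Σℤ.∑ (allPol d) (λ X → Σℤ.∑ elements (λ a → g (X +P scale a X₀)))
      ≡⟨ Σℤ.∑-cong (allPol d) (λ X → trans (Σℤ.∑-cong elements (λ a → cong Λ (expand X a)))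
           (∑Λ-line (s +F residue (A *P X)) nz)) ⟩
    Σℤ.∑ (allPol d) (λ _ → 0ℤ)
      ≡⟨ Σℤ.∑-0 (allPol d) ⟩
    0ℤ
      ≡⟨ sym (ℤ.*-zeroʳ (+ q)) ⟩
    + q ℤ.* 0ℤ ∎)
    where
    open ≡.≡-Reasoning
    g : Pol → ℤ
    g X = χ A s X
    constant : (as : List F) → + length as ℤ.* Σℤ.∑ (allPol d) g ≡ Σℤ.∑ as (λ _ → Σℤ.∑ (allPol d) g)
    constant [] = refl
    constant (a ∷ as) = trans (ℤ.*-distribʳ-+ S 1ℤ (+ length as)) (cong₂ ℤ._+_ (ℤ.*-identityˡ S) (constant as))
      where S = Σℤ.∑ (allPol d) g
    expand : ∀ X a → s +F residue (A *P (X +P scale a X₀)) ≡ (s +F residue (A *P X)) +F (a *F residue (A *P X₀))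
    expand X a = trans (cong (s +F_) (trans
      (residue-cong (≋-trans (*-distribˡ A X (scale a X₀)) (P.+-congˡ {A *P X}
        (≋-trans (*-comm A (scale a X₀)) (≋-trans (scale-* a X₀ A) (scale-cong refl (*-comm X₀ A)))))))
      (trans (residue-+ (A *P X) _) (cong (residue (A *P X) +F_) (residue-scale a (A *P X₀))))))
      (sym (F.+-assoc s _ _))

  -- The residue of A X is linear in X. It vanishes for all X of degree below d if A X never reaches
  -- degree m - 1; otherwise a monomial lifting A to degree exactly m - 1 reveals the leading
  -- coefficient of A.
  orthogonality : ∀ A d s → Small m A →
    Σℤ.∑ (allPol d) (λ X → χ A s X) ≡ Σℤ.⟦ Small? (m ∸ d) A ⟧ ℤ.* (+ (q ^ d) ℤ.* Λ s)
  orthogonality A d s A-small with Small? (m ∸ d) A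
  ... | yes s′ = trans (average-zero A d s vanishes) (sym (ℤ.*-identityˡ _))
    where
    vanishes : ∀ {X} → X ∈ allPol d → residue (A *P X) ≡ 0#
    vanishes {X} X∈ with zero⊎top A | zero⊎top X
    ... | inj₁ A≋0 | _ = trans (residue-cong (*-cong A≋0 (≋-refl {X}))) (residue-small Small-[])
    ... | inj₂ _ | inj₁ X≋0 = trans (residue-cong (≋-trans (*-congʳ A X≋0) (*-zeroʳ A))) (residue-small Small-[])
    ... | inj₂ (i , t) | inj₂ (j , u) = trans (residue-small (Small-mono (≤-trans i+j<m-1 (m∸n≤m m 1)) prod-small))
        (prod-small .vanish i+j<m-1)
      where
      prod-small : Small (suc (i + j)) (A *P X)
      prod-small = Small-* A (bound t) (bound u)
      i+d<m : i + d < m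
      i+d<m = ℕ.m≤o∸n⇒m+n≤o (suc i) d≤m (top-< t s′)
        where
        d≤m : d ≤ m
        d≤m = <⇒≤ (ℕ.m∸n≢0⇒n<m λ e → n≮0 (subst (i <_) e (top-< t s′)))
      i+j<m-1 : suc (i + j) ≤ m ∸ 1
      i+j<m-1 = ℕ.m+n≤o⇒m≤o∸n (suc (i + j)) (subst (_≤ m) (ℕ.+-comm 1 _)
        (≤-trans (s≤s (ℕ.+-monoʳ-< i (top-< u (∈-Small {d} X∈)))) i+d<m))
  ... | no ¬s with zero⊎top A
  ...   | inj₁ A≋0 = ⊥-elim (¬s (Small-resp (≋-sym A≋0) Small-[]))
  ...   | inj₂ (j , t) = average-nonzero A d s (trunc∈ d (monomial k)) nonzero
    where
    k = m ∸ suc j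
    j<m : j < m
    j<m = top-< t A-small
    m-d≤j : m ∸ d ≤ j
    m-d≤j = ≮⇒≥ λ j< → ¬s (Small-mono j< (bound t))
    j+k : suc j + k ≡ m
    j+k = ℕ.m+[n∸m]≡n j<m
    k<d : k < d
    k<d = ℕ.+-cancelˡ-≤ j (suc k) d (begin
      j + suc k      ≡⟨ ℕ.+-suc j k ⟩
      suc j + k      ≡⟨ j+k ⟩
      m                ≤⟨ ℕ.m≤n+m∸n m d ⟩
      d + (m ∸ d)    ≤⟨ +-monoʳ-≤ d m-d≤j ⟩
      d + j          ≡⟨ ℕ.+-comm d j ⟩
      j + d          ∎)
      where open ℕ.≤-Reasoning
    T = monomial-monic k
    nonzero : residue (A *P trunc d (monomial k)) ≢ 0#
    nonzero e = leading t (begin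
      coef A j                                 ≡⟨ sym (F.*-identityʳ _) ⟩
      coef A j *F 1#                           ≡⟨ cong (coef A j *F_) (sym (leading≡1 T)) ⟩
      coef A j *F coef (monomial k) k          ≡⟨ sym (coef-* A (bound t) (small T)) ⟩
      coef (A *P monomial k) (j + k)         ≡⟨ cong (λ l → coef (A *P monomial k) (l ∸ 1)) j+k ⟩
      coef (A *P monomial k) (m ∸ 1)           ≡⟨ sym (residue-small (subst (λ l → Small l (A *P monomial k)) j+k
                                                     (Small-* A (bound t) (small T)))) ⟩
      residue (A *P monomial k)                ≡⟨ residue-cong (*-congʳ A (≋-sym (trunc-≋ d (Small-mono k<d (small T))))) ⟩
      residue (A *P trunc d (monomial k))      ≡⟨ e ⟩
      0#                                       ∎)
      where open ≡.≡-Reasoning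

  -- weight is |Q| times the Fourier transform of the indicator function cop of the polynomials prime to Q.
  weight cop : List Prime → Pol → ℤ
  weight ps X = Σℤ.∏ ps (λ p → + norm p ℤ.* Σℤ.⟦ p ∣? X ⟧ ℤ.- 1ℤ)
  cop ps G = Σℤ.∏ ps (λ p → 1ℤ ℤ.- Σℤ.⟦ p ∣? G ⟧)

  _∣∏?_ : ∀ es X → Dec (∏P es ∣ X)
  es ∣∏? X = monic-∣? (∏P-monic es) X

  quot : List Prime → Pol → Pol
  quot es X = divMod (∏P-monic es) X .proj₁

  quot-∣ : ∀ es {X} a → (a *P ∏P es) ≋ X → quot es X ≋ a
  quot-∣ es {X} a e with divMod (∏P-monic es) X
  ... | c , r , e′ , s = divMod-unique (∏P-monic es) {c} {r} {a} {[]}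
    (≋-trans (≋-sym e′) (≋-trans (≋-sym e) (≋-sym (+-identityʳ _)))) s Small-[] .proj₁

  -- Multiplication by `∏P es` is a bijection onto the multiples; `trunc` on both sides returns to
  -- canonical representatives.
  multiples : ∀ es ds (g : Pol → ℤ) → (∀ {X Y} → X ≋ Y → g X ≡ g Y) → ∑ es degree + ∑ ds degree ≡ m →
    Σℤ.∑ (allPol m) (λ X → Σℤ.⟦ es ∣∏? X ⟧ ℤ.* g X) ≡ Σℤ.∑ (allPol (∑ ds degree)) (λ X → g (X *P ∏P es))
  multiples es ds g g-cong deg≡ = sym (trans
    (Σℤ.∑-cong-∈ (allPol d) (λ {X} X∈ → g-cong (≋-sym (φ≋ X∈))))
    (trans (Σℤ.∑-reindex φ g (map-↭ φ ψ (allPol-unique d) (Unique.filter⁺ (es ∣∏?_) (allPol-unique m))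
      (λ {X} X∈ → ∈-filter⁺ (es ∣∏?_) (trunc∈ m _) (divides X (≋-sym (φ≋ X∈))))
      (λ _ → trunc∈ d _) ψφ φψ))
      (Σℤ.∑-filter (es ∣∏?_) (allPol m) g)))
    where
    d = ∑ ds degree
    E = ∏P es
    φ ψ : Pol → Pol
    φ X = trunc m (X *P E)
    ψ X = trunc d (quot es X)
    mult-small : ∀ {X} → Small d X → Small m (X *P E)
    mult-small {X} s with zero⊎top X
    ... | inj₁ X≋0 = Small-resp (≋-sym (*-cong X≋0 (≋-refl {E}))) Small-[]
    ... | inj₂ (j , t) = Small-mono (subst (suc (j + ∑ es degree) ≤_)
      (trans (ℕ.+-comm d _) deg≡) (+-monoˡ-≤ (∑ es degree) (top-< t s)))
      (Small-* X (bound t) (small (∏P-monic es)))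
    φ≋ : ∀ {X} → X ∈ allPol d → φ X ≋ (X *P E)
    φ≋ X∈ = trunc-≋ m (mult-small (∈-Small {d} X∈))
    small-quotient : ∀ {X} a → (a *P E) ≋ X → Small m X → Small d a
    small-quotient {X} a e s with zero⊎top a
    ... | inj₁ a≋0 = Small-resp (≋-sym a≋0) Small-[]
    ... | inj₂ (j , t) = Small-mono (ℕ.+-cancelʳ-≤ (∑ es degree) (suc j) d
      (subst (suc (j + ∑ es degree) ≤_) (sym (trans (ℕ.+-comm d _) deg≡))
        (top-< (top-resp e (top-* t (monic-top (∏P-monic es)))) s))) (bound t)
    ψφ : ∀ {X} → X ∈ allPol d → ψ (φ X) ≡ X
    ψφ {X} X∈ = ∈-≋⇒≡ {d} (trunc∈ d _) X∈ (≋-trans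
      (trunc-≋ d (Small-resp (≋-sym (quot-∣ es X (≋-sym (φ≋ X∈)))) (∈-Small {d} X∈)))
      (quot-∣ es X (≋-sym (φ≋ X∈))))
    φψ : ∀ {X} → X ∈ filter (es ∣∏?_) (allPol m) → φ (ψ X) ≡ X
    φψ {X} X∈ with ∈-filter⁻ (es ∣∏?_) {xs = allPol m} X∈
    ... | X∈′ , divides a e = ∈-≋⇒≡ {m} (trunc∈ m _) X∈′ (≋-trans (φ≋ (trunc∈ d _))
      (≋-trans (*-cong (≋-trans (trunc-≋ d (Small-resp (≋-sym (quot-∣ es a e))
        (small-quotient a e (∈-Small {m} X∈′)))) (quot-∣ es a e)) (≋-refl {E})) e))

  -- Poisson summation for one factorization Q = E D. On multiples of E only the remainder r of G
  -- modulo D matters, and `orthogonality` applied to r E detects whether r = 0.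
  subgroup-sum : ∀ es ds G s → (∏P es *P ∏P ds) ≋ Q → ∑ es degree + ∑ ds degree ≡ m →
    Σℤ.∑ (allPol m) (λ X → Σℤ.⟦ es ∣∏? X ⟧ ℤ.* χ G s X)
      ≡ + (q ^ ∑ ds degree) ℤ.* (Σℤ.⟦ ds ∣∏? G ⟧ ℤ.* Λ s)
  subgroup-sum es ds G s ED≋Q deg≡ = trans
    (multiples es ds (λ X → χ G s X)
      (λ {X} {Y} X≋Y → cong (λ z → Λ (s +F z)) (residue-cong (*-congʳ G X≋Y))) deg≡)
    (trans (Σℤ.∑-cong (allPol d) (λ X → cong (λ z → Λ (s +F z)) (reduce X)))
    (trans (orthogonality (r *P E) d s rE-small)
    (trans (cong (ℤ._* (+ (q ^ d) ℤ.* Λ s)) (Σℤ.⟦⟧-⇔ (Small? (m ∸ d) (r *P E)) (ds ∣∏? G) to from))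
      (swap-left Σℤ.⟦ ds ∣∏? G ⟧ (+ (q ^ d)) (Λ s)))))
    where
    d = ∑ ds degree
    E = ∏P es
    D = ∏P ds
    division = divMod (∏P-monic ds) G
    c = division .proj₁
    r = division .proj₂ .proj₁
    G≋ : G ≋ ((c *P D) +P r)
    G≋ = division .proj₂ .proj₂ .proj₁
    r-small : Small d r
    r-small = division .proj₂ .proj₂ .proj₂
    swap-left : ∀ x y z → x ℤ.* (y ℤ.* z) ≡ y ℤ.* (x ℤ.* z)
    swap-left = ℤ-Solver.solve-∀
    reduce : ∀ X → residue (G *P (X *P E)) ≡ residue ((r *P E) *P X)
    reduce X = begin
      residue (G *P (X *P E))
        ≡⟨ residue-cong (≋-trans (*-cong G≋ (≋-refl {X *P E})) (P.split-multiple c D r X E)) ⟩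
      residue (((c *P X) *P (E *P D)) +P ((r *P E) *P X))
        ≡⟨ residue-+ ((c *P X) *P (E *P D)) _ ⟩
      residue ((c *P X) *P (E *P D)) +F residue ((r *P E) *P X)
        ≡⟨ cong (_+F residue ((r *P E) *P X)) (residue-∣ (divides (c *P X) (*-congʳ (c *P X) (≋-sym ED≋Q)))) ⟩
      0# +F residue ((r *P E) *P X)
        ≡⟨ F.+-identityˡ _ ⟩
      residue ((r *P E) *P X) ∎
      where open ≡.≡-Reasoning
    m∸d : m ∸ d ≡ ∑ es degree
    m∸d = trans (cong (_∸ d) (sym deg≡)) (ℕ.m+n∸n≡m _ d)
    rE-small : Small m (r *P E)
    rE-small with zero⊎top r
    ... | inj₁ r≋0 = Small-resp (≋-sym (*-cong r≋0 (≋-refl {E}))) Small-[]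
    ... | inj₂ (j , t) = Small-mono (subst (suc (j + ∑ es degree) ≤_)
      (trans (ℕ.+-comm d _) deg≡) (+-monoˡ-≤ (∑ es degree) (top-< t r-small)))
      (Small-* r (bound t) (small (∏P-monic es)))
    to : Small (m ∸ d) (r *P E) → D ∣ G
    to s′ = divides c (≋-sym (≋-trans G≋ (≋-trans (P.+-congˡ {c *P D}
      (Small-multiple r (∏P-monic es) (subst (λ k → Small k (r *P E)) m∸d s′))) (+-identityʳ _))))
    from : D ∣ G → Small (m ∸ d) (r *P E)
    from (divides a e) = Small-resp (≋-sym (*-cong
      (≋-sym (divMod-unique (∏P-monic ds) {a} {[]} {c} {r} (≋-trans (+-identityʳ _) (≋-trans e G≋))
        Small-[] r-small .proj₂)) (≋-refl {E}))) Small-[]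

  ∣∏?-∷ : ∀ p es X → All (Distinct p) es →
    Σℤ.⟦ p ∣? X ⟧ ℤ.* Σℤ.⟦ es ∣∏? X ⟧ ≡ Σℤ.⟦ (p ∷ es) ∣∏? X ⟧
  ∣∏?-∷ p es X p≢ with es ∣∏? X
  ... | no ¬E = trans (ℤ.*-zeroʳ Σℤ.⟦ p ∣? X ⟧)
    (sym (Σℤ.⟦⟧-false ((p ∷ es) ∣∏? X) λ d → ¬E (∣-trans {∏P es} {∏P (p ∷ es)} {X} (divides (pol p) ≋-refl) d)))
  ... | yes E∣X = trans (ℤ.*-identityʳ _) (Σℤ.⟦⟧-⇔ (p ∣? X) ((p ∷ es) ∣∏? X)
      (λ p∣X → ∏P-∷∣ p es X p≢ p∣X E∣X)
      (∣-trans {pol p} {∏P (p ∷ es)} {X} (divides (∏P es) (*-comm (∏P es) (pol p)))))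

  -- When weight and cop are multiplied out prime by prime, es collects the primes required to divide X
  -- and ds those required to divide G.
  transform-partial : ∀ ps es ds G s → AllPairs Distinct ps →
    (∀ {p} → p ∈ ps → All (Distinct p) es × All (Distinct p) ds) →
    ((∏P es *P ∏P ds) *P ∏P ps) ≋ Q → (∑ es degree + ∑ ds degree) + ∑ ps degree ≡ m →
    Σℤ.∑ (allPol m) (λ X → weight ps X ℤ.* (Σℤ.⟦ es ∣∏? X ⟧ ℤ.* χ G s X))
      ≡ (+ (q ^ ∑ ds degree) ℤ.* + (q ^ ∑ ps degree)) ℤ.* (cop ps G ℤ.* (Σℤ.⟦ ds ∣∏? G ⟧ ℤ.* Λ s))
  transform-partial [] es ds G s _ _ prod≋ deg≡ = trans
    (Σℤ.∑-cong (allPol m) (λ X → ℤ.*-identityˡ _))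
    (trans (subgroup-sum es ds G s
      (≋-trans (≋-sym (≋-trans (*-comm _ 1P) (*-identityˡ _))) prod≋) (trans (sym (ℕ.+-identityʳ _)) deg≡))
      (pad (+ (q ^ ∑ ds degree)) (Σℤ.⟦ ds ∣∏? G ⟧ ℤ.* Λ s)))
    where
    pad : ∀ x y → x ℤ.* y ≡ (x ℤ.* 1ℤ) ℤ.* (1ℤ ℤ.* y)
    pad = ℤ-Solver.solve-∀
  transform-partial (p ∷ ps) es ds G s (p≢ ∷ dist) cross prod≋ deg≡ = begin
    Σℤ.∑ (allPol m) (λ X → weight (p ∷ ps) X ℤ.* (e X ℤ.* g X))
      ≡⟨ Σℤ.∑-cong (allPol m) (λ X → trans (expand (+ norm p) Σℤ.⟦ p ∣? X ⟧ (weight ps X) (e X) (g X))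
           (cong (λ z → + norm p ℤ.* (weight ps X ℤ.* (z ℤ.* g X)) ℤ.+ ℤ.- 1ℤ ℤ.* (weight ps X ℤ.* (e X ℤ.* g X)))
             (∣∏?-∷ p es X (cross (here refl) .proj₁)))) ⟩
    Σℤ.∑ (allPol m) (λ X → + norm p ℤ.* (weight ps X ℤ.* (Σℤ.⟦ (p ∷ es) ∣∏? X ⟧ ℤ.* g X))
                           ℤ.+ ℤ.- 1ℤ ℤ.* (weight ps X ℤ.* (e X ℤ.* g X)))
      ≡⟨ trans (Σℤ.∑-+ (allPol m) _ _) (cong₂ ℤ._+_ (Σℤ.∑-*ˡ (+ norm p) (allPol m) _) (Σℤ.∑-*ˡ (ℤ.- 1ℤ) (allPol m) _)) ⟩
    + norm p ℤ.* Σℤ.∑ (allPol m) (λ X → weight ps X ℤ.* (Σℤ.⟦ (p ∷ es) ∣∏? X ⟧ ℤ.* g X))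
      ℤ.+ ℤ.- 1ℤ ℤ.* Σℤ.∑ (allPol m) (λ X → weight ps X ℤ.* (e X ℤ.* g X))
      ≡⟨ cong₂ (λ x y → + norm p ℤ.* x ℤ.+ ℤ.- 1ℤ ℤ.* y)
           (transform-partial ps (p ∷ es) ds G s dist
             (λ p′∈ → ((All.lookup p≢ p′∈ ∘ ≋-sym) ∷ cross (there p′∈) .proj₁) , cross (there p′∈) .proj₂)
             (≋-trans (P.move-left (pol p) (∏P es) (∏P ds) (∏P ps)) prod≋)
             (trans (moveN-left (degree p) (∑ es degree) (∑ ds degree) (∑ ps degree)) deg≡))
           (transform-partial ps es (p ∷ ds) G s dist
             (λ p′∈ → cross (there p′∈) .proj₁ , ((All.lookup p≢ p′∈ ∘ ≋-sym) ∷ cross (there p′∈) .proj₂))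
             (≋-trans (P.move-right (pol p) (∏P es) (∏P ds) (∏P ps)) prod≋)
             (trans (moveN-right (degree p) (∑ es degree) (∑ ds degree) (∑ ps degree)) deg≡)) ⟩
    + norm p ℤ.* (qd ℤ.* qp ℤ.* (cop ps G ℤ.* (δ ℤ.* Λ s)))
      ℤ.+ ℤ.- 1ℤ ℤ.* (+ (q ^ ∑ (p ∷ ds) degree) ℤ.* qp ℤ.* (cop ps G ℤ.* (Σℤ.⟦ (p ∷ ds) ∣∏? G ⟧ ℤ.* Λ s)))
      ≡⟨ cong₂ (λ x y → + norm p ℤ.* (qd ℤ.* qp ℤ.* (cop ps G ℤ.* (δ ℤ.* Λ s)))
               ℤ.+ ℤ.- 1ℤ ℤ.* (x ℤ.* qp ℤ.* (cop ps G ℤ.* (y ℤ.* Λ s))))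
           (pow-∷ ds) (sym (∣∏?-∷ p ds G (cross (here refl) .proj₂))) ⟩
    + norm p ℤ.* (qd ℤ.* qp ℤ.* (cop ps G ℤ.* (δ ℤ.* Λ s)))
      ℤ.+ ℤ.- 1ℤ ℤ.* ((+ norm p ℤ.* qd) ℤ.* qp ℤ.* (cop ps G ℤ.* (Σℤ.⟦ p ∣? G ⟧ ℤ.* δ ℤ.* Λ s)))
      ≡⟨ collect (+ norm p) qd qp (cop ps G) δ (Λ s) Σℤ.⟦ p ∣? G ⟧ ⟩
    qd ℤ.* (+ norm p ℤ.* qp) ℤ.* (cop (p ∷ ps) G ℤ.* (δ ℤ.* Λ s))
      ≡⟨ cong (λ z → qd ℤ.* z ℤ.* (cop (p ∷ ps) G ℤ.* (δ ℤ.* Λ s))) (sym (pow-∷ ps)) ⟩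
    qd ℤ.* + (q ^ ∑ (p ∷ ps) degree) ℤ.* (cop (p ∷ ps) G ℤ.* (δ ℤ.* Λ s)) ∎
    where
    open ≡.≡-Reasoning
    e g : Pol → ℤ
    e X = Σℤ.⟦ es ∣∏? X ⟧
    g X = χ G s X
    qd = + (q ^ ∑ ds degree)
    qp = + (q ^ ∑ ps degree)
    δ = Σℤ.⟦ ds ∣∏? G ⟧
    pow-∷ : ∀ ts → + (q ^ ∑ (p ∷ ts) degree) ≡ + norm p ℤ.* + (q ^ ∑ ts degree)
    pow-∷ ts = trans (cong +_ (^-distribˡ-+-* q (degree p) (∑ ts degree))) (ℤ.pos-* (norm p) _)
    expand : ∀ n i w e g → ((n ℤ.* i ℤ.- 1ℤ) ℤ.* w) ℤ.* (e ℤ.* g)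
      ≡ n ℤ.* (w ℤ.* ((i ℤ.* e) ℤ.* g)) ℤ.+ ℤ.- 1ℤ ℤ.* (w ℤ.* (e ℤ.* g))
    expand = ℤ-Solver.solve-∀
    collect : ∀ n d p c δ l i →
      n ℤ.* (d ℤ.* p ℤ.* (c ℤ.* (δ ℤ.* l))) ℤ.+ ℤ.- 1ℤ ℤ.* ((n ℤ.* d) ℤ.* p ℤ.* (c ℤ.* (i ℤ.* δ ℤ.* l)))
      ≡ d ℤ.* (n ℤ.* p) ℤ.* (((1ℤ ℤ.- i) ℤ.* c) ℤ.* (δ ℤ.* l))
    collect = ℤ-Solver.solve-∀
    moveN-left : ∀ p e d r → ((p + e) + d) + r ≡ (e + d) + (p + r)
    moveN-left = solve-∀
    moveN-right : ∀ p e d r → (e + (p + d)) + r ≡ (e + d) + (p + r)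
    moveN-right = solve-∀

  transform : ∀ G s → Σℤ.∑ (allPol m) (λ X → weight rs X ℤ.* χ G s X)
    ≡ + (q ^ m) ℤ.* (cop rs G ℤ.* Λ s)
  transform G s = begin
    Σℤ.∑ (allPol m) (λ X → weight rs X ℤ.* χ G s X)
      ≡⟨ Σℤ.∑-cong (allPol m) (λ X → cong (weight rs X ℤ.*_) (sym (trans
           (cong (ℤ._* χ G s X) (Σℤ.⟦⟧-true ([] ∣∏? X) (1∣ X))) (ℤ.*-identityˡ _)))) ⟩
    Σℤ.∑ (allPol m) (λ X → weight rs X ℤ.* (Σℤ.⟦ [] ∣∏? X ⟧ ℤ.* χ G s X))
      ≡⟨ transform-partial rs [] [] G s distinct (λ _ → [] , [])
           (≋-trans (*-cong (*-identityˡ 1P) (≋-refl {∏P rs})) (*-identityˡ _)) refl ⟩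
    + (q ^ 0) ℤ.* + (q ^ m) ℤ.* (cop rs G ℤ.* (Σℤ.⟦ [] ∣∏? G ⟧ ℤ.* Λ s))
      ≡⟨ cong₂ ℤ._*_ (ℤ.*-identityˡ (+ (q ^ m))) (cong (cop rs G ℤ.*_)
           (trans (cong (ℤ._* Λ s) (Σℤ.⟦⟧-true ([] ∣∏? G) (1∣ G))) (ℤ.*-identityˡ (Λ s)))) ⟩
    + (q ^ m) ℤ.* (cop rs G ℤ.* Λ s) ∎
    where
    open ≡.≡-Reasoning
    1∣ : ∀ X → 1P ∣ X
    1∣ X = divides X (≋-trans (*-comm X 1P) (*-identityˡ X))

  ∣-cong : ∀ p {X Y} → X ≋ Y → Σℤ.⟦ p ∣? X ⟧ ≡ Σℤ.⟦ p ∣? Y ⟧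
  ∣-cong p {X} {Y} e = Σℤ.⟦⟧-⇔ (p ∣? X) (p ∣? Y) (∣-resp e) (∣-resp (≋-sym e))

  weight-cong : ∀ {X Y} → X ≋ Y → weight rs X ≡ weight rs Y
  weight-cong e = Σℤ.∏-cong rs (λ p → cong (λ z → + norm p ℤ.* z ℤ.- 1ℤ) (∣-cong p e))

  cop-cong : ∀ {X Y} → X ≋ Y → cop rs X ≡ cop rs Y
  cop-cong e = Σℤ.∏-cong rs (λ p → cong (λ z → 1ℤ ℤ.- z) (∣-cong p e))

  restrict : ∀ {n} → n ≤ m → (g : Pol → ℤ) → (∀ {X Y} → X ≋ Y → g X ≡ g Y) →
    Σℤ.∑ (allPol m) (λ X → Σℤ.⟦ Small? n X ⟧ ℤ.* g X) ≡ Σℤ.∑ (allPol n) g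
  restrict {n} n≤m g g-cong = sym (trans
    (Σℤ.∑-cong-∈ (allPol n) (λ X∈ → g-cong (≋-sym (pad≋ X∈))))
    (trans (Σℤ.∑-reindex (trunc m) g (map-↭ (trunc m) (trunc n) (allPol-unique n)
      (Unique.filter⁺ (Small? n) (allPol-unique m))
      (λ X∈ → ∈-filter⁺ (Small? n) (trunc∈ m _) (Small-resp (≋-sym (pad≋ X∈)) (∈-Small {n} X∈)))
      (λ _ → trunc∈ n _)
      (λ {X} X∈ → ∈-≋⇒≡ {n} (trunc∈ n _) X∈ (≋-trans
        (trunc-≋ n (Small-resp (≋-sym (pad≋ X∈)) (∈-Small {n} X∈))) (pad≋ X∈)))
      cut-pad))
    (Σℤ.∑-filter (Small? n) (allPol m) g)))
    where
    pad≋ : ∀ {X} → X ∈ allPol n → trunc m X ≋ X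
    pad≋ X∈ = trunc-≋ m (Small-mono n≤m (∈-Small {n} X∈))
    cut-pad : ∀ {X} → X ∈ filter (Small? n) (allPol m) → trunc m (trunc n X) ≡ X
    cut-pad {X} X∈ with ∈-filter⁻ (Small? n) {xs = allPol m} X∈
    ... | X∈′ , s = ∈-≋⇒≡ {m} (trunc∈ m _) X∈′ (≋-trans (pad≋ (trunc∈ n X)) (trunc-≋ n s))

  -- The count over I(F,h), parametrized by the difference R of degree below h.
  window : ℕ → Pol → ℤ
  window h F = Σℤ.∑ (allPol h) (λ R → cop rs (F +P R))

  -- `transform` is summed over R, and `orthogonality` in R discards the frequencies of degree m - h
  -- or more.
  window-transform : ∀ h F s → + (q ^ m) ℤ.* (window h F ℤ.* Λ s)
    ≡ + (q ^ h) ℤ.* Σℤ.∑ (allPol (m ∸ h)) (λ X → weight rs X ℤ.* χ F s X)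
  window-transform h F s = begin
    + (q ^ m) ℤ.* (window h F ℤ.* Λ s)
      ≡⟨ trans (cong (+ (q ^ m) ℤ.*_) (sym (Σℤ.∑-*ʳ (Λ s) (allPol h) _))) (sym (Σℤ.∑-*ˡ (+ (q ^ m)) (allPol h) _)) ⟩
    Σℤ.∑ (allPol h) (λ R → + (q ^ m) ℤ.* (cop rs (F +P R) ℤ.* Λ s))
      ≡⟨ Σℤ.∑-cong (allPol h) (λ R → sym (transform (F +P R) s)) ⟩
    Σℤ.∑ (allPol h) (λ R → Σℤ.∑ (allPol m) (λ X → weight rs X ℤ.* χ (F +P R) s X))
      ≡⟨ Σℤ.∑-swap (allPol h) (allPol m) _ ⟩
    Σℤ.∑ (allPol m) (λ X → Σℤ.∑ (allPol h) (λ R → weight rs X ℤ.* χ (F +P R) s X))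
      ≡⟨ Σℤ.∑-cong-∈ (allPol m) (λ {X} X∈ → begin
           Σℤ.∑ (allPol h) (λ R → weight rs X ℤ.* χ (F +P R) s X)
             ≡⟨ Σℤ.∑-*ˡ (weight rs X) (allPol h) _ ⟩
           weight rs X ℤ.* Σℤ.∑ (allPol h) (λ R → χ (F +P R) s X)
             ≡⟨ cong (weight rs X ℤ.*_) (trans (Σℤ.∑-cong (allPol h) (λ R → cong Λ (distribute X R)))
                  (orthogonality X h (s +F residue (F *P X)) (∈-Small {m} X∈))) ⟩
           weight rs X ℤ.* (Σℤ.⟦ Small? (m ∸ h) X ⟧ ℤ.* (+ (q ^ h) ℤ.* χ F s X))
             ≡⟨ permute (weight rs X) Σℤ.⟦ Small? (m ∸ h) X ⟧ (+ (q ^ h)) (χ F s X) ⟩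
           + (q ^ h) ℤ.* (Σℤ.⟦ Small? (m ∸ h) X ⟧ ℤ.* (weight rs X ℤ.* χ F s X)) ∎) ⟩
    Σℤ.∑ (allPol m) (λ X → + (q ^ h) ℤ.* (Σℤ.⟦ Small? (m ∸ h) X ⟧ ℤ.* (weight rs X ℤ.* χ F s X)))
      ≡⟨ Σℤ.∑-*ˡ (+ (q ^ h)) (allPol m) _ ⟩
    + (q ^ h) ℤ.* Σℤ.∑ (allPol m) (λ X → Σℤ.⟦ Small? (m ∸ h) X ⟧ ℤ.* (weight rs X ℤ.* χ F s X))
      ≡⟨ cong (+ (q ^ h) ℤ.*_) (restrict (m∸n≤m m h) (λ X → weight rs X ℤ.* χ F s X)
           (λ e → cong₂ ℤ._*_ (weight-cong e) (cong (λ z → Λ (s +F z)) (residue-cong (*-congʳ F e))))) ⟩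
    + (q ^ h) ℤ.* Σℤ.∑ (allPol (m ∸ h)) (λ X → weight rs X ℤ.* χ F s X) ∎
    where
    open ≡.≡-Reasoning
    permute : ∀ w i h l → w ℤ.* (i ℤ.* (h ℤ.* l)) ≡ h ℤ.* (i ℤ.* (w ℤ.* l))
    permute = ℤ-Solver.solve-∀
    distribute : ∀ X R → s +F residue ((F +P R) *P X) ≡ (s +F residue (F *P X)) +F residue (X *P R)
    distribute X R = trans (cong (s +F_) (trans
      (residue-cong (≋-trans (*-distribʳ X F R) (P.+-congˡ {F *P X} (*-comm R X))))
      (residue-+ (F *P X) (X *P R)))) (sym (F.+-assoc s _ _))

  Λ0≢0 : Λ 0# ≢ 0ℤ
  Λ0≢0 e with trans (sym (cong (λ z → + q ℤ.* z ℤ.- 1ℤ) (Σℤ.⟦⟧-true (0# ≟ 0#) refl))) e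
  ... | e′ = ℕ.<⇒≢ 2≤q (sym (ℤ.+-injective (trans (sym (ℤ.*-identityʳ (+ q))) (ℤ.i-j≡0⇒i≡j (+ q ℤ.* 1ℤ) 1ℤ e′))))

  instance
    Λ0-nonZero : ℤ.NonZero (Λ 0#)
    Λ0-nonZero = ℤ.≢-nonZero Λ0≢0

    q^-nonZero : ∀ {k} → ℕ.NonZero (q ^ k)
    q^-nonZero {k} = m^n≢0 q k

  totient : ℤ
  totient = Σℤ.∑ (allPol m) (cop rs)

  -- A window of length m around 0 is a full residue system, and its transform retains the frequency
  -- 0 alone.
  totient≡weight : totient ≡ weight rs []
  totient≡weight = ℤ.*-cancelʳ-≡ totient (weight rs []) (Λ 0#) (ℤ.*-cancelˡ-≡ (+ (q ^ m)) _ _ {{q^-nonZero {m}}} (begin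
    + (q ^ m) ℤ.* (totient ℤ.* Λ 0#)
      ≡⟨ window-transform m [] 0# ⟩
    + (q ^ m) ℤ.* Σℤ.∑ (allPol (m ∸ m)) (λ X → weight rs X ℤ.* Λ (0# +F residue []))
      ≡⟨ cong (λ k → + (q ^ m) ℤ.* Σℤ.∑ (allPol k) (λ X → weight rs X ℤ.* Λ (0# +F residue []))) (ℕ.n∸n≡0 m) ⟩
    + (q ^ m) ℤ.* (weight rs [] ℤ.* Λ (0# +F residue []) ℤ.+ 0ℤ)
      ≡⟨ cong (+ (q ^ m) ℤ.*_) (trans (ℤ.+-identityʳ _) (cong (λ z → weight rs [] ℤ.* Λ z)
           (trans (F.+-identityˡ _) (residue-small Small-[])))) ⟩
    + (q ^ m) ℤ.* (weight rs [] ℤ.* Λ 0#) ∎))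
    where open ≡.≡-Reasoning

  weight* : Pol → ℤ
  weight* X = (1ℤ ℤ.- Σℤ.⟦ X ≋0? ⟧) ℤ.* weight rs X

  deviation : ℕ → Pol → ℤ
  deviation h F = + (q ^ m) ℤ.* window h F ℤ.- + (q ^ h) ℤ.* totient

  -- The frequency 0 contributes exactly `q ^ h * totient`, so subtracting the mean turns `weight`
  -- into `weight*`.
  deviation-transform : ∀ h F s → deviation h F ℤ.* Λ s
    ≡ + (q ^ h) ℤ.* Σℤ.∑ (allPol (m ∸ h)) (λ X → weight* X ℤ.* χ F s X)
  deviation-transform h F s = begin
    deviation h F ℤ.* Λ s
      ≡⟨ distribute (+ (q ^ m)) (window h F) (+ (q ^ h)) totient (Λ s) ⟩
    + (q ^ m) ℤ.* (window h F ℤ.* Λ s) ℤ.- + (q ^ h) ℤ.* (totient ℤ.* Λ s)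
      ≡⟨ cong₂ ℤ._-_ (window-transform h F s) (cong (λ z → + (q ^ h) ℤ.* (z ℤ.* Λ s)) totient≡weight) ⟩
    + (q ^ h) ℤ.* Σℤ.∑ B (λ X → weight rs X ℤ.* g X) ℤ.- + (q ^ h) ℤ.* (weight rs [] ℤ.* Λ s)
      ≡⟨ cong (λ z → + (q ^ h) ℤ.* z ℤ.- + (q ^ h) ℤ.* (weight rs [] ℤ.* Λ s)) (trans
           (Σℤ.∑-cong B (λ X → split (weight rs X) Σℤ.⟦ X ≋0? ⟧ (g X)))
           (trans (Σℤ.∑-+ B _ _) (cong (λ z → Σℤ.∑ B (λ X → weight* X ℤ.* g X) ℤ.+ z) zero-term))) ⟩
    + (q ^ h) ℤ.* (Σℤ.∑ B (λ X → weight* X ℤ.* g X) ℤ.+ weight rs [] ℤ.* Λ s) ℤ.- + (q ^ h) ℤ.* (weight rs [] ℤ.* Λ s)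
      ≡⟨ cancel (+ (q ^ h)) (Σℤ.∑ B (λ X → weight* X ℤ.* g X)) (weight rs [] ℤ.* Λ s) ⟩
    + (q ^ h) ℤ.* Σℤ.∑ B (λ X → weight* X ℤ.* g X) ∎
    where
    open ≡.≡-Reasoning
    n = m ∸ h
    B = allPol n
    g : Pol → ℤ
    g X = χ F s X
    distribute : ∀ a w b t l → (a ℤ.* w ℤ.- b ℤ.* t) ℤ.* l ≡ a ℤ.* (w ℤ.* l) ℤ.- b ℤ.* (t ℤ.* l)
    distribute = ℤ-Solver.solve-∀
    split : ∀ w i g → w ℤ.* g ≡ ((1ℤ ℤ.- i) ℤ.* w) ℤ.* g ℤ.+ i ℤ.* (w ℤ.* g)
    split = ℤ-Solver.solve-∀
    cancel : ∀ a s t → a ℤ.* (s ℤ.+ t) ℤ.- a ℤ.* t ≡ a ℤ.* s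
    cancel = ℤ-Solver.solve-∀
    zero-vector : trunc n [] ≋ []
    zero-vector = trunc-≋ n Small-[]
    zero-term : Σℤ.∑ B (λ X → Σℤ.⟦ X ≋0? ⟧ ℤ.* (weight rs X ℤ.* g X)) ≡ weight rs [] ℤ.* Λ s
    zero-term = trans
      (Σℤ.∑-cong-∈ B (λ {X} X∈ → cong (ℤ._* (weight rs X ℤ.* g X)) (Σℤ.⟦⟧-⇔ (X ≋0?) (List.≡-dec _≟_ X (trunc n []))
        (λ X≋0 → ∈-≋⇒≡ {n} X∈ (trunc∈ n []) (≋-trans X≋0 (≋-sym zero-vector)))
        (λ X≡ → ≋-trans (≋-reflexive X≡) zero-vector))))
      (trans (Σℤ.∑-kronecker (List.≡-dec _≟_) (λ X → weight rs X ℤ.* g X) (allPol-unique n) (trunc∈ n []))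
        (cong₂ ℤ._*_ (weight-cong zero-vector) (cong Λ (trans (cong (s +F_) (trans
          (residue-cong (≋-trans (*-congʳ F zero-vector) (*-zeroʳ F))) (residue-small Small-[]))) (F.+-identityʳ s)))))

  module Moments (h : ℕ) where
    n = m ∸ h

    U : ℕ → Pol → Pol → ℤ
    U zero S F = Λ (residue (F *P S))
    U (suc k) S F = Σℤ.∑ (allPol n) (λ X → weight* X ℤ.* U k (S +P X) F)

    -- The sum of products of `weight*` over X₁ + ... + Xₖ = -S; `U` is its counterpart before F is
    -- summed out.
    W : ℕ → Pol → ℤ
    W zero S = Σℤ.⟦ S ≋0? ⟧
    W (suc k) S = Σℤ.∑ (allPol n) (λ X → weight* X ℤ.* W k (S +P X))

    -- The shift `residue (F *P S)` carries the frequencies already extracted, and each use of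
    -- `deviation-transform` adds one more to S.
    deviation-power : ∀ k S F → deviation h F ℤ.^ k ℤ.* Λ (residue (F *P S)) ≡ (+ (q ^ h)) ℤ.^ k ℤ.* U k S F
    deviation-power zero S F = refl
    deviation-power (suc k) S F = begin
      (Z ℤ.* Z ℤ.^ k) ℤ.* Λ (residue (F *P S))
        ≡⟨ rotate Z (Z ℤ.^ k) (Λ (residue (F *P S))) ⟩
      Z ℤ.^ k ℤ.* (Z ℤ.* Λ (residue (F *P S)))
        ≡⟨ cong (Z ℤ.^ k ℤ.*_) (deviation-transform h F (residue (F *P S))) ⟩
      Z ℤ.^ k ℤ.* (H ℤ.* Σℤ.∑ (allPol n) (λ X → weight* X ℤ.* Λ (residue (F *P S) +F residue (F *P X))))
        ≡⟨ trans (rotate′ (Z ℤ.^ k) H _) (cong (H ℤ.*_) (sym (Σℤ.∑-*ˡ (Z ℤ.^ k) (allPol n) _))) ⟩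
      H ℤ.* Σℤ.∑ (allPol n) (λ X → Z ℤ.^ k ℤ.* (weight* X ℤ.* Λ (residue (F *P S) +F residue (F *P X))))
        ≡⟨ cong (H ℤ.*_) (Σℤ.∑-cong (allPol n) (λ X → trans (rotate′ (Z ℤ.^ k) (weight* X) _)
             (cong (weight* X ℤ.*_) (trans (cong (λ z → Z ℤ.^ k ℤ.* Λ z) (merge X)) (deviation-power k (S +P X) F))))) ⟩
      H ℤ.* Σℤ.∑ (allPol n) (λ X → weight* X ℤ.* (H ℤ.^ k ℤ.* U k (S +P X) F))
        ≡⟨ cong (H ℤ.*_) (trans (Σℤ.∑-cong (allPol n) (λ X → rotate′ (weight* X) (H ℤ.^ k) (U k (S +P X) F)))
             (Σℤ.∑-*ˡ (H ℤ.^ k) (allPol n) _)) ⟩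
      H ℤ.* (H ℤ.^ k ℤ.* U (suc k) S F)
        ≡⟨ sym (ℤ.*-assoc H (H ℤ.^ k) _) ⟩
      (H ℤ.* H ℤ.^ k) ℤ.* U (suc k) S F ∎
      where
      open ≡.≡-Reasoning
      Z = deviation h F
      H = + (q ^ h)
      rotate : ∀ x y z → (x ℤ.* y) ℤ.* z ≡ y ℤ.* (x ℤ.* z)
      rotate = ℤ-Solver.solve-∀
      rotate′ : ∀ x y z → x ℤ.* (y ℤ.* z) ≡ y ℤ.* (x ℤ.* z)
      rotate′ = ℤ-Solver.solve-∀
      merge : ∀ X → residue (F *P S) +F residue (F *P X) ≡ residue (F *P (S +P X))
      merge X = trans (sym (residue-+ (F *P S) (F *P X))) (residue-cong (≋-sym (*-distribˡ F S X)))

    -- Over all F modulo Q only the total frequency 0 survives; the bound on S keeps every partial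
    -- sum of frequencies of degree below m.
    ∑U : ∀ k S → Small n S → Σℤ.∑ (allPol m) (U k S) ≡ (+ (q ^ m) ℤ.* Λ 0#) ℤ.* W k S
    ∑U zero S s = begin
      Σℤ.∑ (allPol m) (λ F → Λ (residue (F *P S)))
        ≡⟨ Σℤ.∑-cong (allPol m) (λ F → cong Λ (trans (residue-cong (*-comm F S)) (sym (F.+-identityˡ _)))) ⟩
      Σℤ.∑ (allPol m) (λ F → χ S 0# F)
        ≡⟨ orthogonality S m 0# (Small-mono (m∸n≤m m h) s) ⟩
      Σℤ.⟦ Small? (m ∸ m) S ⟧ ℤ.* (+ (q ^ m) ℤ.* Λ 0#)
        ≡⟨ cong (ℤ._* (+ (q ^ m) ℤ.* Λ 0#)) (Σℤ.⟦⟧-⇔ (Small? (m ∸ m) S) (S ≋0?)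
             (λ s → Small-0 (subst (λ k → Small k S) (ℕ.n∸n≡0 m) s)) (λ e → Small-resp (≋-sym e) Small-[])) ⟩
      Σℤ.⟦ S ≋0? ⟧ ℤ.* (+ (q ^ m) ℤ.* Λ 0#)
        ≡⟨ ℤ.*-comm Σℤ.⟦ S ≋0? ⟧ _ ⟩
      (+ (q ^ m) ℤ.* Λ 0#) ℤ.* W zero S ∎
      where open ≡.≡-Reasoning
    ∑U (suc k) S s = begin
      Σℤ.∑ (allPol m) (λ F → Σℤ.∑ (allPol n) (λ X → weight* X ℤ.* U k (S +P X) F))
        ≡⟨ Σℤ.∑-swap (allPol m) (allPol n) _ ⟩
      Σℤ.∑ (allPol n) (λ X → Σℤ.∑ (allPol m) (λ F → weight* X ℤ.* U k (S +P X) F))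
        ≡⟨ Σℤ.∑-cong-∈ (allPol n) (λ {X} X∈ → trans (Σℤ.∑-*ˡ (weight* X) (allPol m) _)
             (trans (cong (weight* X ℤ.*_) (∑U k (S +P X) (Small-+ s (∈-Small {n} X∈))))
               (rotate′ (weight* X) (+ (q ^ m) ℤ.* Λ 0#) _))) ⟩
      Σℤ.∑ (allPol n) (λ X → (+ (q ^ m) ℤ.* Λ 0#) ℤ.* (weight* X ℤ.* W k (S +P X)))
        ≡⟨ Σℤ.∑-*ˡ (+ (q ^ m) ℤ.* Λ 0#) (allPol n) _ ⟩
      (+ (q ^ m) ℤ.* Λ 0#) ℤ.* W (suc k) S ∎
      where
      open ≡.≡-Reasoning
      rotate′ : ∀ x y z → x ℤ.* (y ℤ.* z) ≡ y ℤ.* (x ℤ.* z)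
      rotate′ = ℤ-Solver.solve-∀

    moment : ∀ k → Σℤ.∑ (allPol m) (λ F → deviation h F ℤ.^ k) ≡ (+ (q ^ h)) ℤ.^ k ℤ.* (+ (q ^ m) ℤ.* W k [])
    moment k = ℤ.*-cancelʳ-≡ _ _ (Λ 0#) (begin
      Σℤ.∑ (allPol m) (λ F → deviation h F ℤ.^ k) ℤ.* Λ 0#
        ≡⟨ sym (Σℤ.∑-*ʳ (Λ 0#) (allPol m) _) ⟩
      Σℤ.∑ (allPol m) (λ F → deviation h F ℤ.^ k ℤ.* Λ 0#)
        ≡⟨ Σℤ.∑-cong (allPol m) (λ F → trans
             (cong (λ z → deviation h F ℤ.^ k ℤ.* Λ z) (sym (trans (residue-cong (*-zeroʳ F)) (residue-small Small-[]))))
             (deviation-power k [] F)) ⟩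
      Σℤ.∑ (allPol m) (λ F → H ℤ.^ k ℤ.* U k [] F)
        ≡⟨ Σℤ.∑-*ˡ (H ℤ.^ k) (allPol m) _ ⟩
      H ℤ.^ k ℤ.* Σℤ.∑ (allPol m) (U k [])
        ≡⟨ cong (H ℤ.^ k ℤ.*_) (∑U k [] Small-[]) ⟩
      H ℤ.^ k ℤ.* ((+ (q ^ m) ℤ.* Λ 0#) ℤ.* W k [])
        ≡⟨ rearrange (H ℤ.^ k) (+ (q ^ m)) (Λ 0#) (W k []) ⟩
      (H ℤ.^ k ℤ.* (+ (q ^ m) ℤ.* W k [])) ℤ.* Λ 0# ∎)
      where
      open ≡.≡-Reasoning
      H = + (q ^ h)
      rearrange : ∀ a b c d → a ℤ.* ((b ℤ.* c) ℤ.* d) ≡ (a ℤ.* (b ℤ.* d)) ℤ.* c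
      rearrange = ℤ-Solver.solve-∀

-- Divisibility patterns and the size of their classes

module _ {A B : Set} where

  map-≡⇒ : {f g : A → B} {x : A} (xs : List A) → map f xs ≡ map g xs → x ∈ xs → f x ≡ g x
  map-≡⇒ (x ∷ xs) e (here refl) = List.∷-injectiveˡ e
  map-≡⇒ (x ∷ xs) e (there p) = map-≡⇒ xs (List.∷-injectiveʳ e) p

module Classes (𝔽 : FiniteField) (rs : List (Primes.Prime 𝔽))
  (distinct : AllPairs (Primes.Distinct 𝔽) rs) (h : ℕ) where
  open Vectors 𝔽

  m n H : ℕ
  m = ∑ rs degree
  n = m ∸ h
  H = q ^ h

  _∣ᵇ_ : Prime → Pol → Bool
  p ∣ᵇ X = does (p ∣? X)

  -- At a prime of norm N not dividing Y, either p divides X, or Y + X, or neither: N κ + κ N + N κ²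
  -- = N κ(κ + 2).
  next : ℕ → ℕ
  next κ = κ * (κ + 2)

  -- |Q| times the product of κ / |P| over the primes P dividing the reduced denominator of X / Q;
  -- height X is the degree of that denominator.
  f : ℕ → Pol → ℕ
  f κ X = ∏ rs (λ p → if p ∣ᵇ X then norm p else κ)

  codegree : Bool → ℕ → ℕ
  codegree x d = if x then 0 else d

  height : Pol → ℕ
  height X = ∑ rs (λ p → codegree (p ∣ᵇ X) (degree p))

  ∣ᵇ-cong : ∀ p {X Y} → X ≋ Y → p ∣ᵇ X ≡ p ∣ᵇ Y
  ∣ᵇ-cong p {X} {Y} e with p ∣? X | p ∣? Y
  ... | yes _ | yes _ = refl
  ... | no _ | no _ = refl
  ... | yes d | no ¬d = ⊥-elim (¬d (∣-resp e d))
  ... | no ¬d | yes d = ⊥-elim (¬d (∣-resp (≋-sym e) d))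

  ∣ᵇ-neg : ∀ p X → p ∣ᵇ (-P X) ≡ p ∣ᵇ X
  ∣ᵇ-neg p X with p ∣? (-P X) | p ∣? X
  ... | yes _ | yes _ = refl
  ... | no _ | no _ = refl
  ... | yes d | no ¬d = ⊥-elim (¬d (∣-resp (P.-‿involutive X) (∣-neg d)))
  ... | no ¬d | yes d = ⊥-elim (¬d (∣-neg d))

  f-cong : ∀ κ {X Y} → X ≋ Y → f κ X ≡ f κ Y
  f-cong κ e = ∏-cong rs (λ p → cong (if_then norm p else κ) (∣ᵇ-cong p e))

  f-neg : ∀ κ X → f κ (-P X) ≡ f κ X
  f-neg κ X = ∏-cong rs (λ p → cong (if_then norm p else κ) (∣ᵇ-neg p X))

  f-mono : ∀ {κ κ′} X → κ ≤ κ′ → f κ X ≤ f κ′ X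
  f-mono {κ} {κ′} X κ≤ = ∏-mono-∈ rs (λ {p} _ → go (p ∣ᵇ X) p)
    where
    go : ∀ b p → (if b then norm p else κ) ≤ (if b then norm p else κ′)
    go true p = ≤-refl
    go false p = κ≤

  ∏norm : ∀ ps → ∏ ps norm ≡ q ^ ∑ ps degree
  ∏norm [] = refl
  ∏norm (p ∷ ps) = trans (cong (norm p *_) (∏norm ps)) (sym (^-distribˡ-+-* q (degree p) (∑ ps degree)))

  f-zero : ∀ κ {X} → X ≋ [] → f κ X ≡ q ^ m
  f-zero κ {X} X≋0 = trans (∏-cong rs (λ p → cong (if_then norm p else κ) (divides-zero p))) (∏norm rs)
    where
    divides-zero : ∀ p → p ∣ᵇ X ≡ true
    divides-zero p with p ∣? X
    ... | yes _ = refl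
    ... | no ¬d = ⊥-elim (¬d (∣-resp (≋-sym X≋0) ∣-[]))

  height-zero : ∀ {X} → X ≋ [] → height X ≡ 0
  height-zero {X} X≋0 = trans (∑-cong rs go) (∑-0 rs)
    where
    go : ∀ p → codegree (p ∣ᵇ X) (degree p) ≡ 0
    go p with p ∣? X
    ... | yes _ = refl
    ... | no ¬d = ⊥-elim (¬d (∣-resp (≋-sym X≋0) ∣-[]))

  -- The primes of Q dividing a nonzero Z have total degree at most deg Z < m - h, and the remaining
  -- ones make up `height Z`.
  h<height : ∀ {Z} → Small n Z → ¬ Z ≋ [] → h < height Z
  h<height {Z} s Z≢0 = ℕ.+-cancelˡ-< (divisorDegree rs Z) h (height Z)
    (subst (divisorDegree rs Z + h <_) (sym total)
      (ℕ.m≤o∸n⇒m+n≤o (suc (divisorDegree rs Z)) h≤m dd<n))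
    where
    dd<n : divisorDegree rs Z < n
    dd<n = ≰⇒> λ n≤ → Z≢0 (Small-divisorDegree {rs} distinct (Small-mono n≤ s))
    h≤m : h ≤ m
    h≤m = <⇒≤ (ℕ.m∸n≢0⇒n<m λ e → n≮0 (subst (divisorDegree rs Z <_) e dd<n))
    total : divisorDegree rs Z + height Z ≡ m
    total = trans (sym (∑-+ rs _ _)) (∑-cong rs go)
      where
      go : ∀ p → ⟦ p ∣? Z ⟧ * degree p + codegree (p ∣ᵇ Z) (degree p) ≡ degree p
      go p with p ∣? Z
      ... | yes _ = trans (ℕ.+-identityʳ _) (ℕ.*-identityˡ _)
      ... | no _ = refl

  -- Dropping the lowest r coefficients is injective on `xs`: members that agree on the rest differ
  -- by a polynomial of degree below r.
  count : ∀ {xs} r → Unique xs → (∀ {X} → X ∈ xs → X ∈ allPol n) →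
    (∀ {X X′} → X ∈ xs → X′ ∈ xs → Small r (X -P X′) → X ≋ X′) → length xs ≤ q ^ (n ∸ r)
  count {xs} r u sub sep = subst (_≤ q ^ (n ∸ r)) (List.length-map (drop r) xs)
    (subst (length (map (drop r) xs) ≤_) (length-allPol (n ∸ r))
      (unique-⊆⇒length-≤ (map-unique inj u) mem))
    where
    coef-drop : ∀ r X i → coef (drop r X) i ≡ coef X (r + i)
    coef-drop zero X i = refl
    coef-drop (suc r) [] i = refl
    coef-drop (suc r) (_ ∷ X) i = coef-drop r X i
    inj : ∀ {X X′} → X ∈ xs → X′ ∈ xs → drop r X ≡ drop r X′ → X ≡ X′
    inj {X} {X′} X∈ X′∈ e = ∈-≋⇒≡ {n} (sub X∈) (sub X′∈) (sep X∈ X′∈ (small-intro λ {i} r≤i → begin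
      coef (X -P X′) i               ≡⟨ coef-+ X (-P X′) i ⟩
      coef X i +F coef (-P X′) i     ≡⟨ cong₂ _+F_ (same r≤i) (coef-neg X′ i) ⟩
      coef X′ i +F (-F coef X′ i)    ≡⟨ F.-‿inverseʳ _ ⟩
      0#                             ∎))
      where
      open ≡.≡-Reasoning
      same : ∀ {i} → r ≤ i → coef X i ≡ coef X′ i
      same {i} r≤i = subst (λ j → coef X j ≡ coef X′ j) (ℕ.m+[n∸m]≡n r≤i)
        (trans (sym (coef-drop r X (i ∸ r))) (trans (cong (λ Z → coef Z (i ∸ r)) e) (coef-drop r X′ (i ∸ r))))
    mem : ∀ {Z} → Z ∈ map (drop r) xs → Z ∈ allPol (n ∸ r)
    mem Z∈ with ∈-map⁻ (drop r) Z∈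
    ... | X , X∈ , refl = ∈-allPol⁺ (trans (List.length-drop r X) (cong (_∸ r) (∈-allPol⁻ {n} (sub X∈))))

  -- Spacing: distinct fractions X/Q and X′/Q differ by a fraction with denominator of degree at
  -- most u, so by at least q^(-u), while all of them have absolute value below q^(-h). The
  -- truncated exponent covers the case u ≤ h of at most one member.
  count-by-degree : ∀ {xs} u → Unique xs → (∀ {X} → X ∈ xs → X ∈ allPol n) →
    (∀ {X X′} → X ∈ xs → X′ ∈ xs → m ≤ divisorDegree rs (X -P X′) + u) → length xs ≤ q ^ (u ∸ h)
  count-by-degree {xs} u uniq sub div = ≤-trans (count (m ∸ u) uniq sub sep) (^-monoʳ-≤ q exponent)
    where
    sep : ∀ {X X′} → X ∈ xs → X′ ∈ xs → Small (m ∸ u) (X -P X′) → X ≋ X′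
    sep X∈ X′∈ s = ∸-zero⇒≋ (Small-divisorDegree {rs} distinct
      (Small-mono (ℕ.m≤n+o⇒m∸n≤o m u (subst (m ≤_) (ℕ.+-comm _ u) (div X∈ X′∈))) s))
    exponent : n ∸ (m ∸ u) ≤ u ∸ h
    exponent = begin
      (m ∸ h) ∸ (m ∸ u)  ≡⟨ ℕ.∸-+-assoc m h (m ∸ u) ⟩
      m ∸ (h + (m ∸ u))  ≡⟨ cong (m ∸_) (ℕ.+-comm h (m ∸ u)) ⟩
      m ∸ ((m ∸ u) + h)  ≡⟨ sym (ℕ.∸-+-assoc m (m ∸ u) h) ⟩
      (m ∸ (m ∸ u)) ∸ h  ≤⟨ ℕ.∸-monoˡ-≤ h (ℕ.m≤n+o⇒m∸n≤o m (m ∸ u) (subst (m ≤_) (ℕ.+-comm u (m ∸ u)) (ℕ.m≤n+m∸n m u))) ⟩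
      u ∸ h ∎
      where open ℕ.≤-Reasoning

  module Shifted (Y : Pol) where

    -- Divisibility of Y, X and Y + X by a prime: exactly two of them is impossible.
    data Pattern : Bool → Bool → Bool → Set where
      all  : Pattern true true true
      only₁ : Pattern true false false
      only₂ : Pattern false true false
      only₃ : Pattern false false true
      none : Pattern false false false

    pattern-of : ∀ p X → Pattern (p ∣ᵇ Y) (p ∣ᵇ X) (p ∣ᵇ (Y +P X))
    pattern-of p X with p ∣? Y | p ∣? X | p ∣? (Y +P X)
    ... | yes _ | yes _ | yes _ = all
    ... | yes _ | no _ | no _ = only₁
    ... | no _ | yes _ | no _ = only₂
    ... | no _ | no _ | yes _ = only₃
    ... | no _ | no _ | no _ = none
    ... | yes y | yes x | no ¬z = ⊥-elim (¬z (∣-+ y x))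
    ... | yes y | no ¬x | yes z = ⊥-elim (¬x (∣-+-cancel y z))
    ... | no ¬y | yes x | yes z = ⊥-elim (¬y (∣-+-cancel x (∣-resp (+-comm Y X) z)))

    Colour : Set
    Colour = Bool × Bool

    _≟c_ : (c d : Colour) → Dec (c ≡ d)
    _≟c_ = ≡-dec Bool._≟_ Bool._≟_

    colour : Pol → Prime → Colour
    colour X p = p ∣ᵇ X , p ∣ᵇ (Y +P X)

    -- If p divides X or Y + X, the class of X modulo p is 0 or -Y; otherwise p contributes its
    -- degree to the modulus on which X is undetermined.
    free : Colour → ℕ → ℕ
    free (x , z) d = if x then 0 else (if z then 0 else d)

    freeDegree : Pol → ℕ
    freeDegree X = ∑ rs (λ p → free (colour X p) (degree p))

    factor : ℕ → Prime → Colour → ℕ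
    factor κ p (x , z) = (if x then norm p else κ) * (if z then norm p else κ)

    local : ℕ → Prime → Colour → ℕ
    local κ p d = q ^ free d (degree p) * factor κ p d

    product : ℕ → Pol → ℕ
    product κ X = f κ X * f κ (Y +P X)

    product≡ : ∀ κ X → product κ X ≡ ∏ rs (λ p → factor κ p (colour X p))
    product≡ κ X = sym (∏-* rs _ _)

    colours : Prime → List Colour
    colours p = if p ∣ᵇ Y then (true , true) ∷ (false , false) ∷ []
      else (true , false) ∷ (false , true) ∷ (false , false) ∷ []

    colour∈ : ∀ X p → colour X p ∈ colours p
    colour∈ X p = go (pattern-of p X)
      where
      go : ∀ {y x z} → Pattern y x z → (x , z) ∈ (if y then (true , true) ∷ (false , false) ∷ []
        else (true , false) ∷ (false , true) ∷ (false , false) ∷ [])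
      go all = here refl
      go only₁ = there (here refl)
      go only₂ = here refl
      go only₃ = there (here refl)
      go none = there (there (here refl))

    power-freeDegree : ∀ X → q ^ freeDegree X ≡ ∏ rs (λ p → q ^ free (colour X p) (degree p))
    power-freeDegree X = go rs
      where
      go : ∀ ps → q ^ ∑ ps (λ p → free (colour X p) (degree p)) ≡ ∏ ps (λ p → q ^ free (colour X p) (degree p))
      go [] = refl
      go (p ∷ ps) = trans (^-distribˡ-+-* q (free (colour X p) (degree p)) _) (cong (q ^ free (colour X p) (degree p) *_) (go ps))

    -- If p divides both X and X′, or both Y + X and Y + X′, then it divides X - X′; otherwise it
    -- counts as free.
    same-colour : ∀ {X X′} p → colour X p ≡ colour X′ p →
      degree p ≤ ⟦ p ∣? (X -P X′) ⟧ * degree p + free (colour X p) (degree p)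
    same-colour {X} {X′} p e with p ∣? X | p ∣? X′ | p ∣? (Y +P X) | p ∣? (Y +P X′)
    ... | no _ | no _ | no _ | no _ = m≤n+m _ _
    ... | yes x | yes x′ | _ | _ = ≤-trans (≤-reflexive (sym (trans
            (cong (_* degree p) (⟦⟧-true (p ∣? (X -P X′)) (∣-- x x′))) (ℕ.*-identityˡ _)))) (m≤m+n _ _)
    ... | no _ | no _ | yes z | yes z′ = ≤-trans (≤-reflexive (sym (trans
            (cong (_* degree p) (⟦⟧-true (p ∣? (X -P X′)) (∣-resp cancel (∣-- z z′)))) (ℕ.*-identityˡ _)))) (m≤m+n _ _)
      where
      cancel : ((Y +P X) -P (Y +P X′)) ≋ (X -P X′)
      cancel = P.begin
        (Y +P X) +P (-P (Y +P X′))         P.≈⟨ P.+-congˡ {Y +P X} (≋-sym (P.⁻¹-∙-comm Y X′)) ⟩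
        (Y +P X) +P ((-P Y) +P (-P X′))    P.≈⟨ +-interchange Y X (-P Y) (-P X′) ⟩
        (Y -P Y) +P (X -P X′)              P.≈⟨ P.+-congʳ {X -P X′} (+-inverseʳ Y) ⟩
        X -P X′                            P.∎
    same-colour p () | yes _ | no _ | _ | _
    same-colour p () | no _ | yes _ | _ | _
    same-colour p () | no _ | no _ | yes _ | no _
    same-colour p () | no _ | no _ | no _ | yes _

    -- On a class of equal colours the product is constant, and `count-by-degree` bounds the size of
    -- the class. The factor `c`, to be 1 or H, uses up the q^(-h) in that bound, and the sum over
    -- all colourings becomes an Euler product.
    large-bound : ∀ κ c {E} → Unique E → (∀ {X} → X ∈ E → X ∈ allPol n) →
      (∀ {X} → X ∈ E → c * q ^ (freeDegree X ∸ h) ≤ q ^ freeDegree X) →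
      c * ∑ E (product κ) ≤ ∏ rs (λ p → ∑ (colours p) (local κ p))
    large-bound κ c {E} uniq sub c-bound = begin
      c * ∑ E (product κ)
        ≤⟨ *-monoʳ-≤ c (∑-split (List.≡-dec _≟c_) key (choices colours rs) E (product κ)
             (λ {X} _ → map∈choices colours (colour X) rs (λ {p} _ → colour∈ X p))) ⟩
      c * ∑ (choices colours rs) (λ s → ∑ (class s) (product κ))
        ≡⟨ sym (∑-*ˡ c (choices colours rs) _) ⟩
      ∑ (choices colours rs) (λ s → c * ∑ (class s) (product κ))
        ≤⟨ ∑-mono-∈ (choices colours rs) (λ {s} _ → class-bound s (class s) (Unique.filter⁺ (λ X → List.≡-dec _≟c_ (key X) s) uniq)
             (λ X∈ → ∈-filter⁻ (λ X → List.≡-dec _≟c_ (key X) s) {xs = E} X∈)) ⟩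
      ∑ (choices colours rs) (∏zip (local κ) rs)
        ≡⟨ ∑-choices colours (local κ) rs ⟩
      ∏ rs (λ p → ∑ (colours p) (local κ p)) ∎
      where
      open ℕ.≤-Reasoning
      key : Pol → List Colour
      key X = map (colour X) rs
      class : List Colour → List Pol
      class s = filter (λ X → List.≡-dec _≟c_ (key X) s) E
      class-bound : ∀ s xs → Unique xs → (∀ {X} → X ∈ xs → X ∈ E × key X ≡ s) →
        c * ∑ xs (product κ) ≤ ∏zip (local κ) rs s
      class-bound s [] _ _ = ≤-trans (≤-reflexive (ℕ.*-zeroʳ c)) z≤n
      class-bound s xs@(X₀ ∷ _) u mem = begin
        c * ∑ xs (product κ)
          ≡⟨ cong (c *_) (trans (∑-cong-∈ xs (λ {X} X∈ → const X (mem X∈ .proj₂))) (∑-const (product κ X₀) xs)) ⟩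
        c * (length xs * product κ X₀)
          ≤⟨ *-monoʳ-≤ c (*-monoˡ-≤ (product κ X₀) (count-by-degree (freeDegree X₀) u (λ X∈ → sub (mem X∈ .proj₁)) div)) ⟩
        c * (q ^ (freeDegree X₀ ∸ h) * product κ X₀)
          ≡⟨ sym (ℕ.*-assoc c _ _) ⟩
        c * q ^ (freeDegree X₀ ∸ h) * product κ X₀
          ≤⟨ *-monoˡ-≤ (product κ X₀) (c-bound (mem (here refl) .proj₁)) ⟩
        q ^ freeDegree X₀ * product κ X₀
          ≡⟨ cong₂ _*_ (power-freeDegree X₀) (product≡ κ X₀) ⟩
        ∏ rs (λ p → q ^ free (colour X₀ p) (degree p)) * ∏ rs (λ p → factor κ p (colour X₀ p))
          ≡⟨ sym (∏-* rs _ _) ⟩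
        ∏ rs (λ p → q ^ free (colour X₀ p) (degree p) * factor κ p (colour X₀ p))
          ≡⟨ sym (∏zip-map (local κ) (colour X₀) rs) ⟩
        ∏zip (local κ) rs (key X₀)
          ≡⟨ cong (∏zip (local κ) rs) (mem (here refl) .proj₂) ⟩
        ∏zip (local κ) rs s ∎
        where
        same-key : ∀ {X X′} → key X ≡ s → key X′ ≡ s → ∀ {p} → p ∈ rs → colour X p ≡ colour X′ p
        same-key e e′ = map-≡⇒ rs (trans e (sym e′))
        const : ∀ X → key X ≡ s → product κ X ≡ product κ X₀
        const X e = trans (product≡ κ X) (trans
          (∏-cong-∈ rs (λ {p} p∈ → cong (factor κ p) (same-key e (mem (here refl) .proj₂) p∈))) (sym (product≡ κ X₀)))
        div : ∀ {X X′} → X ∈ xs → X′ ∈ xs → m ≤ divisorDegree rs (X -P X′) + freeDegree X₀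
        div {X} {X′} X∈ X′∈ = ≤-trans (∑-mono-∈ rs (λ {p} p∈ →
            subst (λ d → degree p ≤ ⟦ p ∣? (X -P X′) ⟧ * degree p + free d (degree p))
              (same-key (mem X∈ .proj₂) (mem (here refl) .proj₂) p∈)
              (same-colour {X} {X′} p (same-key (mem X∈ .proj₂) (mem X′∈ .proj₂) p∈))))
          (≤-reflexive (∑-+ rs _ _))

    colours′ : Prime → List Colour
    colours′ p = if p ∣ᵇ Y then (true , true) ∷ [] else (true , false) ∷ (false , true) ∷ (false , false) ∷ []

    -- At the primes dividing Y the true colour is overwritten by a fixed one, so members of one
    -- class may differ there.
    colour′ : Pol → Prime → Colour
    colour′ X p = if p ∣ᵇ Y then (true , true) else colour X p

    colour′∈ : ∀ X p → colour′ X p ∈ colours′ p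
    colour′∈ X p = go (pattern-of p X)
      where
      go : ∀ {y x z} → Pattern y x z → (if y then (true , true) else (x , z)) ∈ (if y then (true , true) ∷ []
        else (true , false) ∷ (false , true) ∷ (false , false) ∷ [])
      go all = here refl
      go only₁ = here refl
      go only₂ = here refl
      go only₃ = there (here refl)
      go none = there (there (here refl))

    levelAt : Pol → Prime → ℕ
    levelAt X p = if p ∣ᵇ Y then codegree (p ∣ᵇ X) (degree p) else 0

    level freeDegree′ : Pol → ℕ
    level X = ∑ rs (levelAt X)
    freeDegree′ X = ∑ rs (λ p → free (colour′ X p) (degree p))

    freeDegree-split : ∀ X → freeDegree X ≡ level X + freeDegree′ X
    freeDegree-split X = trans (∑-cong rs (λ p → go (degree p) (pattern-of p X))) (∑-+ rs _ _)
      where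
      go : ∀ d {y x z} → Pattern y x z → free (x , z) d
        ≡ (if y then codegree x d else 0) + free (if y then (true , true) else (x , z)) d
      go d all = refl
      go d only₁ = sym (ℕ.+-identityʳ d)
      go d only₂ = refl
      go d only₃ = refl
      go d none = refl

    -- The primes in the denominators of X/Q and (Y + X)/Q that are absent from the denominator of
    -- Y/Q.
    cancelled : Pol → Prime → Bool
    cancelled X p = if p ∣ᵇ Y then Bool.not (p ∣ᵇ X) else false

    level≡ : ∀ X → ∑ rs (λ p → if cancelled X p then degree p else 0) ≡ level X
    level≡ X = ∑-cong rs (λ p → go (p ∣ᵇ Y) (p ∣ᵇ X) (degree p))
      where
      go : ∀ y x d → (if (if y then Bool.not x else false) then d else 0) ≡ (if y then codegree x d else 0)
      go true true d = refl
      go true false d = refl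
      go false _ d = refl

    -- Overwriting the colour at a cancelled prime raises its factor from κ² to |P|²; over all of
    -- them this amounts to the square of `q ^ level X`.
    product-level : ∀ κ X → product κ X * (q ^ level X * q ^ level X)
      ≡ ∏ rs (λ p → if cancelled X p then κ * κ else 1) * ∏ rs (λ p → factor κ p (colour′ X p))
    product-level κ X = begin
      product κ X * (q ^ level X * q ^ level X)
        ≡⟨ cong₂ (λ x y → x * (y * y)) (product≡ κ X) (power rs) ⟩
      ∏ rs (λ p → factor κ p (colour X p)) * (∏ rs (λ p → q ^ levelAt X p) * ∏ rs (λ p → q ^ levelAt X p))
        ≡⟨ trans (cong (∏ rs (λ p → factor κ p (colour X p)) *_) (sym (∏-* rs _ _))) (sym (∏-* rs _ _)) ⟩
      ∏ rs (λ p → factor κ p (colour X p) * (q ^ levelAt X p * q ^ levelAt X p))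
        ≡⟨ ∏-cong rs (λ p → go (degree p) (pattern-of p X)) ⟩
      ∏ rs (λ p → (if cancelled X p then κ * κ else 1) * factor κ p (colour′ X p))
        ≡⟨ ∏-* rs _ _ ⟩
      ∏ rs (λ p → if cancelled X p then κ * κ else 1) * ∏ rs (λ p → factor κ p (colour′ X p)) ∎
      where
      open ≡.≡-Reasoning
      power : ∀ ps → q ^ ∑ ps (levelAt X) ≡ ∏ ps (λ p → q ^ levelAt X p)
      power [] = refl
      power (p ∷ ps) = trans (^-distribˡ-+-* q (levelAt X p) _) (cong (q ^ levelAt X p *_) (power ps))
      g : ℕ → Bool → Bool → ℕ
      g d x z = (if x then q ^ d else κ) * (if z then q ^ d else κ)
      go : ∀ d {y x z} → Pattern y x z →
        g d x z * (q ^ (if y then codegree x d else 0) * q ^ (if y then codegree x d else 0))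
        ≡ (if (if y then Bool.not x else false) then κ * κ else 1)
          * g d (proj₁ (if y then (true , true) else (x , z))) (proj₂ (if y then (true , true) else (x , z)))
      go d all = ℕ.*-comm _ 1
      go d only₁ = refl
      go d only₂ = ℕ.*-comm _ 1
      go d only₃ = ℕ.*-comm _ 1
      go d none = ℕ.*-comm _ 1

    -- Here only the divisibility by primes not dividing Y is prescribed; of the primes dividing Y but not X
    -- just the total degree (the level) is fixed, since each of them separately would allow only one X.
    small-bound : ∀ κ Γ → PowerBound rs h (κ * κ) Γ →
      ∀ {E} → Unique E → (∀ {X} → X ∈ E → X ∈ allPol n) → (∀ {X} → X ∈ E → freeDegree X < h) →
      (∀ {X} → X ∈ E → h ≤ freeDegree′ X + (level X + level X)) →
      H * ∑ E (product κ) ≤ h * (Γ * ∏ rs (λ p → ∑ (colours′ p) (local κ p)))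
    small-bound κ Γ Γ-bound {E} uniq sub below above = begin
      H * ∑ E (product κ)
        ≤⟨ *-monoʳ-≤ H (≤-trans
             (∑-split (List.≡-dec _≟c_) key (choices colours′ rs) E (product κ)
               (λ {X} _ → map∈choices colours′ (colour′ X) rs (λ {p} _ → colour′∈ X p)))
             (∑-mono-∈ (choices colours′ rs) (λ {s} _ → ∑-split ℕ._≟_ level (upTo h) (class s) (product κ)
               (λ {X} X∈ → ∈-upTo⁺ (≤-<-trans (level≤ X) (below (∈-filter⁻ (λ X → List.≡-dec _≟c_ (key X) s) {xs = E} X∈ .proj₁))))))) ⟩
      H * ∑ (choices colours′ rs) (λ s → ∑ (upTo h) (λ k → ∑ (class₂ s k) (product κ)))
        ≡⟨ sym (trans (∑-cong (choices colours′ rs) (λ s → ∑-*ˡ H (upTo h) _)) (∑-*ˡ H (choices colours′ rs) _)) ⟩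
      ∑ (choices colours′ rs) (λ s → ∑ (upTo h) (λ k → H * ∑ (class₂ s k) (product κ)))
        ≤⟨ ∑-mono-∈ (choices colours′ rs) (λ {s} _ → ∑-mono-∈ (upTo h) (λ {k} _ → class-bound s k (class₂ s k)
             (Unique.filter⁺ (λ X → level X ℕ.≟ k) (Unique.filter⁺ (λ X → List.≡-dec _≟c_ (key X) s) uniq)) (mem s k))) ⟩
      ∑ (choices colours′ rs) (λ s → ∑ (upTo h) (λ k → Γ * ∏zip (local κ) rs s))
        ≡⟨ ∑-cong (choices colours′ rs) (λ s → trans (∑-const (Γ * ∏zip (local κ) rs s) (upTo h))
             (cong (_* (Γ * ∏zip (local κ) rs s)) (List.length-upTo h))) ⟩
      ∑ (choices colours′ rs) (λ s → h * (Γ * ∏zip (local κ) rs s))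
        ≡⟨ trans (∑-*ˡ h (choices colours′ rs) _) (cong (h *_) (trans (∑-*ˡ Γ (choices colours′ rs) _)
             (cong (Γ *_) (∑-choices colours′ (local κ) rs)))) ⟩
      h * (Γ * ∏ rs (λ p → ∑ (colours′ p) (local κ p))) ∎
      where
      open ℕ.≤-Reasoning
      key : Pol → List Colour
      key X = map (colour′ X) rs
      class : List Colour → List Pol
      class s = filter (λ X → List.≡-dec _≟c_ (key X) s) E
      class₂ : List Colour → ℕ → List Pol
      class₂ s k = filter (λ X → level X ℕ.≟ k) (class s)
      -- Together with `below` this leaves at most `h` levels, the source of the factor `h`.
      level≤ : ∀ X → level X ≤ freeDegree X
      level≤ X = subst (level X ≤_) (sym (freeDegree-split X)) (m≤m+n _ _)
      mem : ∀ s k {X} → X ∈ class₂ s k → X ∈ E × key X ≡ s × level X ≡ k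
      mem s k X∈ with ∈-filter⁻ (λ X → level X ℕ.≟ k) {xs = class s} X∈
      ... | X∈′ , l with ∈-filter⁻ (λ X → List.≡-dec _≟c_ (key X) s) {xs = E} X∈′
      ...   | X∈″ , e = X∈″ , e , l
      class-bound : ∀ s k xs → Unique xs → (∀ {X} → X ∈ xs → X ∈ E × key X ≡ s × level X ≡ k) →
        H * ∑ xs (product κ) ≤ Γ * ∏zip (local κ) rs s
      class-bound s k [] _ _ = ≤-trans (≤-reflexive (ℕ.*-zeroʳ H)) z≤n
      class-bound s k xs@(X₀ ∷ _) u mem = ℕ.*-cancelʳ-≤ _ _ K {{K-nonZero}} (begin
        (H * ∑ xs (product κ)) * K
          ≡⟨ trans (ℕ.*-assoc H _ K) (cong (H *_) (sym (∑-*ʳ K xs (product κ)))) ⟩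
        H * ∑ xs (λ X → product κ X * K)
          ≤⟨ *-monoʳ-≤ H (∑-mono-∈ xs (λ {X} X∈ → weigh X (mem X∈))) ⟩
        H * ∑ xs (λ _ → Γ * F₀)
          ≡⟨ trans (cong (H *_) (∑-const (Γ * F₀) xs)) (sym (ℕ.*-assoc H _ _)) ⟩
        (H * length xs) * (Γ * F₀)
          ≤⟨ *-monoˡ-≤ (Γ * F₀) size-bound ⟩
        (q ^ freeDegree′ X₀ * K) * (Γ * F₀)
          ≡⟨ rearrange (q ^ freeDegree′ X₀) K Γ F₀ ⟩
        (Γ * (q ^ freeDegree′ X₀ * F₀)) * K
          ≡⟨ cong (λ z → (Γ * z) * K) local≡ ⟩
        (Γ * ∏zip (local κ) rs s) * K ∎)
        where
        -- Members X and X′ may disagree at the cancelled primes of either, of degree k each, so the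
        -- class grows by q^(2k); by `product-level` the weights shrink by the same `K`.
        K = q ^ k * q ^ k
        K-nonZero : ℕ.NonZero K
        K-nonZero = ℕ.m*n≢0 _ _ {{m^n≢0 q k}} {{m^n≢0 q k}}
        F₀ = ∏ rs (λ p → factor κ p (colour′ X₀ p))
        same-key : ∀ {X X′} → key X ≡ s → key X′ ≡ s → ∀ {p} → p ∈ rs → colour′ X p ≡ colour′ X′ p
        same-key e e′ = map-≡⇒ rs (trans e (sym e′))
        rearrange : ∀ a b c d → (a * b) * (c * d) ≡ (c * (a * d)) * b
        rearrange = solve-∀
        weigh : ∀ X → X ∈ E × key X ≡ s × level X ≡ k → product κ X * K ≤ Γ * F₀
        weigh X (X∈ , e , refl) = begin
          product κ X * K
            ≡⟨ product-level κ X ⟩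
          ∏ rs (λ p → if cancelled X p then κ * κ else 1) * ∏ rs (λ p → factor κ p (colour′ X p))
            ≤⟨ *-mono-≤ (Γ-bound (cancelled X) (subst (_< h) (sym (level≡ X)) (≤-<-trans (level≤ X) (below X∈))))
                 (≤-reflexive (∏-cong-∈ rs (λ {p} p∈ → cong (factor κ p) (same-key e (mem (here refl) .proj₂ .proj₁) p∈)))) ⟩
          Γ * F₀ ∎
        local≡ : q ^ freeDegree′ X₀ * F₀ ≡ ∏zip (local κ) rs s
        local≡ = trans (trans (cong (_* F₀) (go rs)) (sym (∏-* rs _ _)))
          (trans (sym (∏zip-map (local κ) (colour′ X₀) rs)) (cong (∏zip (local κ) rs) (mem (here refl) .proj₂ .proj₁)))
          where
          go : ∀ ps → q ^ ∑ ps (λ p → free (colour′ X₀ p) (degree p)) ≡ ∏ ps (λ p → q ^ free (colour′ X₀ p) (degree p))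
          go [] = refl
          go (p ∷ ps) = trans (^-distribˡ-+-* q (free (colour′ X₀ p) (degree p)) _)
            (cong (q ^ free (colour′ X₀ p) (degree p) *_) (go ps))
        u₀ = freeDegree′ X₀ + (k + k)
        same-class : ∀ {X X′} p → colour′ X p ≡ colour′ X′ p →
          degree p ≤ (⟦ p ∣? (X -P X′) ⟧ * degree p + free (colour′ X p) (degree p)) + (levelAt X p + levelAt X′ p)
        same-class {X} {X′} p e with p ∣ᵇ Y
        ... | false = ≤-trans (same-colour {X} {X′} p e) (m≤m+n _ _)
        ... | true with p ∣? X | p ∣? X′
        ...   | no _ | _ = ≤-trans (m≤m+n (degree p) _) (m≤n+m _ (⟦ p ∣? (X -P X′) ⟧ * degree p + 0))
        ...   | yes _ | no _ = m≤n+m (degree p) (⟦ p ∣? (X -P X′) ⟧ * degree p + 0)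
        ...   | yes x | yes x′ = ≤-trans (≤-reflexive (sym (trans
                (cong (_* degree p) (⟦⟧-true (p ∣? (X -P X′)) (∣-- x x′))) (ℕ.*-identityˡ _))))
                (≤-trans (m≤m+n _ _) (m≤m+n _ _))
        div : ∀ {X X′} → X ∈ xs → X′ ∈ xs → m ≤ divisorDegree rs (X -P X′) + u₀
        div {X} {X′} X∈ X′∈ = begin
          ∑ rs degree
            ≤⟨ ∑-mono-∈ rs (λ {p} p∈ →
                 subst (λ d → degree p ≤ (⟦ p ∣? (X -P X′) ⟧ * degree p + free d (degree p)) + (levelAt X p + levelAt X′ p))
                   (same-key (mem X∈ .proj₂ .proj₁) (mem (here refl) .proj₂ .proj₁) p∈)
                   (same-class {X} {X′} p (same-key (mem X∈ .proj₂ .proj₁) (mem X′∈ .proj₂ .proj₁) p∈))) ⟩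
          ∑ rs (λ p → (⟦ p ∣? (X -P X′) ⟧ * degree p + free (colour′ X₀ p) (degree p)) + (levelAt X p + levelAt X′ p))
            ≡⟨ trans (∑-+ rs _ _) (cong₂ _+_ (∑-+ rs _ _) (∑-+ rs _ _)) ⟩
          (divisorDegree rs (X -P X′) + freeDegree′ X₀) + (level X + level X′)
            ≡⟨ cong₂ (λ a b → (divisorDegree rs (X -P X′) + freeDegree′ X₀) + (a + b))
                 (mem X∈ .proj₂ .proj₂) (mem X′∈ .proj₂ .proj₂) ⟩
          (divisorDegree rs (X -P X′) + freeDegree′ X₀) + (k + k)
            ≡⟨ ℕ.+-assoc (divisorDegree rs (X -P X′)) _ _ ⟩
          divisorDegree rs (X -P X′) + u₀ ∎
        size-bound : H * length xs ≤ q ^ freeDegree′ X₀ * K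
        size-bound = begin
          H * length xs
            ≤⟨ *-monoʳ-≤ H (count-by-degree u₀ u (λ X∈ → sub (mem X∈ .proj₁)) div) ⟩
          q ^ h * q ^ (u₀ ∸ h)
            ≡⟨ trans (sym (^-distribˡ-+-* q h (u₀ ∸ h))) (cong (q ^_) (ℕ.m+[n∸m]≡n h≤u₀)) ⟩
          q ^ u₀
            ≡⟨ trans (^-distribˡ-+-* q (freeDegree′ X₀) (k + k)) (cong (q ^ freeDegree′ X₀ *_) (^-distribˡ-+-* q k k)) ⟩
          q ^ freeDegree′ X₀ * K ∎
          where
          h≤u₀ : h ≤ u₀
          h≤u₀ = subst (λ l → h ≤ freeDegree′ X₀ + (l + l)) (mem (here refl) .proj₂ .proj₂) (above (mem (here refl) .proj₁))

    -- At a prime of norm N dividing Y the two colours give N² + N κ² = N (N + κ²), whose surplus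
    -- over N² is paid by L; at the others the three colours give N times `next κ`.
    large-product : ∀ κ L → ProductBound rs (κ * κ) L →
      ∏ rs (λ p → ∑ (colours p) (local κ p)) ≤ q ^ m * (L * f (next κ) Y)
    large-product κ L L-bound = begin
      ∏ rs (λ p → ∑ (colours p) (local κ p))
        ≡⟨ ∏-cong rs (λ p → eq (p ∣ᵇ Y) (degree p)) ⟩
      ∏ rs (λ p → norm p * ((if p ∣ᵇ Y then norm p + κ * κ else 1) * other p))
        ≡⟨ trans (∏-* rs norm _) (cong (∏ rs norm *_) (∏-* rs _ other)) ⟩
      ∏ rs norm * (∏ rs (λ p → if p ∣ᵇ Y then norm p + κ * κ else 1) * ∏ rs other)
        ≤⟨ *-monoʳ-≤ (∏ rs norm) (*-monoˡ-≤ (∏ rs other) (L-bound (_∣ᵇ Y))) ⟩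
      ∏ rs norm * (L * ∏ rs (λ p → if p ∣ᵇ Y then norm p else 1) * ∏ rs other)
        ≡⟨ cong₂ _*_ (∏norm rs) (trans (ℕ.*-assoc L _ _) (cong (L *_) (trans (sym (∏-* rs _ _))
             (∏-cong rs (λ p → merge (p ∣ᵇ Y) (norm p)))))) ⟩
      q ^ m * (L * f (next κ) Y) ∎
      where
      open ℕ.≤-Reasoning
      other : Prime → ℕ
      other p = if p ∣ᵇ Y then 1 else next κ
      merge : ∀ y N → (if y then N else 1) * (if y then 1 else next κ) ≡ (if y then N else next κ)
      merge true N = ℕ.*-identityʳ N
      merge false N = ℕ.*-identityˡ _
      eq₁ : ∀ N k → 1 * (N * N) + (N * (k * k) + 0) ≡ N * ((N + k * k) * 1)
      eq₁ = solve-∀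
      eq₂ : ∀ N k → 1 * (N * k) + (1 * (k * N) + (N * (k * k) + 0)) ≡ N * (1 * (k * (k + 2)))
      eq₂ = solve-∀
      loc : ℕ → Colour → ℕ
      loc d (x , z) = q ^ free (x , z) d * ((if x then q ^ d else κ) * (if z then q ^ d else κ))
      eq : ∀ y d → ∑ (if y then (true , true) ∷ (false , false) ∷ []
          else (true , false) ∷ (false , true) ∷ (false , false) ∷ []) (loc d)
        ≡ q ^ d * ((if y then q ^ d + κ * κ else 1) * (if y then 1 else next κ))
      eq true d = eq₁ (q ^ d) κ
      eq false d = eq₂ (q ^ d) κ

    -- At a prime dividing Y only one colour is left and contributes N², so there is no surplus.
    small-product : ∀ κ → ∏ rs (λ p → ∑ (colours′ p) (local κ p)) ≡ q ^ m * f (next κ) Y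
    small-product κ = trans (∏-cong rs (λ p → eq (p ∣ᵇ Y) (degree p)))
      (trans (∏-* rs norm _) (cong (_* f (next κ) Y) (∏norm rs)))
      where
      eq₁ : ∀ N → 1 * (N * N) + 0 ≡ N * N
      eq₁ = solve-∀
      eq₂ : ∀ N k → 1 * (N * k) + (1 * (k * N) + (N * (k * k) + 0)) ≡ N * (k * (k + 2))
      eq₂ = solve-∀
      loc : ℕ → Colour → ℕ
      loc d (x , z) = q ^ free (x , z) d * ((if x then q ^ d else κ) * (if z then q ^ d else κ))
      eq : ∀ y d → ∑ (if y then (true , true) ∷ []
          else (true , false) ∷ (false , true) ∷ (false , false) ∷ []) (loc d)
        ≡ q ^ d * (if y then q ^ d else next κ)
      eq true d = eq₁ (q ^ d)
      eq false d = eq₂ (q ^ d) κ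

    -- Both sides are the degree of the common denominator of X/Q and Y/Q, that is, of the primes
    -- not dividing both X and Y.
    height-balance : ∀ X → level X + height Y ≡ ∑ rs (λ p → if p ∣ᵇ X then codegree (p ∣ᵇ (Y +P X)) (degree p) else 0) + height X
    height-balance X = trans (sym (∑-+ rs _ _)) (trans (∑-cong rs (λ p → go (degree p) (pattern-of p X))) (∑-+ rs _ _))
      where
      go : ∀ d {y x z} → Pattern y x z →
        (if y then codegree x d else 0) + codegree y d ≡ (if x then codegree z d else 0) + codegree x d
      go d all = refl
      go d only₁ = ℕ.+-identityʳ d
      go d only₂ = sym (ℕ.+-identityʳ d)
      go d only₃ = refl
      go d none = refl

    -- A prime in the denominator of (Y + X)/Q is missing from that of Y/Q, or from that of X/Q, or
    -- from neither.
    height-sum : ∀ X → height (Y +P X) ≡ (level X + ∑ rs (λ p → if p ∣ᵇ X then codegree (p ∣ᵇ (Y +P X)) (degree p) else 0)) + freeDegree′ X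
    height-sum X = trans (∑-cong rs (λ p → go (degree p) (pattern-of p X)))
      (trans (∑-+ rs _ _) (cong (_+ freeDegree′ X) (∑-+ rs _ _)))
      where
      go : ∀ d {y x z} → Pattern y x z → codegree z d
        ≡ ((if y then codegree x d else 0) + (if x then codegree z d else 0)) + free (if y then (true , true) else (x , z)) d
      go d all = refl
      go d only₁ = sym (trans (ℕ.+-identityʳ _) (ℕ.+-identityʳ d))
      go d only₂ = sym (ℕ.+-identityʳ d)
      go d only₃ = refl
      go d none = refl

    -- The order of the heights bounds the degree `c` of the primes missing from the denominator of
    -- X/Q by `level X`; `height-sum` then bounds the height of Y + X, which exceeds h.
    enough-freedom : ∀ {X} → height Y ≤ height X → h < height (Y +P X) → h ≤ freeDegree′ X + (level X + level X)
    enough-freedom {X} hY≤hX h< = begin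
      h                                          ≤⟨ <⇒≤ h< ⟩
      height (Y +P X)                            ≡⟨ height-sum X ⟩
      (level X + c) + freeDegree′ X          ≤⟨ +-monoˡ-≤ (freeDegree′ X) (+-monoʳ-≤ (level X) c≤level) ⟩
      (level X + level X) + freeDegree′ X    ≡⟨ ℕ.+-comm _ (freeDegree′ X) ⟩
      freeDegree′ X + (level X + level X)    ∎
      where
      open ℕ.≤-Reasoning
      c = ∑ rs (λ p → if p ∣ᵇ X then codegree (p ∣ᵇ (Y +P X)) (degree p) else 0)
      c≤level : c ≤ level X
      c≤level = ℕ.+-cancelʳ-≤ (height X) c (level X) (begin
        c + height X        ≡⟨ sym (height-balance X) ⟩
        level X + height Y  ≤⟨ +-monoʳ-≤ (level X) hY≤hX ⟩
        level X + height X  ∎)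

  -- Sums over two, three and five frequencies

  module Bounds (μ L Γ : ℕ)
    (L-bound : ProductBound rs μ L)
    (Γ-bound : PowerBound rs h μ Γ) where

    B : List Pol
    B = allPol n

    -- `L` comes from the frequencies of free degree at least h, `h * Γ` from the others.
    loss : ℕ
    loss = L + h * Γ

    if-monoˡ : ∀ (b : Bool) {x y z : ℕ} → x ≤ y → (if b then x else z) ≤ (if b then y else z)
    if-monoˡ true e = e
    if-monoˡ false e = ≤-refl

    module _ (κ : ℕ) (κ²≤μ : κ * κ ≤ μ) where

      L-bound′ : ProductBound rs (κ * κ) L
      L-bound′ b = ≤-trans (∏-mono-∈ rs (λ {p} _ → if-monoˡ (b p) (+-monoʳ-≤ (norm p) κ²≤μ))) (L-bound b)

      Γ-bound′ : PowerBound rs h (κ * κ) Γ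
      Γ-bound′ b s = ≤-trans (∏-mono-∈ rs (λ {p} _ → if-monoˡ (b p) κ²≤μ)) (Γ-bound b s)

      convolution-bound : ∀ Y → ∑ B (λ X → f κ X * f κ (Y +P X)) ≤ q ^ m * (L * f (next κ) Y)
      convolution-bound Y = begin
        ∑ B (product κ)         ≡⟨ sym (ℕ.*-identityˡ _) ⟩
        1 * ∑ B (product κ)   ≤⟨ large-bound κ 1 (allPol-unique n) id (λ {X} _ →
          ≤-trans (≤-reflexive (ℕ.*-identityˡ _)) (^-monoʳ-≤ q (m∸n≤m (freeDegree X) h))) ⟩
        _                       ≤⟨ large-product κ L L-bound′ ⟩
        q ^ m * (L * f (next κ) Y) ∎
        where
        open ℕ.≤-Reasoning
        open Shifted Y

      -- For free degree at least h, `large-bound` with c = H gains the whole factor; the rest falls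
      -- under `small-bound`, whose last condition is `enough-freedom`.
      restricted-bound : ∀ Y {E} → Unique E → (∀ {X} → X ∈ E → X ∈ B × height Y ≤ height X × h < height (Y +P X)) →
        H * ∑ E (λ X → f κ X * f κ (Y +P X)) ≤ q ^ m * (loss * f (next κ) Y)
      restricted-bound Y {E} uniq E-cond = begin
        H * ∑ E (product κ)
          ≤⟨ *-monoʳ-≤ H (∑-cover P₀? P₁? (λ X → ℕ.≤-<-connex h (freeDegree X)) E (product κ)) ⟩
        H * (∑ E₀ (product κ) + ∑ E₁ (product κ))
          ≡⟨ ℕ.*-distribˡ-+ H _ _ ⟩
        H * ∑ E₀ (product κ) + H * ∑ E₁ (product κ)
          ≤⟨ +-mono-≤ large small′ ⟩
        q ^ m * (L * f (next κ) Y) + h * (Γ * (q ^ m * f (next κ) Y))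
          ≡⟨ collect (q ^ m) L (f (next κ) Y) h Γ ⟩
        q ^ m * (loss * f (next κ) Y) ∎
        where
        open ℕ.≤-Reasoning
        open Shifted Y
        collect : ∀ a l f h g → a * (l * f) + h * (g * (a * f)) ≡ a * ((l + h * g) * f)
        collect = solve-∀
        P₀? : ∀ X → Dec (h ≤ freeDegree X)
        P₀? X = h ℕ.≤? freeDegree X
        P₁? : ∀ X → Dec (freeDegree X < h)
        P₁? X = freeDegree X ℕ.<? h
        E₀ = filter P₀? E
        E₁ = filter P₁? E
        large : H * ∑ E₀ (product κ) ≤ q ^ m * (L * f (next κ) Y)
        large = ≤-trans (large-bound κ H (Unique.filter⁺ P₀? uniq)
          (λ X∈ → E-cond (∈-filter⁻ P₀? {xs = E} X∈ .proj₁) .proj₁)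
          (λ {X} X∈ → ≤-reflexive (trans (sym (^-distribˡ-+-* q h _))
            (cong (q ^_) (ℕ.m+[n∸m]≡n (∈-filter⁻ P₀? {xs = E} X∈ .proj₂))))))
          (large-product κ L L-bound′)
        small′ : H * ∑ E₁ (product κ) ≤ h * (Γ * (q ^ m * f (next κ) Y))
        small′ = ≤-trans (small-bound κ Γ Γ-bound′ (Unique.filter⁺ P₁? uniq)
          (λ X∈ → E-cond (∈-filter⁻ P₁? {xs = E} X∈ .proj₁) .proj₁)
          (λ {X} X∈ → ∈-filter⁻ P₁? {xs = E} X∈ .proj₂)
          (λ X∈ → enough-freedom (E-cond (∈-filter⁻ P₁? {xs = E} X∈ .proj₁) .proj₂ .proj₁)
            (E-cond (∈-filter⁻ P₁? {xs = E} X∈ .proj₁) .proj₂ .proj₂)))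
          (≤-reflexive (cong (λ z → h * (Γ * z)) (small-product κ)))

    next-mono : ∀ κ → κ ≤ next κ
    next-mono κ = ℕ.m≤m*n κ (κ + 2) {{>-nonZero (≤-trans (s≤s z≤n) (m≤n+m 2 κ))}}

    f* : ℕ → Pol → ℕ
    f* κ X = if does (X ≋0?) then 0 else f κ X

    f*≤f : ∀ κ X → f* κ X ≤ f κ X
    f*≤f κ X with does (X ≋0?)
    ... | true = z≤n
    ... | false = ≤-refl

    f*-nonzero : ∀ κ {X} → ¬ X ≋ [] → f* κ X ≡ f κ X
    f*-nonzero κ {X} X≢0 with X ≋0?
    ... | yes e = ⊥-elim (X≢0 e)
    ... | no _ = refl

    f*-⇔ : ∀ κ {X Y} → (X ≋ [] → Y ≋ []) → (Y ≋ [] → X ≋ []) → f κ X ≡ f κ Y → f* κ X ≡ f* κ Y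
    f*-⇔ κ {X} {Y} to from e with X ≋0? | Y ≋0?
    ... | yes _ | yes _ = refl
    ... | no _ | no _ = e
    ... | yes x | no ¬y = ⊥-elim (¬y (to x))
    ... | no ¬x | yes y = ⊥-elim (¬x (from y))

    f*-cong : ∀ κ {X Y} → X ≋ Y → f* κ X ≡ f* κ Y
    f*-cong κ e = f*-⇔ κ (≋-trans (≋-sym e)) (≋-trans e) (f-cong κ e)

    f*-neg : ∀ κ X → f* κ (-P X) ≡ f* κ X
    f*-neg κ X = f*-⇔ κ (λ e → ≋-trans (≋-sym (P.-‿involutive X)) (≋-trans (neg-cong e) P.-0#≈0#))
      (λ e → ≋-trans (neg-cong e) P.-0#≈0#) (f-neg κ X)

    f*-mono : ∀ {κ κ′} X → κ ≤ κ′ → f* κ X ≤ f* κ′ X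
    f*-mono X κ≤ with does (X ≋0?)
    ... | true = z≤n
    ... | false = f-mono X κ≤

    neg-↭ : map -P_ B ↭ B
    neg-↭ = map-↭ -P_ -P_ (allPol-unique n) (allPol-unique n) (-P∈ {n}) (-P∈ {n})
      (λ {X} X∈ → ∈-≋⇒≡ {n} (-P∈ {n} (-P∈ {n} X∈)) X∈ (P.-‿involutive X))
      (λ {X} X∈ → ∈-≋⇒≡ {n} (-P∈ {n} (-P∈ {n} X∈)) X∈ (P.-‿involutive X))

    ∑-neg : (g : Pol → ℕ) → ∑ B g ≡ ∑ B (g ∘ -P_)
    ∑-neg g = sym (∑-reindex -P_ g neg-↭)

    ∑-shift : ∀ {Y} → Y ∈ B → (g : Pol → ℕ) → ∑ B g ≡ ∑ B (λ X → g (X -P Y))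
    ∑-shift {Y} Y∈ g = sym (∑-reindex (_-P Y) g (shift-↭ {n} (-P∈ {n} Y∈)))

    -- The two-variable sum over X₁ + X₂ = S, with X₁ = -X; the sign is invisible because `f*` is
    -- even.
    G : ℕ → Pol → ℕ
    G κ S = ∑ B (λ X → f* κ X * f* κ (S +P X))

    G-cong : ∀ κ {S S′} → S ≋ S′ → G κ S ≡ G κ S′
    G-cong κ {S} {S′} e = ∑-cong B (λ X → cong (f* κ X *_) (f*-cong κ (+-cong e (≋-refl {X}))))

    G-neg : ∀ κ S → G κ (-P S) ≡ G κ S
    G-neg κ S = trans (∑-neg _) (∑-cong B (λ X → cong₂ _*_ (f*-neg κ X)
      (trans (f*-cong κ (P.⁻¹-∙-comm S X)) (f*-neg κ (S +P X)))))

    G-mono : ∀ {κ κ′} S → κ ≤ κ′ → G κ S ≤ G κ′ S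
    G-mono S κ≤ = ∑-mono-∈ B (λ {X} _ → *-mono-≤ (f*-mono X κ≤) (f*-mono (S +P X) κ≤))

    G-bound : ∀ κ → κ * κ ≤ μ → ∀ S → G κ S ≤ q ^ m * (L * f (next κ) S)
    G-bound κ κ²≤μ S = ≤-trans
      (∑-mono-∈ B (λ {X} _ → *-mono-≤ (f*≤f κ X) (f*≤f κ (S +P X)))) (convolution-bound κ κ²≤μ S)

    higher : Pol → Pol → ℕ
    higher Y X = ⟦ height Y ℕ.≤? height X ⟧

    -- The part of G κ S that gains a factor H over the trivial bound.
    R : ℕ → Pol → ℕ
    R κ S = ∑ B (λ X → higher S X * (f* κ X * f* κ (S +P X)))

    -- Since `f*` vanishes at 0, the X with S + X = 0 drop out, and for all others `h<height`
    -- supplies the remaining hypothesis of `restricted-bound`.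
    R-bound : ∀ κ → κ * κ ≤ μ → ∀ {S} → Small n S → H * R κ S ≤ q ^ m * (loss * f (next κ) S)
    R-bound κ κ²≤μ {S} s = ≤-trans (*-monoʳ-≤ H (begin
        R κ S
          ≤⟨ ∑-mono-∈ B (λ {X} _ → pointwise X) ⟩
        ∑ B (λ X → ⟦ E? X ⟧ * (f κ X * f κ (S +P X)))
          ≡⟨ sym (∑-filter E? B _) ⟩
        ∑ (filter E? B) (λ X → f κ X * f κ (S +P X)) ∎))
      (restricted-bound κ κ²≤μ S (Unique.filter⁺ E? (allPol-unique n)) cond)
      where
      open ℕ.≤-Reasoning
      E? : ∀ X → Dec (height S ≤ height X × ¬ (S +P X) ≋ [])
      E? X = (height S ℕ.≤? height X) ×-dec ¬? ((S +P X) ≋0?)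
      cond : ∀ {X} → X ∈ filter E? B → X ∈ B × height S ≤ height X × h < height (S +P X)
      cond X∈ with ∈-filter⁻ E? {xs = B} X∈
      ... | X∈′ , le , nz = X∈′ , le , h<height (Small-+ s (∈-Small {n} X∈′)) nz
      pointwise : ∀ X → higher S X * (f* κ X * f* κ (S +P X)) ≤ ⟦ E? X ⟧ * (f κ X * f κ (S +P X))
      pointwise X = ≤-trans (*-monoʳ-≤ (higher S X) (*-monoˡ-≤ (f* κ (S +P X)) (f*≤f κ X))) (by-cases (f κ X))
        where
        by-cases : ∀ k → higher S X * (k * f* κ (S +P X)) ≤ ⟦ E? X ⟧ * (k * f κ (S +P X))
        by-cases k with does (height S ℕ.≤? height X) | does ((S +P X) ≋0?)
        ... | false | _ = z≤n
        ... | true | true = ≤-reflexive (trans (ℕ.*-identityˡ _) (ℕ.*-zeroʳ k))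
        ... | true | false = ≤-refl

    -- At S = 0 the height condition is automatic, the height of 0 being 0, so `G` coincides with
    -- `R` and gains H.
    G-bound-zero : ∀ κ → κ * κ ≤ μ → ∀ {S} → S ≋ [] → H * G κ S ≤ q ^ m * (loss * q ^ m)
    G-bound-zero κ κ²≤μ {S} S≋0 = subst (λ z → H * G κ S ≤ q ^ m * (loss * z)) (f-zero (next κ) S≋0)
      (subst (λ z → H * z ≤ q ^ m * (loss * f (next κ) S)) (sym G≡R)
        (R-bound κ κ²≤μ (Small-resp (≋-sym S≋0) Small-[])))
      where
      G≡R : G κ S ≡ R κ S
      G≡R = ∑-cong B (λ X → sym (trans (cong (_* (f* κ X * f* κ (S +P X))) (⟦⟧-true (height S ℕ.≤? height X)
        (subst (_≤ height X) (sym (height-zero S≋0)) z≤n))) (ℕ.*-identityˡ _)))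

    -- Of two frequencies one has the smaller height; by symmetry it may be named first at the cost
    -- of the factor 2.
    symmetric-double : (t : Pol → Pol → ℕ) → (∀ Y X → t Y X ≡ t X Y) →
      ∑ B (λ Y → ∑ B (t Y)) ≤ 2 * ∑ B (λ Y → ∑ B (λ X → higher Y X * t Y X))
    symmetric-double t t-sym = begin
      ∑ B (λ Y → ∑ B (t Y))
        ≤⟨ ∑-mono-∈ B (λ {Y} _ → ∑-mono-∈ B (λ {X} _ → pointwise Y X)) ⟩
      ∑ B (λ Y → ∑ B (λ X → higher Y X * t Y X + higher X Y * t X Y))
        ≡⟨ trans (∑-cong B (λ Y → ∑-+ B _ _)) (∑-+ B _ _) ⟩
      D + ∑ B (λ Y → ∑ B (λ X → higher X Y * t X Y))
        ≡⟨ cong (D ℕ.+_) (trans (∑-swap B B _) (sym (ℕ.+-identityʳ D))) ⟩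
      2 * D ∎
      where
      open ℕ.≤-Reasoning
      D = ∑ B (λ Y → ∑ B (λ X → higher Y X * t Y X))
      one : ∀ {a b} → a ≤ b → ∀ k → k ≤ ⟦ a ℕ.≤? b ⟧ * k
      one {a} {b} a≤b k = ≤-reflexive (sym (trans (cong (_* k) (⟦⟧-true (a ℕ.≤? b) a≤b)) (ℕ.*-identityˡ k)))
      pointwise : ∀ Y X → t Y X ≤ higher Y X * t Y X + higher X Y * t X Y
      pointwise Y X with ℕ.≤-total (height Y) (height X)
      ... | inj₁ le = ≤-trans (one le _) (m≤m+n _ _)
      ... | inj₂ ge = ≤-trans (≤-trans (≤-reflexive (t-sym Y X)) (one ge _)) (m≤n+m _ _)

    third : ℕ → ℕ
    third κ = ∑ B (λ Y → f* κ Y * G κ Y)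

    third-limit : ℕ
    third-limit = 2 * ((q ^ m * loss) * (q ^ m * (loss * q ^ m)))

    -- One H comes from `R-bound`, which turns the inner sum into f κ′ Y; the other from the
    -- remaining sum of squares of f* κ′ Y, which is `G κ′ []`.
    third-bound : ∀ κ → next κ * next κ ≤ μ → (H * H) * third κ ≤ third-limit
    third-bound κ κ′²≤μ = begin
      (H * H) * third κ
        ≡⟨ ℕ.*-assoc H H _ ⟩
      H * (H * third κ)
        ≤⟨ *-monoʳ-≤ H (*-monoʳ-≤ H (≤-trans (≤-reflexive (∑-cong B (λ Y → sym (∑-*ˡ (f* κ Y) B _))))
             (symmetric-double (λ Y X → f* κ Y * (f* κ X * f* κ (Y +P X))) (λ Y X →
               trans (swap-front (f* κ Y) (f* κ X) _) (cong (λ z → f* κ X * (f* κ Y * z)) (f*-cong κ (+-comm Y X))))))) ⟩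
      H * (H * (2 * ∑ B (λ Y → ∑ B (λ X → higher Y X * (f* κ Y * (f* κ X * f* κ (Y +P X)))))))
        ≡⟨ cong (λ z → H * (H * (2 * z))) (∑-cong B (λ Y → trans
             (∑-cong B (λ X → swap-front (higher Y X) (f* κ Y) _)) (∑-*ˡ (f* κ Y) B _))) ⟩
      H * (H * (2 * ∑ B (λ Y → f* κ Y * R κ Y)))
        ≡⟨ cong (H *_) (trans (swap-front H 2 _) (cong (2 *_) (trans (sym (∑-*ˡ H B _))
             (∑-cong B (λ Y → swap-front H (f* κ Y) (R κ Y)))))) ⟩
      H * (2 * ∑ B (λ Y → f* κ Y * (H * R κ Y)))
        ≤⟨ *-monoʳ-≤ H (*-monoʳ-≤ 2 (∑-mono-∈ B (λ {Y} Y∈ → pointwise Y (∈-Small {n} Y∈)))) ⟩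
      H * (2 * ∑ B (λ Y → (q ^ m * loss) * (f* κ′ Y * f* κ′ Y)))
        ≡⟨ cong (λ z → H * (2 * z)) (∑-*ˡ (q ^ m * loss) B _) ⟩
      H * (2 * ((q ^ m * loss) * G κ′ []))
        ≡⟨ rearrange H (q ^ m * loss) (G κ′ []) ⟩
      2 * ((q ^ m * loss) * (H * G κ′ []))
        ≤⟨ *-monoʳ-≤ 2 (*-monoʳ-≤ (q ^ m * loss) (G-bound-zero κ′ κ′²≤μ ≋-refl)) ⟩
      third-limit ∎
      where
      open ℕ.≤-Reasoning
      κ′ = next κ
      κ²≤μ : κ * κ ≤ μ
      κ²≤μ = ≤-trans (*-mono-≤ (next-mono κ) (next-mono κ)) κ′²≤μ
      swap-front : ∀ x y z → x * (y * z) ≡ y * (x * z)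
      swap-front = solve-∀
      rearrange : ∀ h a g → h * (2 * (a * g)) ≡ 2 * (a * (h * g))
      rearrange = solve-∀
      regroup : ∀ a b c d → a * (b * (c * d)) ≡ (b * c) * (a * d)
      regroup = solve-∀
      pointwise : ∀ Y → Small n Y → f* κ Y * (H * R κ Y) ≤ (q ^ m * loss) * (f* κ′ Y * f* κ′ Y)
      pointwise Y s = begin
        f* κ Y * (H * R κ Y)
          ≤⟨ *-monoʳ-≤ (f* κ Y) (R-bound κ κ²≤μ s) ⟩
        f* κ Y * (q ^ m * (loss * f κ′ Y))
          ≡⟨ regroup (f* κ Y) (q ^ m) loss (f κ′ Y) ⟩
        (q ^ m * loss) * (f* κ Y * f κ′ Y)
          ≤⟨ *-monoʳ-≤ (q ^ m * loss) (star Y) ⟩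
        (q ^ m * loss) * (f* κ′ Y * f* κ′ Y) ∎
        where
        star : ∀ Y → f* κ Y * f κ′ Y ≤ f* κ′ Y * f* κ′ Y
        star Y with does (Y ≋0?)
        ... | true = z≤n
        ... | false = *-monoˡ-≤ (f κ′ Y) (f-mono Y (next-mono κ))

    -- Majorant of the signed frequency sums `W`, with `f* 1` in place of `weight*`.
    T : ℕ → Pol → ℕ
    T zero S = ⟦ S ≋0? ⟧
    T (suc k) S = ∑ B (λ X → f* 1 X * T k (S +P X))

    T-1 : ∀ {S} → Small n S → T 1 S ≡ f* 1 S
    T-1 {S} s = begin
      ∑ B (λ X → f* 1 X * ⟦ (S +P X) ≋0? ⟧)
        ≡⟨ ∑-cong-∈ B (λ {X} X∈ → trans (ℕ.*-comm (f* 1 X) _) (cong (_* f* 1 X)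
             (⟦⟧-⇔ ((S +P X) ≋0?) (List.≡-dec _≟_ X X₀) (λ e → ∈-≋⇒≡ {n} X∈ (trunc∈ n _) (≋-trans (to e) (≋-sym X₀≋)))
               (λ e → from (≋-trans (≋-reflexive e) X₀≋))))) ⟩
      ∑ B (λ X → ⟦ List.≡-dec _≟_ X X₀ ⟧ * f* 1 X)
        ≡⟨ ∑-kronecker (List.≡-dec _≟_) (f* 1) (allPol-unique n) (trunc∈ n _) ⟩
      f* 1 X₀
        ≡⟨ trans (f*-cong 1 X₀≋) (f*-neg 1 S) ⟩
      f* 1 S ∎
      where
      open ≡.≡-Reasoning
      X₀ = trunc n (-P S)
      X₀≋ : X₀ ≋ (-P S)
      X₀≋ = trunc-≋ n (Small-neg s)
      to : ∀ {X} → (S +P X) ≋ [] → X ≋ (-P S)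
      to {X} e = ∸-zero⇒≋ {X} { -P S} (≋-trans (+-cong (≋-refl {X}) (P.-‿involutive S)) (≋-trans (+-comm X S) e))
      from : ∀ {X} → X ≋ (-P S) → (S +P X) ≋ []
      from {X} e = ≋-trans (+-cong (≋-refl {S}) e) (+-inverseʳ S)

    T-2 : ∀ {S} → Small n S → T 2 S ≡ G 1 S
    T-2 {S} s = ∑-cong-∈ B (λ {X} X∈ → cong (f* 1 X *_) (T-1 (Small-+ s (∈-Small {n} X∈))))

    -- With Y = X₁ + X₂ and Z = X₄ + X₅ the middle variable is -(Y + Z); signs disappear because
    -- `f*` and `G` are even.
    T-5 : T 5 [] ≡ ∑ B (λ Y → ∑ B (λ Z → G 1 Y * (f* 1 (Y +P Z) * G 1 Z)))
    T-5 = begin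
      T 5 []
        ≡⟨ ∑-cong-∈ B (λ {X} X∈ → cong (f* 1 X *_) (∑-cong-∈ B (λ {X₂} X₂∈ → cong (f* 1 X₂ *_)
             (∑-cong-∈ B (λ {X₃} X₃∈ → cong (f* 1 X₃ *_)
               (T-2 (Small-+ (Small-+ (∈-Small {n} X∈) (∈-Small {n} X₂∈)) (∈-Small {n} X₃∈)))))))) ⟩
      ∑ B (λ X → f* 1 X * ∑ B (λ X₂ → f* 1 X₂ * K (X +P X₂)))
        ≡⟨ ∑-cong-∈ B (λ {X} X∈ → cong (f* 1 X *_) (trans (∑-shift X∈ _)
             (∑-cong B (λ Y → cong (f* 1 (Y -P X) *_) (K-cong (put-back X Y)))))) ⟩
      ∑ B (λ X → f* 1 X * ∑ B (λ Y → f* 1 (Y -P X) * K Y))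
        ≡⟨ trans (∑-cong B (λ X → sym (∑-*ˡ (f* 1 X) B _))) (∑-swap B B _) ⟩
      ∑ B (λ Y → ∑ B (λ X → f* 1 X * (f* 1 (Y -P X) * K Y)))
        ≡⟨ ∑-cong B (λ Y → trans (∑-cong B (λ X → sym (ℕ.*-assoc (f* 1 X) _ _))) (trans (∑-*ʳ (K Y) B _)
             (cong (_* K Y) (fold-G Y)))) ⟩
      ∑ B (λ Y → G 1 Y * K Y)
        ≡⟨ ∑-cong-∈ B (λ {Y} Y∈ → trans (cong (G 1 Y *_) (K≡ Y∈)) (sym (∑-*ˡ (G 1 Y) B _))) ⟩
      ∑ B (λ Y → ∑ B (λ Z → G 1 Y * (f* 1 (Y +P Z) * G 1 Z))) ∎
      where
      open ≡.≡-Reasoning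
      K : Pol → ℕ
      K Y = ∑ B (λ X → f* 1 X * G 1 (Y +P X))
      K-cong : ∀ {Y Y′} → Y ≋ Y′ → K Y ≡ K Y′
      K-cong e = ∑-cong B (λ X → cong (f* 1 X *_) (G-cong 1 (+-cong e (≋-refl {X}))))
      put-back : ∀ X Y → (X +P (Y -P X)) ≋ Y
      put-back X Y = ≋-trans (+-comm X (Y -P X)) (sub-add Y X)
      fold-G : ∀ Y → ∑ B (λ X → f* 1 X * f* 1 (Y -P X)) ≡ G 1 Y
      fold-G Y = trans (∑-neg _) (∑-cong B (λ X → cong₂ _*_ (f*-neg 1 X)
        (f*-cong 1 (+-cong (≋-refl {Y}) (P.-‿involutive X)))))
      K≡ : ∀ {Y} → Y ∈ B → K Y ≡ ∑ B (λ Z → f* 1 (Y +P Z) * G 1 Z)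
      K≡ {Y} Y∈ = trans (∑-shift Y∈ _) (trans (∑-cong B (λ Z → cong (f* 1 (Z -P Y) *_) (G-cong 1 (put-back Y Z))))
        (trans (∑-neg _) (∑-cong B (λ Z → cong₂ _*_
          (trans (f*-cong 1 (≋-trans (P.⁻¹-∙-comm Z Y) (neg-cong (+-comm Z Y)))) (f*-neg 1 (Y +P Z)))
          (G-neg 1 Z)))))

    -- Along the proof κ runs through 1, 3, 15, 255, iterating next.
    fifth-bound : 255 * 255 ≤ μ →
      (H * (H * H)) * T 5 [] ≤ 4 * ((q ^ m) ^ 5 * (loss ^ 3 * (1 + L)))
    fifth-bound 255²≤μ = begin
      (H * (H * H)) * T 5 []
        ≤⟨ *-monoʳ-≤ (H * (H * H)) (≤-trans (≤-reflexive T-5)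
             (symmetric-double (λ Y Z → G 1 Y * (f* 1 (Y +P Z) * G 1 Z)) (λ Y Z →
               trans (cong (λ z → G 1 Y * (z * G 1 Z)) (f*-cong 1 (+-comm Y Z))) (flip-outer (G 1 Y) (f* 1 (Z +P Y)) (G 1 Z))))) ⟩
      (H * (H * H)) * (2 * ∑ B (λ Y → ∑ B (λ Z → higher Y Z * (G 1 Y * (f* 1 (Y +P Z) * G 1 Z)))))
        ≡⟨ cong (λ z → (H * (H * H)) * (2 * z)) (∑-cong B (λ Y → trans
             (∑-cong B (λ Z → swap-front (higher Y Z) (G 1 Y) _)) (∑-*ˡ (G 1 Y) B _))) ⟩
      (H * (H * H)) * (2 * ∑ B (λ Y → G 1 Y * V Y))
        ≡⟨ trans (swap-front (H * (H * H)) 2 _) (cong (2 *_) (sym (∑-*ˡ (H * (H * H)) B _))) ⟩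
      2 * ∑ B (λ Y → (H * (H * H)) * (G 1 Y * V Y))
        ≤⟨ *-monoʳ-≤ 2 (∑-mono-∈ B (λ {Y} Y∈ → pointwise Y (∈-Small {n} Y∈))) ⟩
      2 * ∑ B (λ Y → ⟦ Y ≋0? ⟧ * c + ((H * H) * d) * (f* 15 Y * G 15 Y))
        ≡⟨ cong (2 *_) (trans (∑-+ B _ _) (cong₂ _+_ zero-term (∑-*ˡ ((H * H) * d) B _))) ⟩
      2 * (c + ((H * H) * d) * third 15)
        ≡⟨ cong (λ z → 2 * (c + z)) (move-d (H * H) d (third 15)) ⟩
      2 * (c + d * ((H * H) * third 15))
        ≤⟨ *-monoʳ-≤ 2 (+-monoʳ-≤ c (*-monoʳ-≤ d (third-bound 15 255²≤μ))) ⟩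
      2 * (c + d * third-limit)
        ≡⟨ total (q ^ m) L loss ⟩
      4 * ((q ^ m) ^ 5 * (loss ^ 3 * (1 + L))) ∎
      where
      open ℕ.≤-Reasoning
      -- `c` bounds the term Y = 0, with one H from `G-bound-zero` and two from `third-bound`; `d`
      -- is the cost of the two mergings when Y is nonzero.
      c = (q ^ m * (loss * q ^ m)) * third-limit
      d = (q ^ m * L) * (q ^ m * loss)
      V : Pol → ℕ
      V Y = ∑ B (λ Z → higher Y Z * (f* 1 (Y +P Z) * G 1 Z))
      flip-outer : ∀ x y z → x * (y * z) ≡ z * (y * x)
      flip-outer = solve-∀
      swap-front : ∀ x y z → x * (y * z) ≡ y * (x * z)
      swap-front = solve-∀
      move-d : ∀ x y z → (x * y) * z ≡ y * (x * z)
      move-d = solve-∀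
      total : ∀ Q l s → 2 * ((Q * (s * Q)) * (2 * ((Q * s) * (Q * (s * Q))))
          + ((Q * l) * (Q * s)) * (2 * ((Q * s) * (Q * (s * Q)))))
        ≡ 4 * (Q * (Q * (Q * (Q * (Q * 1)))) * (s * (s * (s * 1)) * (1 + l)))
      total = solve-∀
      below-255 : ∀ {k} → k ≤ 255 → k * k ≤ μ
      below-255 k≤ = ≤-trans (*-mono-≤ k≤ k≤) 255²≤μ
      zero-vector : trunc n [] ≋ []
      zero-vector = trunc-≋ n Small-[]
      zero-term : ∑ B (λ Y → ⟦ Y ≋0? ⟧ * c) ≡ c
      zero-term = trans (∑-cong-∈ B (λ {X} X∈ → cong (_* c) (⟦⟧-⇔ (X ≋0?) (List.≡-dec _≟_ X (trunc n []))
          (λ X≋0 → ∈-≋⇒≡ {n} X∈ (trunc∈ n []) (≋-trans X≋0 (≋-sym zero-vector)))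
          (λ X≡ → ≋-trans (≋-reflexive X≡) zero-vector))))
        (∑-kronecker (List.≡-dec _≟_) (λ _ → c) (allPol-unique n) (trunc∈ n []))
      V-zero : ∀ {Y} → Y ≋ [] → V Y ≤ third 1
      V-zero {Y} Y≋0 = ∑-mono-∈ B (λ {Z} _ → ≤-trans (indicator≤ Z _)
        (≤-reflexive (cong (_* G 1 Z) (f*-cong 1 (+-cong {Y} {[]} Y≋0 (≋-refl {Z}))))))
        where
        indicator≤ : ∀ Z k → higher Y Z * k ≤ k
        indicator≤ Z k with does (height Y ℕ.≤? height Z)
        ... | true = ≤-reflexive (ℕ.*-identityˡ k)
        ... | false = z≤n
      V-nonzero : ∀ {Y} → Small n Y → ¬ Y ≋ [] → V Y ≤ (q ^ m * L) * R 3 Y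
      V-nonzero {Y} s Y≢0 = ≤-trans (∑-mono-∈ B (λ {Z} _ → compare Z)) (≤-reflexive (∑-*ˡ (q ^ m * L) B _))
        where
        regroup : ∀ a b c d → a * (b * (c * d)) ≡ (b * c) * (d * a)
        regroup = solve-∀
        compare : ∀ Z → higher Y Z * (f* 1 (Y +P Z) * G 1 Z) ≤ (q ^ m * L) * (higher Y Z * (f* 3 Z * f* 3 (Y +P Z)))
        compare Z = ≤-trans (⟦⟧-guard (height Y ℕ.≤? height Z) λ hY≤hZ → begin
            f* 1 (Y +P Z) * G 1 Z
              ≤⟨ *-mono-≤ (f*-mono (Y +P Z) (next-mono 1)) (G-bound 1 (below-255 (s≤s z≤n)) Z) ⟩
            f* 3 (Y +P Z) * (q ^ m * (L * f 3 Z))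
              ≡⟨ cong (λ z → f* 3 (Y +P Z) * (q ^ m * (L * z))) (sym (f*-nonzero 3 (Z≢0 hY≤hZ))) ⟩
            f* 3 (Y +P Z) * (q ^ m * (L * f* 3 Z))
              ≡⟨ regroup (f* 3 (Y +P Z)) (q ^ m) L (f* 3 Z) ⟩
            (q ^ m * L) * (f* 3 Z * f* 3 (Y +P Z)) ∎)
          (≤-reflexive (swap-front (higher Y Z) (q ^ m * L) _))
          where
          -- A term Z = 0 would carry f 3 0 = q ^ m. It is excluded because Z is at least as high as
          -- Y, whose height exceeds h; so `f` may be replaced by `f*`, as `R` requires.
          Z≢0 : height Y ≤ height Z → ¬ Z ≋ []
          Z≢0 hY≤hZ Z≋0 = n≮0 (ℕ.<-≤-trans (h<height s Y≢0) (subst (height Y ≤_) (height-zero Z≋0) hY≤hZ))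
      pointwise : ∀ Y → Small n Y → (H * (H * H)) * (G 1 Y * V Y)
        ≤ ⟦ Y ≋0? ⟧ * c + ((H * H) * d) * (f* 15 Y * G 15 Y)
      pointwise Y s with Y ≋0?
      ... | yes Y≋0 = ≤-trans (begin
          (H * (H * H)) * (G 1 Y * V Y)
            ≡⟨ split-H H (G 1 Y) (V Y) ⟩
          (H * G 1 Y) * ((H * H) * V Y)
            ≤⟨ *-mono-≤ (G-bound-zero 1 (below-255 (s≤s z≤n)) Y≋0)
                 (≤-trans (*-monoʳ-≤ (H * H) (V-zero Y≋0)) (third-bound 1 (below-255 (m≤m+n 3 252)))) ⟩
          c
            ≡⟨ sym (ℕ.*-identityˡ c) ⟩
          1 * c ∎) (m≤m+n _ _)
        where
        split-H : ∀ h g v → (h * (h * h)) * (g * v) ≡ (h * g) * ((h * h) * v)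
        split-H = solve-∀
      ... | no Y≢0 = begin
          (H * (H * H)) * (G 1 Y * V Y)
            ≤⟨ *-monoʳ-≤ (H * (H * H)) (*-mono-≤ (G-mono Y (s≤s {n = 14} z≤n)) (V-nonzero s Y≢0)) ⟩
          (H * (H * H)) * (G 15 Y * ((q ^ m * L) * R 3 Y))
            ≡⟨ split-H H (G 15 Y) (q ^ m * L) (R 3 Y) ⟩
          ((H * H) * (G 15 Y * (q ^ m * L))) * (H * R 3 Y)
            ≤⟨ *-monoʳ-≤ ((H * H) * (G 15 Y * (q ^ m * L))) (R-bound 3 (below-255 (m≤m+n 3 252)) s) ⟩
          ((H * H) * (G 15 Y * (q ^ m * L))) * (q ^ m * (loss * f 15 Y))
            ≡⟨ gather (H * H) (G 15 Y) (q ^ m * L) (q ^ m) loss (f 15 Y) ⟩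
          ((H * H) * d) * (f 15 Y * G 15 Y) ∎
        where
        split-H : ∀ h g a r → (h * (h * h)) * (g * (a * r)) ≡ ((h * h) * (g * a)) * (h * r)
        split-H = solve-∀
        gather : ∀ H g a Q l f → (H * (g * a)) * (Q * (l * f)) ≡ (H * (a * (Q * l))) * (f * g)
        gather = solve-∀

-- Elementary inequalities for powers

^-distribʳ : ∀ n x y → (x * y) ^ n ≡ x ^ n * y ^ n
^-distribʳ zero x y = refl
^-distribʳ (suc n) x y = trans (cong (x * y *_) (^-distribʳ n x y)) (eq x y (x ^ n) (y ^ n))
  where
  eq : ∀ a b c d → a * b * (c * d) ≡ (a * c) * (b * d)
  eq = solve-∀

∏-^ : ∀ {A : Set} (xs : List A) (f : A → ℕ) n → ∏ xs f ^ n ≡ ∏ xs (λ x → f x ^ n)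
∏-^ [] f n = ℕ.^-zeroˡ n
∏-^ (x ∷ xs) f n = trans (^-distribʳ n (f x) _) (cong (f x ^ n *_) (∏-^ xs f n))

∏-power : ∀ {A : Set} (xs : List A) c (f : A → ℕ) → ∏ xs (λ x → c ^ f x) ≡ c ^ ∑ xs f
∏-power [] c f = refl
∏-power (x ∷ xs) c f = trans (cong (c ^ f x *_) (∏-power xs c f)) (sym (^-distribˡ-+-* c (f x) _))

^-cancelʳ-≤ : ∀ {x y} n .{{_ : ℕ.NonZero n}} → x ^ n ≤ y ^ n → x ≤ y
^-cancelʳ-≤ n le = ≮⇒≥ λ y<x → <⇒≱ (ℕ.^-monoˡ-< n y<x) le

n<2^n : ∀ n → n < 2 ^ n
n<2^n zero = s≤s z≤n
n<2^n (suc n) = begin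
  suc (suc n)                ≡⟨ ℕ.+-comm 1 (suc n) ⟩
  suc n + 1                ≤⟨ +-mono-≤ (n<2^n n) (m^n>0 2 n) ⟩
  2 ^ n + 2 ^ n        ≡⟨ cong (2 ^ n ℕ.+_) (sym (ℕ.+-identityʳ _)) ⟩
  2 * 2 ^ n              ∎
  where open ℕ.≤-Reasoning

-- (1 + 1/N)^j ≤ 1 / (1 - j/N)
reverse-bernoulli : ∀ N j → suc N ^ j * (N ∸ j) ≤ N ^ j * N
reverse-bernoulli N zero = ≤-refl
reverse-bernoulli N (suc j) with ℕ.≤-<-connex N j
... | inj₁ N≤j = ≤-trans (≤-reflexive (trans (cong (suc N ^ suc j *_) (ℕ.m≤n⇒m∸n≡0 (m≤n⇒m≤1+n N≤j)))
  (ℕ.*-zeroʳ (suc N ^ suc j)))) z≤n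
... | inj₂ j<N = begin
  suc N * suc N ^ j * d     ≡⟨ swap (suc N) (suc N ^ j) d ⟩
  suc N ^ j * (suc N * d)   ≤⟨ *-monoʳ-≤ (suc N ^ j) step ⟩
  suc N ^ j * ((N ∸ j) * N) ≡⟨ sym (ℕ.*-assoc (suc N ^ j) (N ∸ j) N) ⟩
  suc N ^ j * (N ∸ j) * N   ≤⟨ *-monoˡ-≤ N (reverse-bernoulli N j) ⟩
  N ^ j * N * N             ≡⟨ cong (_* N) (ℕ.*-comm (N ^ j) N) ⟩
  N ^ suc j * N               ∎
  where
  open ℕ.≤-Reasoning
  d = N ∸ suc j
  swap : ∀ a b c → a * b * c ≡ b * (a * c)
  swap = solve-∀
  N∸j : N ∸ j ≡ suc d
  N∸j = trans (sym (ℕ.suc-pred (N ∸ j) {{>-nonZero (ℕ.m<n⇒0<n∸m j<N)}})) (cong suc (ℕ.pred[m∸n]≡m∸[1+n] N j))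
  step : suc N * d ≤ (N ∸ j) * N
  step = subst (λ z → suc N * d ≤ z * N) (sym N∸j) (+-mono-≤ (m∸n≤m N (suc j)) (≤-reflexive (ℕ.*-comm N d)))

-- Applied to the whole exponent N, `reverse-bernoulli` is empty. Halves of N work: the lower one
-- leaves at least N/2 and costs 2, the upper one leaves at least N/4 and costs 4.
1+1/N-bound : ∀ N → 2 ≤ N → suc N ^ N ≤ 8 * N ^ N
1+1/N-bound N 2≤N = begin
  suc N ^ N
    ≡⟨ trans (cong (suc N ^_) (sym halves)) (^-distribˡ-+-* (suc N) j k) ⟩
  suc N ^ j * suc N ^ k
    ≤⟨ *-mono-≤ (partial j 2 low) (partial k 4 high) ⟩
  (2 * N ^ j) * (4 * N ^ k)
    ≡⟨ eq (N ^ j) (N ^ k) ⟩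
  8 * (N ^ j * N ^ k)
    ≡⟨ cong (8 *_) (trans (sym (^-distribˡ-+-* N j k)) (cong (N ^_) halves)) ⟩
  8 * N ^ N ∎
  where
  open ℕ.≤-Reasoning
  j = ⌊ N /2⌋
  k = ⌈ N /2⌉
  halves : j + k ≡ N
  halves = ℕ.⌊n/2⌋+⌈n/2⌉≡n N
  j≤k : j ≤ k
  j≤k = ℕ.⌊n/2⌋≤⌈n/2⌉ N
  1≤j : 1 ≤ j
  1≤j = ℕ.⌊n/2⌋-mono 2≤N
  k≤1+j : k ≤ suc j
  k≤1+j = go N
    where
    go : ∀ n → ⌈ n /2⌉ ≤ suc ⌊ n /2⌋
    go zero = z≤n
    go (suc zero) = s≤s z≤n
    go (suc (suc n)) = s≤s (go n)
  eq : ∀ a b → (2 * a) * (4 * b) ≡ 8 * (a * b)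
  eq = solve-∀
  low : N ≤ 2 * (N ∸ j)
  low = begin
    N                  ≡⟨ sym halves ⟩
    j + k            ≤⟨ +-mono-≤ j≤k (m≤m+n k 0) ⟩
    2 * k            ≡⟨ cong (2 *_) (sym (trans (cong (_∸ j) (sym halves)) (ℕ.m+n∸m≡n j k))) ⟩
    2 * (N ∸ j)      ∎
  high : N ≤ 4 * (N ∸ k)
  high = begin
    N                  ≡⟨ sym halves ⟩
    j + k            ≤⟨ +-monoʳ-≤ j (≤-trans k≤1+j (≤-trans (+-monoˡ-≤ j 1≤j) (+-monoʳ-≤ j (m≤m+n j (j + 0))))) ⟩
    4 * j            ≡⟨ cong (4 *_) (sym (trans (cong (_∸ k) (sym halves)) (ℕ.m+n∸n≡m j k))) ⟩
    4 * (N ∸ k)      ∎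
  partial : ∀ i c → N ≤ c * (N ∸ i) → suc N ^ i ≤ c * N ^ i
  partial i c le = ℕ.*-cancelʳ-≤ _ _ N {{>-nonZero (≤-trans (s≤s z≤n) 2≤N)}} (begin
    suc N ^ i * N                     ≤⟨ *-monoʳ-≤ (suc N ^ i) le ⟩
    suc N ^ i * (c * (N ∸ i))       ≡⟨ swap (suc N ^ i) c (N ∸ i) ⟩
    c * (suc N ^ i * (N ∸ i))       ≤⟨ *-monoʳ-≤ c (reverse-bernoulli N i) ⟩
    c * (N ^ i * N)                 ≡⟨ sym (ℕ.*-assoc c (N ^ i) N) ⟩
    c * N ^ i * N                   ∎)
    where
    swap : ∀ a b c → a * (b * c) ≡ b * (a * c)
    swap = solve-∀

-- 1 + μ/N ≤ (1 + 1/N)^μ, cleared of denominators.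
bernoulli : ∀ N μ → (N + μ) * N ^ μ ≤ suc N ^ μ * N
bernoulli N zero = ≤-reflexive (trans (ℕ.*-identityʳ _) (trans (ℕ.+-identityʳ N) (sym (ℕ.+-identityʳ N))))
bernoulli N (suc μ) = begin
  (N + suc μ) * (N * N ^ μ)
    ≡⟨ expand N μ (N ^ μ) ⟩
  N * ((N + μ) * N ^ μ) + N ^ μ * N
    ≤⟨ +-mono-≤ (*-monoʳ-≤ N (bernoulli N μ)) (*-monoˡ-≤ N (^-monoˡ-≤ μ (ℕ.n≤1+n N))) ⟩
  N * (suc N ^ μ * N) + suc N ^ μ * N
    ≡⟨ collect N (suc N ^ μ) ⟩
  suc N * suc N ^ μ * N ∎
  where
  open ℕ.≤-Reasoning
  expand : ∀ N μ p → (N + (1 + μ)) * (N * p) ≡ N * ((N + μ) * p) + p * N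
  expand = solve-∀
  collect : ∀ N p → N * (p * N) + p * N ≡ (1 + N) * p * N
  collect = solve-∀

-- The N-th power of `bernoulli`, followed by the μ-th power of `1+1/N-bound`.
1+μ/N-bound : ∀ N μ → 2 ≤ N → (N + μ) ^ N ≤ 8 ^ μ * N ^ N
1+μ/N-bound N μ 2≤N = ℕ.*-cancelʳ-≤ _ _ ((N ^ μ) ^ N) {{nonZero}} (begin
  (N + μ) ^ N * (N ^ μ) ^ N
    ≡⟨ sym (^-distribʳ N (N + μ) (N ^ μ)) ⟩
  ((N + μ) * N ^ μ) ^ N
    ≤⟨ ^-monoˡ-≤ N (bernoulli N μ) ⟩
  (suc N ^ μ * N) ^ N
    ≡⟨ trans (^-distribʳ N (suc N ^ μ) N) (cong (_* N ^ N) (swap-powers (suc N))) ⟩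
  (suc N ^ N) ^ μ * N ^ N
    ≤⟨ *-monoˡ-≤ (N ^ N) (^-monoˡ-≤ μ (1+1/N-bound N 2≤N)) ⟩
  (8 * N ^ N) ^ μ * N ^ N
    ≡⟨ cong (_* N ^ N) (trans (^-distribʳ μ 8 (N ^ N)) (cong (8 ^ μ *_) (sym (swap-powers N)))) ⟩
  8 ^ μ * (N ^ μ) ^ N * N ^ N
    ≡⟨ swap (8 ^ μ) ((N ^ μ) ^ N) (N ^ N) ⟩
  8 ^ μ * N ^ N * (N ^ μ) ^ N ∎)
  where
  open ℕ.≤-Reasoning
  N-nonZero : ℕ.NonZero N
  N-nonZero = >-nonZero (≤-trans (s≤s z≤n) 2≤N)
  nonZero : ℕ.NonZero ((N ^ μ) ^ N)
  nonZero = m^n≢0 (N ^ μ) N {{m^n≢0 N μ {{N-nonZero}}}}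
  swap-powers : ∀ x → (x ^ μ) ^ N ≡ (x ^ N) ^ μ
  swap-powers x = trans (^-*-assoc x μ N) (trans (cong (x ^_) (ℕ.*-comm μ N)) (sym (^-*-assoc x N μ)))
  swap : ∀ a b c → a * b * c ≡ a * c * b
  swap = solve-∀

-- Sums and products over primes, and the size of the losses

module PrimeSums (𝔽 : FiniteField) where
  open Vectors 𝔽

  2≤norm : ∀ p → 2 ≤ norm p
  2≤norm p = ≤-trans 2≤q (subst (_≤ norm p) (ℕ.^-identityʳ q) (^-monoʳ-≤ q (1≤degree p)))

  -- A crude count by all polynomials of degree at most M; what matters is that it does not depend
  -- on h.
  count-low-degree : ∀ M rs → AllPairs Distinct rs → ∑ rs (λ p → ⟦ degree p ℕ.≤? M ⟧) ≤ q ^ suc M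
  count-low-degree M rs distinct = begin
    ∑ rs (λ p → ⟦ degree p ℕ.≤? M ⟧)
      ≡⟨ sym (length-filter (λ p → degree p ℕ.≤? M) rs) ⟩
    length low
      ≡⟨ sym (List.length-map φ low) ⟩
    length (map φ low)
      ≤⟨ unique-⊆⇒length-≤ (unique low (AllPairs.filter⁺ (λ p → degree p ℕ.≤? M) distinct)
           (λ p∈ → ∈-filter⁻ (λ p → degree p ℕ.≤? M) {xs = rs} p∈ .proj₂)) mem ⟩
    length (allPol (suc M))
      ≡⟨ length-allPol (suc M) ⟩
    q ^ suc M ∎
    where
    open ℕ.≤-Reasoning
    low = filter (λ p → degree p ℕ.≤? M) rs
    φ : Prime → Pol
    φ p = trunc (suc M) (pol p)
    φ≋ : ∀ {p} → degree p ≤ M → φ p ≋ pol p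
    φ≋ {p} le = trunc-≋ (suc M) (Small-mono (s≤s le) (small (monic p)))
    mem : ∀ {Z} → Z ∈ map φ low → Z ∈ allPol (suc M)
    mem Z∈ with ∈-map⁻ φ Z∈
    ... | p , _ , refl = trunc∈ (suc M) (pol p)
    unique : ∀ ps → AllPairs Distinct ps → (∀ {p} → p ∈ ps → degree p ≤ M) → Unique (map φ ps)
    unique [] _ _ = []
    unique (p ∷ ps) (p≢ ∷ ds) le = All.tabulate separate ∷ unique ps ds (le ∘ there)
      where
      separate : ∀ {Z} → Z ∈ map φ ps → φ p ≢ Z
      separate Z∈ e with ∈-map⁻ φ Z∈
      ... | r , r∈ , Z≡ = All.lookup p≢ r∈ (≋-trans (≋-sym (φ≋ {p} (le (here refl))))
        (≋-trans (≋-reflexive (trans e Z≡)) (φ≋ {r} (le (there r∈)))))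

  count-multiples : ∀ k p → degree p ≤ k → q ^ (k ∸ degree p) ≤ ∑ (allPol k) (λ X → ⟦ p ∣? X ⟧)
  count-multiples k p d≤k = begin
    q ^ (k ∸ degree p)
      ≡⟨ trans (sym (length-allPol (k ∸ degree p))) (sym (List.length-map φ (allPol (k ∸ degree p)))) ⟩
    length (map φ (allPol (k ∸ degree p)))
      ≤⟨ unique-⊆⇒length-≤ (map-unique inj (allPol-unique (k ∸ degree p))) mem ⟩
    length (filter (p ∣?_) (allPol k))
      ≡⟨ length-filter (p ∣?_) (allPol k) ⟩
    ∑ (allPol k) (λ X → ⟦ p ∣? X ⟧) ∎
    where
    open ℕ.≤-Reasoning
    φ : Pol → Pol
    φ X = trunc k (X *P pol p)
    φ≋ : ∀ {X} → X ∈ allPol (k ∸ degree p) → φ X ≋ (X *P pol p)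
    φ≋ {X} X∈ = trunc-≋ k (mult (zero⊎top X))
      where
      mult : X ≋ [] ⊎ ∃ (Top X) → Small k (X *P pol p)
      mult (inj₁ X≋0) = Small-resp (≋-sym (*-cong X≋0 (≋-refl {pol p}))) Small-[]
      mult (inj₂ (j , t)) = Small-mono (subst (suc (j + degree p) ≤_) (ℕ.m∸n+n≡m d≤k)
        (+-monoˡ-≤ (degree p) (top-< t (∈-Small {k ∸ degree p} X∈)))) (Small-* X (bound t) (small (monic p)))
    inj : ∀ {X X′} → X ∈ allPol (k ∸ degree p) → X′ ∈ allPol (k ∸ degree p) → φ X ≡ φ X′ → X ≡ X′
    inj {X} {X′} X∈ X′∈ e = ∈-≋⇒≡ {k ∸ degree p} X∈ X′∈ (divMod-unique (monic p) {X} {[]} {X′} {[]}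
      (≋-trans (+-identityʳ _) (≋-trans (≋-trans (≋-sym (φ≋ X∈)) (≋-trans (≋-reflexive e) (φ≋ X′∈))) (≋-sym (+-identityʳ _))))
      Small-[] Small-[] .proj₁)
    mem : ∀ {Z} → Z ∈ map φ (allPol (k ∸ degree p)) → Z ∈ filter (p ∣?_) (allPol k)
    mem Z∈ with ∈-map⁻ φ Z∈
    ... | X , X∈ , refl = ∈-filter⁺ (p ∣?_) (trunc∈ k _) (divides X (≋-sym (φ≋ X∈)))

  -- Every nonzero G of degree ≤ k is divisible by primes of total degree at most k.
  mertens : ∀ k rs → AllPairs Distinct rs → (∀ {p} → p ∈ rs → degree p ≤ k) →
    ∑ rs (λ p → degree p * q ^ (suc k ∸ degree p)) ≤ 2 * (k * q ^ suc k)
  mertens k rs distinct deg≤ = ℕ.+-cancelʳ-≤ S S _ (begin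
    S + S
      ≤⟨ +-mono-≤ S≤ S≤ ⟩
    (k * W + D) + (k * W + D)
      ≡⟨ regroup (k * W) D ⟩
    2 * (k * W) + 2 * D
      -- Each power of q in `S` is at least 2, so 2 D ≤ S; this is why the estimate starts from S +
      -- S.
      ≤⟨ +-monoʳ-≤ (2 * (k * W)) (≤-trans (≤-reflexive (sym (∑-*ˡ 2 rs degree))) (∑-mono-∈ rs (λ {p} p∈ →
           ≤-trans (≤-reflexive (ℕ.*-comm 2 (degree p))) (*-monoʳ-≤ (degree p) (≤-trans 2≤q
             (subst (_≤ q ^ (suc k ∸ degree p)) (ℕ.^-identityʳ q)
               (^-monoʳ-≤ q (ℕ.m<n⇒0<n∸m (s≤s (deg≤ p∈)))))))))) ⟩
    2 * (k * W) + S ∎)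
    where
    open ℕ.≤-Reasoning
    W = q ^ suc k
    S = ∑ rs (λ p → degree p * q ^ (suc k ∸ degree p))
    D = ∑ rs degree
    regroup : ∀ a b → (a + b) + (a + b) ≡ 2 * a + 2 * b
    regroup = solve-∀
    Z₀ = trunc (suc k) []
    zero-vector : Z₀ ≋ []
    zero-vector = trunc-≋ (suc k) Small-[]
    divisorDegree≤D : ∀ G → divisorDegree rs G ≤ D
    divisorDegree≤D G = ∑-mono-∈ rs (λ {p} _ → indicator≤ (p ∣? G) (degree p))
      where
      indicator≤ : ∀ {R : Set} (d : Dec R) n → ⟦ d ⟧ * n ≤ n
      indicator≤ (yes _) n = ≤-reflexive (ℕ.*-identityˡ n)
      indicator≤ (no _) n = z≤n
    -- The polynomial 0 is divisible by every prime and is charged `D`; any other G has degree at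
    -- most k.
    per-polynomial : ∀ {G} → G ∈ allPol (suc k) → divisorDegree rs G ≤ k + ⟦ List.≡-dec _≟_ G Z₀ ⟧ * D
    per-polynomial {G} G∈ with List.≡-dec _≟_ G Z₀
    ... | yes _ = ≤-trans (divisorDegree≤D G) (≤-trans (m≤m+n D 0) (m≤n+m _ k))
    ... | no G≢ = ≤-trans (≤-pred (≰⇒> λ le → G≢ (∈-≋⇒≡ {suc k} G∈ (trunc∈ (suc k) [])
            (≋-trans (Small-divisorDegree {rs} distinct (Small-mono le (∈-Small {suc k} G∈))) (≋-sym zero-vector)))))
            (m≤m+n k 0)
    S≤ : S ≤ k * W + D
    S≤ = begin
      S
        ≤⟨ ∑-mono-∈ rs (λ {p} p∈ → *-monoʳ-≤ (degree p) (count-multiples (suc k) p (m≤n⇒m≤1+n (deg≤ p∈)))) ⟩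
      ∑ rs (λ p → degree p * ∑ (allPol (suc k)) (λ X → ⟦ p ∣? X ⟧))
        ≡⟨ trans (∑-cong rs (λ p → trans (ℕ.*-comm (degree p) _) (sym (∑-*ʳ (degree p) (allPol (suc k)) _)))) (∑-swap rs (allPol (suc k)) _) ⟩
      ∑ (allPol (suc k)) (divisorDegree rs)
        ≤⟨ ∑-mono-∈ (allPol (suc k)) per-polynomial ⟩
      ∑ (allPol (suc k)) (λ G → k + ⟦ List.≡-dec _≟_ G Z₀ ⟧ * D)
        ≡⟨ trans (∑-+ (allPol (suc k)) _ _) (cong₂ _+_
             (trans (∑-const k (allPol (suc k))) (trans (cong (_* k) (length-allPol (suc k))) (ℕ.*-comm W k)))
             (∑-kronecker (List.≡-dec _≟_) (λ _ → D) (allPol-unique (suc k)) (trunc∈ (suc k) []))) ⟩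
      k * W + D ∎

  module Constants (μ : ℕ) (1≤μ : 1 ≤ μ) (M : ℕ) (M≢0 : ℕ.NonZero M) (h : ℕ) (rs : List Prime)
    (distinct : AllPairs Distinct rs) (deg≤ : ∀ {p} → p ∈ rs → degree p ≤ 2 * h) where

    private
      instance
        M-nonZero : ℕ.NonZero M
        M-nonZero = M≢0
        μ-nonZero : ℕ.NonZero μ
        μ-nonZero = >-nonZero 1≤μ

    e N : ℕ
    e = h ℕ./ M
    N = q ^ suc M

    low high : Prime → ℕ
    low p = ⟦ degree p ℕ.≤? M ⟧
    high p = 1 ∸ low p

    M*high≤degree : ∀ p → M * high p ≤ degree p
    M*high≤degree p with ℕ.≤-<-connex (degree p) M
    ... | inj₁ le = subst (λ z → M * (1 ∸ z) ≤ degree p) (sym (⟦⟧-true (degree p ℕ.≤? M) le))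
      (≤-trans (≤-reflexive (ℕ.*-zeroʳ M)) z≤n)
    ... | inj₂ lt = subst (λ z → M * (1 ∸ z) ≤ degree p) (sym (⟦⟧-false (degree p ℕ.≤? M) (<⇒≱ lt)))
      (≤-trans (≤-reflexive (ℕ.*-identityʳ M)) (<⇒≤ lt))

    cancel-M : ∀ {x} y → M * x ≤ M * y → x ≤ y
    cancel-M y = ℕ.*-cancelˡ-≤ M

    h≤M[1+e] : h ≤ M * suc e
    h≤M[1+e] = begin
      h                       ≡⟨ ℕ.m≡m%n+[m/n]*n h M ⟩
      h ℕ.% M + e * M     ≤⟨ +-monoˡ-≤ (e * M) (<⇒≤ (ℕ.m%n<n h M)) ⟩
      M + e * M           ≡⟨ ℕ.*-comm (suc e) M ⟩
      M * suc e             ∎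
      where open ℕ.≤-Reasoning

    -- At most N of the primes have degree M or less; of the larger ones, at most h/M fit into total
    -- degree h.
    power-bound : PowerBound rs h μ (μ ^ (N + e))
    power-bound b small-degree = begin
      ∏ rs (λ p → if b p then μ else 1)
        ≡⟨ trans (∏-cong rs (λ p → as-power (b p))) (∏-power rs μ (λ p → if b p then 1 else 0)) ⟩
      μ ^ ∑ rs (λ p → if b p then 1 else 0)
        ≤⟨ ^-monoʳ-≤ μ (begin
             ∑ rs (λ p → if b p then 1 else 0)          ≤⟨ ∑-mono-∈ rs (λ {p} _ → split (b p) (degree p ℕ.≤? M)) ⟩
             ∑ rs (λ p → low p + selected p)          ≡⟨ ∑-+ rs low selected ⟩
             ∑ rs low + ∑ rs selected                 ≤⟨ +-mono-≤ (count-low-degree M rs distinct) few ⟩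
             N + e                                    ∎) ⟩
      μ ^ (N + e) ∎
      where
      open ℕ.≤-Reasoning
      selected : Prime → ℕ
      selected p = if b p then high p else 0
      as-power : ∀ b → (if b then μ else 1) ≡ μ ^ (if b then 1 else 0)
      as-power true = sym (ℕ.*-identityʳ μ)
      as-power false = refl
      split : ∀ {P : Set} b (d : Dec P) → (if b then 1 else 0) ≤ ⟦ d ⟧ + (if b then 1 ∸ ⟦ d ⟧ else 0)
      split true (yes _) = s≤s z≤n
      split true (no _) = s≤s z≤n
      split false _ = z≤n
      few : ∑ rs selected ≤ e
      few = subst (_≤ e) (ℕ.m*n/n≡m (∑ rs selected) M) (ℕ./-monoˡ-≤ M (begin
        ∑ rs selected * M                       ≡⟨ trans (ℕ.*-comm _ M) (sym (∑-*ˡ M rs selected)) ⟩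
        ∑ rs (λ p → M * selected p)             ≤⟨ ∑-mono-∈ rs (λ {p} _ → scaled p (b p)) ⟩
        ∑ rs (λ p → if b p then degree p else 0)  ≤⟨ <⇒≤ small-degree ⟩
        h                                         ∎))
        where
        scaled : ∀ p b → M * (if b then high p else 0) ≤ (if b then degree p else 0)
        scaled p true = M*high≤degree p
        scaled p false = ≤-reflexive (ℕ.*-zeroʳ M)

    -- Each prime of degree at most M costs no more than 1 + μ. For the others 1 + μ/|P| ≤
    -- 8^(μ/|P|), and the sum of 1/|P| over them is at most 1/M times the sum of deg P/|P|, which is
    -- at most 4h by `mertens`. Raising everything to the power W, a multiple of all norms, avoids
    -- fractional exponents.
    product-bound : ProductBound rs μ (suc μ ^ N * 8 ^ (μ * (4 * suc e)))
    product-bound b = begin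
      ∏ rs (λ p → if b p then norm p + μ else 1)
        ≤⟨ ∏-mono-∈ rs (λ {p} _ → pointwise p (b p) (degree p ℕ.≤? M)) ⟩
      ∏ rs (λ p → suc μ ^ low p * c p)
        ≡⟨ trans (∏-* rs _ c) (cong (_* ∏ rs c) (∏-power rs (suc μ) low)) ⟩
      suc μ ^ ∑ rs low * ∏ rs c
        ≤⟨ *-mono-≤ (^-monoʳ-≤ (suc μ) (count-low-degree M rs distinct)) (^-cancelʳ-≤ W {{m^n≢0 q (suc k)}} powers) ⟩
      suc μ ^ N * (8 ^ (μ * (4 * suc e)) * ∏ rs ν)
        ≡⟨ sym (ℕ.*-assoc (suc μ ^ N) _ _) ⟩
      (suc μ ^ N * 8 ^ (μ * (4 * suc e))) * ∏ rs ν ∎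
      where
      open ℕ.≤-Reasoning
      k = 2 * h
      W = q ^ suc k
      ν c g : Prime → ℕ
      ν p = if b p then norm p else 1
      c p = if b p then norm p + μ * high p else 1
      g p = high p * q ^ (suc k ∸ degree p)
      pointwise : ∀ p b {P : Set} (d : Dec P) → (if b then norm p + μ else 1)
        ≤ suc μ ^ ⟦ d ⟧ * (if b then norm p + μ * (1 ∸ ⟦ d ⟧) else 1)
      pointwise p true (yes _) = begin
        norm p + μ                                ≤⟨ +-monoʳ-≤ (norm p) (ℕ.m≤m*n μ (norm p) {{m^n≢0 q (degree p)}}) ⟩
        norm p + μ * norm p                     ≡⟨ eq μ (norm p) ⟩
        suc μ ^ 1 * (norm p + μ * 0)        ∎
        where
        eq : ∀ μ n → n + μ * n ≡ (1 + μ) * 1 * (n + μ * 0)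
        eq = solve-∀
      pointwise p true (no _) = ≤-reflexive (trans (cong (norm p ℕ.+_) (sym (ℕ.*-identityʳ μ))) (sym (ℕ.*-identityˡ _)))
      pointwise p false d = subst (1 ≤_) (sym (ℕ.*-identityʳ _)) (m^n>0 (suc μ) ⟦ d ⟧)
      W≡ : ∀ {p} → p ∈ rs → W ≡ norm p * q ^ (suc k ∸ degree p)
      W≡ {p} p∈ = trans (cong (q ^_) (sym (ℕ.m+[n∸m]≡n (m≤n⇒m≤1+n (deg≤ p∈))))) (^-distribˡ-+-* q (degree p) _)
      c-power : ∀ {p} → p ∈ rs → c p ^ W ≤ 8 ^ (μ * g p) * ν p ^ W
      c-power {p} p∈ = go (b p) (degree p ℕ.≤? M)
        where
        u = q ^ (suc k ∸ degree p)
        go : ∀ b {P : Set} (d : Dec P) → (if b then norm p + μ * (1 ∸ ⟦ d ⟧) else 1) ^ W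
          ≤ 8 ^ (μ * ((1 ∸ ⟦ d ⟧) * u)) * (if b then norm p else 1) ^ W
        go false d = ℕ.m≤n*m _ _ {{m^n≢0 8 (μ * ((1 ∸ ⟦ d ⟧) * u))}}
        go true (yes _) = begin
          (norm p + μ * 0) ^ W            ≡⟨ cong (_^ W) (trans (cong (norm p ℕ.+_) (ℕ.*-zeroʳ μ)) (ℕ.+-identityʳ (norm p))) ⟩
          norm p ^ W                          ≤⟨ ℕ.m≤n*m _ _ {{m^n≢0 8 (μ * 0)}} ⟩
          8 ^ (μ * 0) * norm p ^ W      ∎
        go true (no _) = begin
          (norm p + μ * 1) ^ W
            ≡⟨ trans (cong₂ (λ x y → (norm p + x) ^ y) (ℕ.*-identityʳ μ) (W≡ p∈)) (sym (^-*-assoc (norm p + μ) (norm p) u)) ⟩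
          ((norm p + μ) ^ norm p) ^ u
            ≤⟨ ^-monoˡ-≤ u (1+μ/N-bound (norm p) μ (2≤norm p)) ⟩
          (8 ^ μ * norm p ^ norm p) ^ u
            ≡⟨ trans (^-distribʳ u (8 ^ μ) _) (cong₂ _*_ (^-*-assoc 8 μ u)
                 (trans (^-*-assoc (norm p) (norm p) u) (cong (norm p ^_) (sym (W≡ p∈))))) ⟩
          8 ^ (μ * u) * norm p ^ W
            ≡⟨ cong (λ z → 8 ^ (μ * z) * norm p ^ W) (sym (ℕ.*-identityˡ u)) ⟩
          8 ^ (μ * (1 * u)) * norm p ^ W ∎
      ∑g : ∑ rs g ≤ 4 * suc e * W
      ∑g = cancel-M _ (begin
        M * ∑ rs g
          ≡⟨ sym (∑-*ˡ M rs g) ⟩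
        ∑ rs (λ p → M * (high p * q ^ (suc k ∸ degree p)))
          ≤⟨ ∑-mono-∈ rs (λ {p} _ → ≤-trans (≤-reflexive (sym (ℕ.*-assoc M (high p) _))) (*-monoˡ-≤ _ (M*high≤degree p))) ⟩
        ∑ rs (λ p → degree p * q ^ (suc k ∸ degree p))
          ≤⟨ mertens k rs distinct deg≤ ⟩
        2 * (2 * h * W)
          ≤⟨ *-monoʳ-≤ 2 (*-monoˡ-≤ W (*-monoʳ-≤ 2 h≤M[1+e])) ⟩
        2 * (2 * (M * suc e) * W)
          ≡⟨ eq M (suc e) W ⟩
        M * (4 * suc e * W) ∎)
        where
        eq : ∀ M s W → 2 * (2 * (M * s) * W) ≡ M * (4 * s * W)
        eq = solve-∀
      powers : ∏ rs c ^ W ≤ (8 ^ (μ * (4 * suc e)) * ∏ rs ν) ^ W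
      powers = begin
        ∏ rs c ^ W
          ≡⟨ ∏-^ rs c W ⟩
        ∏ rs (λ p → c p ^ W)
          ≤⟨ ∏-mono-∈ rs c-power ⟩
        ∏ rs (λ p → 8 ^ (μ * g p) * ν p ^ W)
          ≡⟨ trans (∏-* rs _ _) (cong₂ _*_ (trans (∏-power rs 8 (λ p → μ * g p)) (cong (8 ^_) (∑-*ˡ μ rs g))) (sym (∏-^ rs ν W))) ⟩
        8 ^ (μ * ∑ rs g) * ∏ rs ν ^ W
          ≤⟨ *-monoˡ-≤ (∏ rs ν ^ W) (^-monoʳ-≤ 8 (≤-trans (*-monoʳ-≤ μ ∑g) (≤-reflexive (sym (ℕ.*-assoc μ (4 * suc e) W))))) ⟩
        8 ^ (μ * (4 * suc e) * W) * ∏ rs ν ^ W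
          ≡⟨ trans (cong (_* ∏ rs ν ^ W) (sym (^-*-assoc 8 (μ * (4 * suc e)) W))) (sym (^-distribʳ W _ (∏ rs ν))) ⟩
        (8 ^ (μ * (4 * suc e)) * ∏ rs ν) ^ W ∎

  -- The last inequality says that the total loss in the fifth moment is at most C H^(1/b).
  Losses : ℕ → ℕ → ℕ → ℕ → List Prime → Set
  Losses μ b C h rs = ∃ λ L → ∃ λ Γ → ProductBound rs μ L × PowerBound rs h μ Γ ×
    (4 * ((L + h * Γ) ^ 3 * (1 + L))) ^ b ≤ C ^ b * q ^ h

  -- Every loss is at most C · A ^ ⌊h / M⌋ with A independent of M, so M is taken so large that A ^ (b / M) ≤ 2.
  losses : ∀ μ → 1 ≤ μ → ∀ b → 1 ≤ b → ∃ λ C → ∀ h rs → AllPairs Distinct rs →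
    (∀ {p} → p ∈ rs → degree p ≤ 2 * h) → Losses μ b C h rs
  losses μ 1≤μ b 1≤b = 8 * c ^ 4 , λ h rs distinct deg≤ → let e = h ℕ./ M in
      suc μ ^ N * 8 ^ (μ * (4 * suc e)) , μ ^ (N + e) ,
      Constants.product-bound μ 1≤μ M M≢0 h rs distinct deg≤ ,
      Constants.power-bound μ 1≤μ M M≢0 h rs distinct deg≤ ,
      total h (Constants.h≤M[1+e] μ 1≤μ M M≢0 h rs distinct deg≤)
    where
    open ℕ.≤-Reasoning
    -- A common base for both losses: the power of 8 covers L, and 2 μ covers h Γ, since h ≤ M 2^e
    -- for e = h / M.
    A = 8 ^ (4 * μ) * (2 * μ)
    -- The total contains four factors of order A^e: three of `L + h * Γ` and one of `1 + L`.
    t = A ^ 4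
    M = t * b
    N = q ^ suc M
    instance
      μ-nonZero : ℕ.NonZero μ
      μ-nonZero = >-nonZero 1≤μ
      A-nonZero : ℕ.NonZero A
      A-nonZero = ℕ.m*n≢0 _ _ {{m^n≢0 8 (4 * μ)}} {{ℕ.m*n≢0 2 μ}}
      M≢0 : ℕ.NonZero M
      M≢0 = ℕ.m*n≢0 t b {{m^n≢0 A 4}} {{>-nonZero 1≤b}}
    c₁ = suc μ ^ N * 8 ^ (4 * μ)
    c₂ = M * μ ^ N
    c = c₁ + c₂
    total : ∀ h → h ≤ M * suc (h ℕ./ M) →
      (4 * ((suc μ ^ N * 8 ^ (μ * (4 * suc (h ℕ./ M))) + h * μ ^ (N + h ℕ./ M)) ^ 3
        * (1 + suc μ ^ N * 8 ^ (μ * (4 * suc (h ℕ./ M)))))) ^ b ≤ (8 * c ^ 4) ^ b * q ^ h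
    total h h≤ = begin
      (4 * ((L + h * Γ) ^ 3 * (1 + L))) ^ b
        ≤⟨ ^-monoˡ-≤ b (*-monoʳ-≤ 4 (*-mono-≤ (^-monoˡ-≤ 3 loss≤) 1+L≤)) ⟩
      (4 * ((c * x) ^ 3 * (2 * (c * x)))) ^ b
        ≡⟨ cong (_^ b) (eq c x) ⟩
      ((8 * c ^ 4) * x ^ 4) ^ b
        ≡⟨ ^-distribʳ b (8 * c ^ 4) (x ^ 4) ⟩
      (8 * c ^ 4) ^ b * (x ^ 4) ^ b
        ≤⟨ *-monoʳ-≤ ((8 * c ^ 4) ^ b) x-power ⟩
      (8 * c ^ 4) ^ b * q ^ h ∎
      where
      e = h ℕ./ M
      x = A ^ e
      L = suc μ ^ N * 8 ^ (μ * (4 * suc e))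
      Γ = μ ^ (N + e)
      eq : ∀ c x → 4 * ((c * x) * ((c * x) * ((c * x) * 1)) * (2 * (c * x)))
        ≡ (8 * (c * (c * (c * (c * 1))))) * (x * (x * (x * (x * 1))))
      eq = solve-∀
      exponent : ∀ μ e → μ * (4 * (1 + e)) ≡ 4 * μ + 4 * μ * e
      exponent = solve-∀
      L≤ : L ≤ c₁ * x
      L≤ = begin
        suc μ ^ N * 8 ^ (μ * (4 * suc e))
          ≡⟨ cong (suc μ ^ N *_) (trans (cong (8 ^_) (exponent μ e)) (^-distribˡ-+-* 8 (4 * μ) (4 * μ * e))) ⟩
        suc μ ^ N * (8 ^ (4 * μ) * 8 ^ (4 * μ * e))
          ≡⟨ trans (sym (ℕ.*-assoc (suc μ ^ N) _ _)) (cong (c₁ *_) (sym (^-*-assoc 8 (4 * μ) e))) ⟩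
        c₁ * (8 ^ (4 * μ)) ^ e
          ≤⟨ *-monoʳ-≤ c₁ (^-monoˡ-≤ e (ℕ.m≤m*n (8 ^ (4 * μ)) (2 * μ) {{ℕ.m*n≢0 2 μ}})) ⟩
        c₁ * x ∎
      hΓ≤ : h * Γ ≤ c₂ * x
      hΓ≤ = begin
        h * μ ^ (N + e)
          ≤⟨ *-mono-≤ (≤-trans h≤ (*-monoʳ-≤ M (n<2^n e))) (≤-reflexive (^-distribˡ-+-* μ N e)) ⟩
        (M * 2 ^ e) * (μ ^ N * μ ^ e)
          ≡⟨ swap M (2 ^ e) (μ ^ N) (μ ^ e) ⟩
        c₂ * (2 ^ e * μ ^ e)
          ≡⟨ cong (c₂ *_) (sym (^-distribʳ e 2 μ)) ⟩
        c₂ * (2 * μ) ^ e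
          ≤⟨ *-monoʳ-≤ c₂ (^-monoˡ-≤ e (ℕ.m≤n*m (2 * μ) (8 ^ (4 * μ)) {{m^n≢0 8 (4 * μ)}})) ⟩
        c₂ * x ∎
        where
        swap : ∀ a b c d → (a * b) * (c * d) ≡ (a * c) * (b * d)
        swap = solve-∀
      loss≤ : L + h * Γ ≤ c * x
      loss≤ = ≤-trans (+-mono-≤ L≤ hΓ≤) (≤-reflexive (sym (ℕ.*-distribʳ-+ x c₁ c₂)))
      L≤cx : L ≤ c * x
      L≤cx = ≤-trans (m≤m+n L _) loss≤
      1≤L : 1 ≤ L
      1≤L = *-mono-≤ (m^n>0 (suc μ) N) (m^n>0 8 (μ * (4 * suc e)))
      1+L≤ : 1 + L ≤ 2 * (c * x)
      1+L≤ = ≤-trans (+-mono-≤ (≤-trans 1≤L L≤cx) L≤cx)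
        (≤-reflexive (cong (c * x ℕ.+_) (sym (ℕ.+-identityʳ _))))
      x-power : (x ^ 4) ^ b ≤ q ^ h
      x-power = begin
        (x ^ 4) ^ b
          ≡⟨ cong (_^ b) (trans (^-*-assoc A e 4) (trans (cong (A ^_) (ℕ.*-comm e 4)) (sym (^-*-assoc A 4 e)))) ⟩
        (t ^ e) ^ b
          -- Since t ≤ 2^t and M = t b, the exponent of 2 becomes e M, which is at most h.
          ≤⟨ ^-monoˡ-≤ b (^-monoˡ-≤ e (<⇒≤ (n<2^n t))) ⟩
        ((2 ^ t) ^ e) ^ b
          ≡⟨ trans (cong (_^ b) (^-*-assoc 2 t e)) (^-*-assoc 2 (t * e) b) ⟩
        2 ^ (t * e * b)
          ≤⟨ ^-monoʳ-≤ 2 (subst (_≤ h) (reorder t b e) (ℕ.m/n*n≤m h M)) ⟩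
        2 ^ h
          ≤⟨ ^-monoˡ-≤ h 2≤q ⟩
        q ^ h ∎
        where
        reorder : ∀ t b e → e * (t * b) ≡ t * e * b
        reorder = solve-∀

-- Clearing denominators

ι : ℤ → ℚ
ι i = i / 1

toℚᵘ-/ : ∀ i d → ℚ.toℚᵘ (i / suc d) ℚᵘ.≃ ℚᵘ.mkℚᵘ i d
toℚᵘ-/ i d = ℚ.toℚᵘ-fromℚᵘ (ℚᵘ.mkℚᵘ i d)

ι-+ : ∀ i j → ι i ℚ.+ ι j ≡ ι (i ℤ.+ j)
ι-+ i j = ℚ.toℚᵘ-injective (ℚᵘ.≃-trans (ℚ.toℚᵘ-homo-+ (ι i) (ι j)) (ℚᵘ.≃-trans
  (ℚᵘ.+-cong (toℚᵘ-/ i 0) (toℚᵘ-/ j 0)) (ℚᵘ.≃-trans (ℚᵘ.*≡* (eq i j)) (ℚᵘ.≃-sym (toℚᵘ-/ (i ℤ.+ j) 0)))))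
  where
  eq : ∀ i j → (i ℤ.* 1ℤ ℤ.+ j ℤ.* 1ℤ) ℤ.* 1ℤ ≡ (i ℤ.+ j) ℤ.* 1ℤ
  eq = ℤ-Solver.solve-∀

ι-* : ∀ i j → ι i ℚ.* ι j ≡ ι (i ℤ.* j)
ι-* i j = ℚ.toℚᵘ-injective (ℚᵘ.≃-trans (ℚ.toℚᵘ-homo-* (ι i) (ι j)) (ℚᵘ.≃-trans
  (ℚᵘ.*-cong (toℚᵘ-/ i 0) (toℚᵘ-/ j 0)) (ℚᵘ.≃-trans (ℚᵘ.*≡* refl) (ℚᵘ.≃-sym (toℚᵘ-/ (i ℤ.* j) 0)))))

ι-neg : ∀ i → ℚ.- ι i ≡ ι (ℤ.- i)
ι-neg i = ℚ.toℚᵘ-injective (ℚᵘ.≃-trans (ℚ.toℚᵘ-homo‿- (ι i)) (ℚᵘ.≃-trans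
  (ℚᵘ.-‿cong (toℚᵘ-/ i 0)) (ℚᵘ.≃-sym (toℚᵘ-/ (ℤ.- i) 0))))

ι-∣∣ : ∀ i → ∣ ι i ∣ ≡ ι (+ ℤ.∣ i ∣)
ι-∣∣ i = ℚ.toℚᵘ-injective (ℚᵘ.≃-trans (ℚ.toℚᵘ-homo-∣-∣ (ι i)) (ℚᵘ.≃-trans
  (ℚᵘ.∣-∣-cong (toℚᵘ-/ i 0)) (ℚᵘ.≃-sym (toℚᵘ-/ (+ ℤ.∣ i ∣) 0))))

ι-mono : ∀ {i j} → i ℤ.≤ j → ι i ℚ.≤ ι j
ι-mono {i} {j} i≤j = ℚ.toℚᵘ-cancel-≤ (ℚᵘ.≤-respʳ-≃ (ℚᵘ.≃-sym (toℚᵘ-/ j 0)) (ℚᵘ.≤-respˡ-≃ (ℚᵘ.≃-sym (toℚᵘ-/ i 0))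
  (ℚᵘ.*≤* (ℤ.*-monoʳ-≤-nonNeg 1ℤ i≤j))))

/-*-cancel : ∀ i k .{{_ : ℕ.NonZero k}} → (i / k) ℚ.* ι (+ k) ≡ ι i
/-*-cancel i (suc d) = ℚ.toℚᵘ-injective (ℚᵘ.≃-trans (ℚ.toℚᵘ-homo-* (i / suc d) (ι (+ suc d))) (ℚᵘ.≃-trans
  (ℚᵘ.*-cong (toℚᵘ-/ i d) (toℚᵘ-/ (+ suc d) 0)) (ℚᵘ.≃-trans (ℚᵘ.*≡*
    (trans (ℤ.*-identityʳ _) (cong (λ z → i ℤ.* + suc z) (sym (ℕ.*-identityʳ d))))) (ℚᵘ.≃-sym (toℚᵘ-/ i 0)))))

^Q-* : ∀ x y n → (x ℚ.* y) ^Q n ≡ (x ^Q n) ℚ.* (y ^Q n)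
^Q-* x y zero = refl
^Q-* x y (suc n) = trans (cong (x ℚ.* y ℚ.*_) (^Q-* x y n)) (interchange x y (x ^Q n) (y ^Q n))
  where
  open ≡.≡-Reasoning
  interchange : ∀ a b c d → (a ℚ.* b) ℚ.* (c ℚ.* d) ≡ (a ℚ.* c) ℚ.* (b ℚ.* d)
  interchange a b c d = begin
    (a ℚ.* b) ℚ.* (c ℚ.* d)  ≡⟨ ℚ.*-assoc a b _ ⟩
    a ℚ.* (b ℚ.* (c ℚ.* d))  ≡⟨ cong (a ℚ.*_) (trans (sym (ℚ.*-assoc b c d)) (trans (cong (ℚ._* d) (ℚ.*-comm b c)) (ℚ.*-assoc c b d))) ⟩
    a ℚ.* (c ℚ.* (b ℚ.* d))  ≡⟨ sym (ℚ.*-assoc a c _) ⟩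
    (a ℚ.* c) ℚ.* (b ℚ.* d)  ∎

ι-^ : ∀ i n → ι i ^Q n ≡ ι (i ℤ.^ n)
ι-^ i zero = refl
ι-^ i (suc n) = trans (cong (ι i ℚ.*_) (ι-^ i n)) (ι-* i (i ℤ.^ n))

pos-^ : ∀ k n → (+ k) ℤ.^ n ≡ + (k ^ n)
pos-^ k zero = refl
pos-^ k (suc n) = trans (cong (+ k ℤ.*_) (pos-^ k n)) (sym (ℤ.pos-* k (k ^ n)))

^Q-nonNeg : ∀ {x} n → ℚ.0ℚ ℚ.≤ x → ℚ.0ℚ ℚ.≤ x ^Q n
^Q-nonNeg zero _ = ι-mono {0ℤ} {1ℤ} (ℤ.+≤+ z≤n)
^Q-nonNeg {x} (suc n) 0≤x = subst (ℚ._≤ x ℚ.* (x ^Q n)) (ℚ.*-zeroˡ (x ^Q n))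
  (ℚ.*-monoʳ-≤-nonNeg (x ^Q n) {{ℚ.nonNegative (^Q-nonNeg n 0≤x)}} 0≤x)

^Q-mono : ∀ {x y} n → ℚ.0ℚ ℚ.≤ x → x ℚ.≤ y → x ^Q n ℚ.≤ y ^Q n
^Q-mono zero _ _ = ℚ.≤-refl
^Q-mono {x} {y} (suc n) 0≤x x≤y = ℚ.≤-trans
  (ℚ.*-monoʳ-≤-nonNeg (x ^Q n) {{ℚ.nonNegative (^Q-nonNeg n 0≤x)}} x≤y)
  (ℚ.*-monoˡ-≤-nonNeg y {{ℚ.nonNegative (ℚ.≤-trans 0≤x x≤y)}} (^Q-mono n 0≤x x≤y))

∑ℚ-scale : ∀ {A : Set} (xs : List A) (g : A → ℚ) (z : A → ℤ) c → (∀ {x} → x ∈ xs → g x ℚ.* c ≡ ι (z x)) →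
  foldr ℚ._+_ ℚ.0ℚ (map g xs) ℚ.* c ≡ ι (Σℤ.∑ xs z)
∑ℚ-scale [] g z c _ = ℚ.*-zeroˡ c
∑ℚ-scale (x ∷ xs) g z c e = trans (ℚ.*-distribʳ-+ c (g x) _)
  (trans (cong₂ ℚ._+_ (e (here refl)) (∑ℚ-scale xs g z c (e ∘ there))) (ι-+ (z x) _))

scaled-difference : ∀ a j k .{{_ : ℕ.NonZero k}} → ((a / 1) ℚ.- (j / k)) ℚ.* ι (+ k) ≡ ι (+ k ℤ.* a ℤ.- j)
scaled-difference a j k = begin
  (ι a ℚ.+ ℚ.- y) ℚ.* D              ≡⟨ ℚ.*-distribʳ-+ D (ι a) (ℚ.- y) ⟩
  ι a ℚ.* D ℚ.+ (ℚ.- y) ℚ.* D        ≡⟨ cong₂ ℚ._+_ (ι-* a (+ k)) (trans (sym (ℚ.neg-distribˡ-* y D))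
                                          (cong ℚ.-_ (/-*-cancel j k))) ⟩
  ι (a ℤ.* + k) ℚ.+ ℚ.- ι j          ≡⟨ trans (cong (ι (a ℤ.* + k) ℚ.+_) (ι-neg j)) (ι-+ (a ℤ.* + k) (ℤ.- j)) ⟩
  ι (a ℤ.* + k ℤ.- j)                ≡⟨ cong (λ z → ι (z ℤ.- j)) (ℤ.*-comm a (+ k)) ⟩
  ι (+ k ℤ.* a ℤ.- j)                ∎
  where
  open ≡.≡-Reasoning
  y = j / k
  D = ι (+ k)

scaled-power : ∀ a j k .{{_ : ℕ.NonZero k}} n →
  (((a / 1) ℚ.- (j / k)) ^Q n) ℚ.* (ι (+ k) ^Q n) ≡ ι ((+ k ℤ.* a ℤ.- j) ℤ.^ n)
scaled-power a j k n = trans (sym (^Q-* ((a / 1) ℚ.- (j / k)) (ι (+ k)) n))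
  (trans (cong (_^Q n) (scaled-difference a j k)) (ι-^ (+ k ℤ.* a ℤ.- j) n))

ι-positive : ∀ k .{{_ : ℕ.NonZero k}} → ℚ.Positive (ι (+ k))
ι-positive (suc k) = ℚ.positive (ℚ.toℚᵘ-cancel-< (ℚᵘ.<-respʳ-≃ (ℚᵘ.≃-sym (toℚᵘ-/ (+ suc k) 0)) (ℚᵘ.*<* (ℤ.+<+ (s≤s z≤n)))))

-- Multiplication by `k ^ n`, which is positive, turns the rational estimate into one between
-- integers.
scaled-bound : ∀ x k .{{_ : ℕ.NonZero k}} n S c → x ℚ.* (ι (+ k) ^Q n) ≡ ι S → ℤ.∣ S ∣ ≤ c * k ^ n → ∣ x ∣ ℚ.≤ ι (+ c)
scaled-bound x k n S c x-scale S≤ = ℚ.*-cancelʳ-≤-pos (ι (+ (k ^ n))) {{ι-positive (k ^ n) {{m^n≢0 k n}}}} (begin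
  ∣ x ∣ ℚ.* D              ≡⟨ cong (∣ x ∣ ℚ.*_) (sym (ι-∣∣ (+ (k ^ n)))) ⟩
  ∣ x ∣ ℚ.* ∣ D ∣          ≡⟨ sym (ℚ.∣p*q∣≡∣p∣*∣q∣ x D) ⟩
  ∣ x ℚ.* D ∣              ≡⟨ cong ∣_∣ (trans (cong (x ℚ.*_) (sym (trans (ι-^ (+ k) n) (cong ι (pos-^ k n))))) x-scale) ⟩
  ∣ ι S ∣                  ≡⟨ ι-∣∣ S ⟩
  ι (+ ℤ.∣ S ∣)            ≤⟨ ι-mono (ℤ.+≤+ S≤) ⟩
  ι (+ (c * k ^ n))        ≡⟨ sym (trans (ι-* (+ c) (+ (k ^ n))) (cong ι (sym (ℤ.pos-* c (k ^ n))))) ⟩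
  ι (+ c) ℚ.* D            ∎)
  where
  open ℚ.≤-Reasoning
  D = ι (+ (k ^ n))

-- The fifth moment as an integer frequency sum

module Link (𝔽 : FiniteField) (rs : List (Primes.Prime 𝔽)) (distinct : AllPairs (Primes.Distinct 𝔽) rs)
  (coprime? : ∀ A B → Dec (Poly.Coprime 𝔽 A B)) (h : ℕ) where
  open Vectors 𝔽
  open Fourier 𝔽 rs distinct using (Q; m; Q-monic; cop; cop-cong; window; totient; deviation; weight; weight*; module Moments)
  open Counting coprime?

  cop-one : ∀ G ps → (∀ {p} → p ∈ ps → ¬ pol p ∣ G) → cop ps G ≡ 1ℤ
  cop-one G [] _ = refl
  cop-one G (p ∷ ps) ∤G = cong₂ (λ x y → (1ℤ ℤ.- x) ℤ.* y) (Σℤ.⟦⟧-false (p ∣? G) (∤G (here refl))) (cop-one G ps (∤G ∘ there))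

  cop-zero : ∀ G ps → Any (λ p → pol p ∣ G) ps → cop ps G ≡ 0ℤ
  cop-zero G (p ∷ ps) (here p∣G) = trans (cong (λ x → (1ℤ ℤ.- x) ℤ.* cop ps G) (Σℤ.⟦⟧-true (p ∣? G) p∣G)) (ℤ.*-zeroˡ (cop ps G))
  cop-zero G (p ∷ ps) (there i) = trans (cong (λ y → (1ℤ ℤ.- Σℤ.⟦ p ∣? G ⟧) ℤ.* y) (cop-zero G ps i)) (ℤ.*-zeroʳ (1ℤ ℤ.- Σℤ.⟦ p ∣? G ⟧))

  indicator≡cop : ∀ G → + ⟦ coprime? G Q ⟧ ≡ cop rs G
  indicator≡cop G with any? (λ p → p ∣? G) rs
  ... | yes i = trans (cong +_ (⟦⟧-false (coprime? G Q) λ c → let p , p∈ , p∣G = find i in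
          coprime⇒∤ {G} {Q} {rs} (≋-refl {Q}) c p∈ p∣G)) (sym (cop-zero G rs i))
  ... | no ¬i = trans (cong +_ (⟦⟧-true (coprime? G Q) (∤⇒coprime {G} {Q} {rs} (≋-refl {Q}) ∤G))) (sym (cop-one G rs ∤G))
    where
    ∤G : ∀ {p} → p ∈ rs → ¬ pol p ∣ G
    ∤G p∈ p∣G = ¬i (Any.map (λ { refl → p∣G }) p∈)

  count-coprime : ∀ xs → + length (filter (λ G → coprime? G Q) xs) ≡ Σℤ.∑ xs (cop rs)
  count-coprime xs = trans (cong +_ (length-filter (λ G → coprime? G Q) xs))
    (trans (sym (∑-+-homo xs _)) (Σℤ.∑-cong xs (indicator≡cop)))

  deg≡m : deg Q ≡ m
  deg≡m = cong (_∸ 1) (size-top (monic-top Q-monic))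

  φ≡totient : + φ Q ≡ totient
  φ≡totient = trans (count-coprime (allPol (deg Q))) (cong (λ k → Σℤ.∑ (allPol k) (cop rs)) deg≡m)

  -- The bijection is R ↦ F + R; `deg Q + h` coefficients leave room for both F and R.
  N≡window : ∀ {F} → F ∈ allPol m → + N Q h F ≡ window h F
  N≡window {F} F∈ = trans (count-coprime near) (trans
      (sym (Σℤ.∑-reindex φ′ (cop rs) (map-↭ φ′ ψ (allPol-unique h) (Unique.filter⁺ near? (allPol-unique k)) φ∈ (λ _ → trunc∈ h _) ψφ φψ)))
      (Σℤ.∑-cong-∈ (allPol h) (λ R∈ → cop-cong (φ≋ R∈))))
    where
    k = deg Q + h
    near? : ∀ G → Dec (∣ F -P G ∣P < q ^ h)
    near? G = ∣ F -P G ∣P ℕ.<? q ^ h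
    near = filter near? (allPol k)
    φ′ ψ : Pol → Pol
    φ′ R = trunc k (F +P R)
    ψ G = trunc h (G -P F)
    φ≋ : ∀ {R} → R ∈ allPol h → φ′ R ≋ (F +P R)
    φ≋ R∈ = trunc-≋ k (Small-+ (Small-mono (subst (_≤ k) deg≡m (m≤m+n (deg Q) h)) (∈-Small {m} F∈))
      (Small-mono (m≤n+m h (deg Q)) (∈-Small {h} R∈)))
    neg-sub : ∀ A B → (-P (A -P B)) ≋ (B -P A)
    neg-sub A B = ≋-trans (≋-sym (P.⁻¹-∙-comm A (-P B))) (≋-trans (+-cong (≋-refl { -P A}) (P.-‿involutive B)) (+-comm (-P A) B))
    cancelˡ : ∀ A B → ((A +P B) -P A) ≋ B
    cancelˡ A B = ≋-trans (+-cong (+-comm A B) (≋-refl { -P A})) (add-sub B A)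
    restore : ∀ A B → (A +P (B -P A)) ≋ B
    restore A B = ≋-trans (+-comm A (B -P A)) (sub-add B A)
    ψφ≋ : ∀ {R} → R ∈ allPol h → (φ′ R -P F) ≋ R
    ψφ≋ {R} R∈ = ≋-trans (+-cong (φ≋ R∈) (≋-refl { -P F})) (cancelˡ F R)
    φ∈ : ∀ {R} → R ∈ allPol h → φ′ R ∈ near
    φ∈ {R} R∈ = ∈-filter⁺ near? (trunc∈ k _) (Small⇒∣∣P< (Small-resp (neg-sub (φ′ R) F)
      (Small-neg (Small-resp (≋-sym (ψφ≋ R∈)) (∈-Small {h} R∈)))))
    ψφ : ∀ {R} → R ∈ allPol h → ψ (φ′ R) ≡ R
    ψφ {R} R∈ = ∈-≋⇒≡ {h} (trunc∈ h _) R∈ (≋-trans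
      (trunc-≋ h (Small-resp (≋-sym (ψφ≋ R∈)) (∈-Small {h} R∈))) (ψφ≋ R∈))
    φψ : ∀ {G} → G ∈ near → φ′ (ψ G) ≡ G
    φψ {G} G∈ with ∈-filter⁻ near? {xs = allPol k} G∈
    ... | G∈′ , lt = ∈-≋⇒≡ {k} (trunc∈ k _) G∈′ (≋-trans (φ≋ (trunc∈ h _)) (≋-trans (+-cong (≋-refl {F})
      (trunc-≋ h (Small-resp (neg-sub F G) (Small-neg (∣∣P<⇒Small lt))))) (restore F G)))

  integrality : ∀ {F} → F ∈ allPol m →
    + (q ^ deg Q) ℤ.* + N Q h F ℤ.- + (q ^ h * φ Q) ≡ deviation h F
  integrality {F} F∈ = cong₂ ℤ._-_ (cong₂ (λ k z → + (q ^ k) ℤ.* z) deg≡m (N≡window F∈))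
    (trans (ℤ.pos-* (q ^ h) (φ Q)) (cong (+ (q ^ h) ℤ.*_) φ≡totient))

  m₅-scale : m₅ Q h ℚ.* (ι (+ (q ^ m)) ^Q 5) ≡ ι (Σℤ.∑ (allPol m) (λ F → deviation h F ℤ.^ 5))
  m₅-scale = trans (cong (λ k → m₅ Q h ℚ.* (ι (+ (q ^ k)) ^Q 5)) (sym deg≡m))
    (trans (∑ℚ-scale (allPol (deg Q)) _ (λ F → deviation h F ℤ.^ 5) (ι (+ (q ^ deg Q)) ^Q 5)
      (λ {F} F∈ → trans (scaled-power (+ N Q h F) (+ (q ^ h * φ Q)) (q ^ deg Q) {{m^n≢0 q (deg Q)}} 5)
        (cong (λ z → ι (z ℤ.^ 5)) (integrality (subst (λ k → F ∈ allPol k) deg≡m F∈)))))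
    (cong (λ k → ι (Σℤ.∑ (allPol k) (λ F → deviation h F ℤ.^ 5))) deg≡m))

  module _ (μ L Γ : ℕ) (255²≤μ : 255 * 255 ≤ μ)
    (L-bound : ProductBound rs μ L)
    (Γ-bound : PowerBound rs h μ Γ) where

    open Classes 𝔽 rs distinct h using (H; f; _∣ᵇ_; module Bounds)
    open Bounds μ L Γ L-bound Γ-bound using (f*; T; loss; fifth-bound)
    open Moments h using (W; moment)

    -- The local factor is |P| - 1 if P divides X and -1 otherwise, bounded by |P| and 1: this is κ
    -- = 1.
    ∣weight∣≤f : ∀ X → ℤ.∣ weight rs X ∣ ≤ f 1 X
    ∣weight∣≤f X = go rs
      where
      local : ∀ p {P : Set} (d : Dec P) → ℤ.∣ + norm p ℤ.* Σℤ.⟦ d ⟧ ℤ.- 1ℤ ∣ ≤ (if does d then norm p else 1)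
      local p (no _) = ≤-reflexive (cong (λ z → ℤ.∣ z ℤ.- 1ℤ ∣) (ℤ.*-zeroʳ (+ norm p)))
      local p (yes _) = subst (λ z → ℤ.∣ z ℤ.- 1ℤ ∣ ≤ norm p) (sym (ℤ.*-identityʳ (+ norm p))) (pred≤ (norm p) (m^n>0 q (degree p)))
        where
        pred≤ : ∀ k → 1 ≤ k → ℤ.∣ + k ℤ.- 1ℤ ∣ ≤ k
        pred≤ (suc k) _ = ℕ.n≤1+n k
      go : ∀ ps → ℤ.∣ weight ps X ∣ ≤ ∏ ps (λ p → if p ∣ᵇ X then norm p else 1)
      go [] = ≤-refl
      go (p ∷ ps) = ≤-trans (≤-reflexive (ℤ.abs-* (+ norm p ℤ.* Σℤ.⟦ p ∣? X ⟧ ℤ.- 1ℤ) (weight ps X)))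
        (*-mono-≤ (local p (p ∣? X)) (go ps))

    ∣weight*∣≤f* : ∀ X → ℤ.∣ weight* X ∣ ≤ f* 1 X
    ∣weight*∣≤f* X with X ≋0?
    ... | yes _ = ≤-reflexive (cong ℤ.∣_∣ (ℤ.*-zeroˡ (weight rs X)))
    ... | no _ = ≤-trans (≤-reflexive (cong ℤ.∣_∣ (ℤ.*-identityˡ (weight rs X)))) (∣weight∣≤f X)

    ∣W∣≤T : ∀ k S → ℤ.∣ W k S ∣ ≤ T k S
    ∣W∣≤T zero S with does (S ≋0?)
    ... | true = ≤-refl
    ... | false = ≤-refl
    ∣W∣≤T (suc k) S = ≤-trans (∣∑∣≤∑∣∣ (allPol (m ∸ h)) (λ X → weight* X ℤ.* W k (S +P X)))
      (∑-mono-∈ (allPol (m ∸ h)) (λ {X} _ → ≤-trans (≤-reflexive (ℤ.abs-* (weight* X) (W k (S +P X))))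
        (*-mono-≤ (∣weight*∣≤f* X) (∣W∣≤T k (S +P X)))))

    factor : ℕ
    factor = 4 * (loss ^ 3 * (1 + L))

    -- Poisson summation contributes H^5, of which `fifth-bound` takes back H^3; the remaining H² is
    -- `q ^ (2 * h)`.
    moment-bound : ℤ.∣ Σℤ.∑ (allPol m) (λ F → deviation h F ℤ.^ 5) ∣ ≤ (q ^ m * q ^ (2 * h) * factor) * (q ^ m) ^ 5
    moment-bound = begin
      ℤ.∣ Σℤ.∑ (allPol m) (λ F → deviation h F ℤ.^ 5) ∣
        ≡⟨ cong ℤ.∣_∣ (trans (moment 5) (cong (ℤ._* (+ (q ^ m) ℤ.* W 5 [])) (pos-^ (q ^ h) 5))) ⟩
      ℤ.∣ + (H ^ 5) ℤ.* (+ (q ^ m) ℤ.* W 5 []) ∣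
        ≡⟨ trans (ℤ.abs-* (+ (H ^ 5)) (+ (q ^ m) ℤ.* W 5 [])) (cong (H ^ 5 *_) (ℤ.abs-* (+ (q ^ m)) (W 5 []))) ⟩
      H ^ 5 * (q ^ m * ℤ.∣ W 5 [] ∣)
        ≤⟨ *-monoʳ-≤ (H ^ 5) (*-monoʳ-≤ (q ^ m) (∣W∣≤T 5 [])) ⟩
      H ^ 5 * (q ^ m * T 5 [])
        ≡⟨ regroup H (q ^ m) (T 5 []) ⟩
      (q ^ m * (H * H)) * ((H * (H * H)) * T 5 [])
        ≤⟨ *-monoʳ-≤ (q ^ m * (H * H)) (fifth-bound 255²≤μ) ⟩
      (q ^ m * (H * H)) * (4 * ((q ^ m) ^ 5 * (loss ^ 3 * (1 + L))))
        ≡⟨ reorder (q ^ m * (H * H)) ((q ^ m) ^ 5) (loss ^ 3 * (1 + L)) ⟩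
      (q ^ m * (H * H)) * factor * (q ^ m) ^ 5
        ≡⟨ cong (λ z → (q ^ m * z) * factor * (q ^ m) ^ 5) (trans (sym (^-distribˡ-+-* q h h))
             (cong (λ z → q ^ (h + z)) (sym (ℕ.+-identityʳ h)))) ⟩
      (q ^ m * q ^ (2 * h) * factor) * (q ^ m) ^ 5 ∎
      where
      open ℕ.≤-Reasoning
      regroup : ∀ H Q t → (H * (H * (H * (H * (H * 1))))) * (Q * t) ≡ (Q * (H * H)) * ((H * (H * H)) * t)
      regroup = solve-∀
      reorder : ∀ a b c → a * (4 * (b * c)) ≡ a * (4 * c) * b
      reorder = solve-∀

    m₅-bound : ∣ m₅ Q h ∣ ℚ.≤ ι (+ (q ^ m * q ^ (2 * h) * factor))
    m₅-bound = scaled-bound (m₅ Q h) (q ^ m) {{m^n≢0 q m}} 5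
      (Σℤ.∑ (allPol m) (λ F → deviation h F ℤ.^ 5)) (q ^ m * q ^ (2 * h) * factor) m₅-scale moment-bound

-- The primorial and the final estimate

module PrimeList (𝔽 : FiniteField) where
  open Primes 𝔽

  toPrime : ∀ P → Monic P → Irreducible P → Prime
  toPrime P monicP (_ , non-unit , irr) = record
    { pol = P
    ; degree = Monic⇒monicOfDegree {P} monicP .proj₁
    ; monic = Monic⇒monicOfDegree {P} monicP .proj₂
    ; nonUnit = non-unit ∘ ∣⇒∣P
    ; irreducible = λ A B e → Sum.map ∣P⇒∣ ∣P⇒∣ (irr A B (≋⇒≈P e))
    }

  -- `Unique` separates lists and `Distinct` separates polynomials; normal forms reconcile the two,
  -- which is why they are carried along.
  toPrimes : ∀ k Ps → Unique Ps →
    (∀ P → P ∈ Ps → normalize P ≡ P × Monic P × Irreducible P × ∣ P ∣P ≤ q ^ k) →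
    ∃ λ rs → map pol rs ≡ Ps × AllPairs Distinct rs × (∀ {p} → p ∈ rs → degree p ≤ k) ×
      (∀ {p} → p ∈ rs → normalize (pol p) ≡ pol p)
  toPrimes k [] _ _ = [] , refl , [] , (λ ()) , (λ ())
  toPrimes k (P ∷ Ps) (P∉ ∷ uniq) props with toPrimes k Ps uniq (λ R R∈ → props R (there R∈)) | props P (here refl)
  ... | rs , eq , dist , deg≤ , norm≡ | normP , monicP , irrP , P≤ =
      p ∷ rs , cong (P ∷_) eq , (All.tabulate distinct ∷ dist) , bound′ , normal
    where
    p = toPrime P monicP irrP
    distinct : ∀ {r} → r ∈ rs → Distinct p r
    distinct {r} r∈ P≋r = All.lookup P∉ (subst (pol r ∈_) eq (∈-map⁺ pol r∈))
      (trans (sym normP) (trans (≋⇒≈P P≋r) (norm≡ r∈)))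
    bound′ : ∀ {r} → r ∈ p ∷ rs → degree r ≤ k
    bound′ (here refl) = ≮⇒≥ λ k< → <⇒≱ (^-monoʳ-< q 2≤q k<) (subst (_≤ q ^ k) (∣∣P-top (monic-top (monic p))) P≤)
    bound′ (there r∈) = deg≤ r∈
    normal : ∀ {r} → r ∈ p ∷ rs → normalize (pol r) ≡ pol r
    normal (here refl) = normP
    normal (there r∈) = norm≡ r∈

private
  -- With ε = a/b, comparing b-th powers keeps all exponents integral; K is the loss, known only
  -- through its b-th power.
  bounded-power : ∀ (x : ℚ) A B C K b → ℚ.0ℚ ℚ.≤ x → x ℚ.≤ ι (+ (A * K)) → K ^ b ≤ C ^ b * B →
    x ^Q b ℚ.≤ (ι (+ C) ^Q b) ℚ.* ι (+ (A ^ b * B))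
  bounded-power x A B C K b 0≤x x≤ K≤ = ℚ.≤-trans (^Q-mono b 0≤x x≤) (subst₂ ℚ._≤_
    (sym (trans (ι-^ (+ (A * K)) b) (cong ι (pos-^ (A * K) b))))
    (sym (trans (cong (ℚ._* ι (+ (A ^ b * B))) (trans (ι-^ (+ C) b) (cong ι (pos-^ C b))))
      (trans (ι-* (+ (C ^ b)) (+ (A ^ b * B))) (cong ι (sym (ℤ.pos-* (C ^ b) (A ^ b * B)))))))
    (ι-mono (ℤ.+≤+ (begin
      (A * K) ^ b            ≡⟨ ^-distribʳ b A K ⟩
      A ^ b * K ^ b          ≤⟨ *-monoʳ-≤ (A ^ b) K≤ ⟩
      A ^ b * (C ^ b * B)    ≡⟨ swap (A ^ b) (C ^ b) B ⟩
      C ^ b * (A ^ b * B)    ∎))))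
    where
    open ℕ.≤-Reasoning
    swap : ∀ a b c → a * (b * c) ≡ b * (a * c)
    swap = solve-∀

module Estimate (𝔽 : FiniteField) (coprime? : ∀ A B → Dec (Poly.Coprime 𝔽 A B)) (a b : ℕ) (1≤a : 1 ≤ a)
  (μ : ℕ) (255²≤μ : 255 * 255 ≤ μ) where
  open Vectors 𝔽
  open Counting coprime?
  open PrimeSums 𝔽 using (Losses)

  Estimate : ℕ → ℕ → Pol → Set
  Estimate C h Q = ∣ m₅ Q h ∣ ^Q b ℚ.≤ (ι (+ C) ^Q b) ℚ.* ι (+ ((∣ Q ∣P * q ^ (2 * h)) ^ b * q ^ (a * h)))

  estimate-product : ∀ C h rs → AllPairs Distinct rs → Losses μ b C h rs → Estimate C h (∏P rs)
  estimate-product C h rs dist (L , Γ , L-bound , Γ-bound , total) =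
    bounded-power (∣ m₅ (∏P rs) h ∣) (∣ ∏P rs ∣P * q ^ (2 * h)) (q ^ (a * h)) C
      (4 * ((L + h * Γ) ^ 3 * (1 + L))) b (ℚ.0≤∣p∣ (m₅ (∏P rs) h))
      (ℚ.≤-trans (Link.m₅-bound 𝔽 rs dist coprime? h μ L Γ 255²≤μ L-bound Γ-bound)
        (ι-mono (ℤ.+≤+ (≤-reflexive (cong (λ z → z * q ^ (2 * h) * (4 * ((L + h * Γ) ^ 3 * (1 + L))))
          (sym (∣∣P-top (monic-top (∏P-monic rs)))))))))
      -- The losses already meet the exponent 1/b, which is at most a/b.
      (≤-trans total (*-monoʳ-≤ (C ^ b) (^-monoʳ-≤ q (ℕ.m≤n*m h a {{>-nonZero 1≤a}}))))

  estimate-primorial : ∀ C → (∀ h rs → AllPairs Distinct rs → (∀ {p} → p ∈ rs → degree p ≤ 2 * h) → Losses μ b C h rs) →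
    ∀ h Q → IsPrimorial h Q → Estimate C h Q
  estimate-primorial C losses h Q (Ps , uniq , props , _ , Q≡) = go (PrimeList.toPrimes 𝔽 (2 * h) Ps uniq props)
    where
    go : (∃ λ rs → map pol rs ≡ Ps × AllPairs Distinct rs × (∀ {p} → p ∈ rs → degree p ≤ 2 * h) ×
      (∀ {p} → p ∈ rs → normalize (pol p) ≡ pol p)) → Estimate C h Q
    go (rs , eq , dist , deg≤ , _) = subst (Estimate C h) (trans (cong prodP eq) (sym Q≡))
      (estimate-product C h rs dist (losses h rs dist deg≤))

  estimate : (∃ λ C → ∀ h rs → AllPairs Distinct rs → (∀ {p} → p ∈ rs → degree p ≤ 2 * h) → Losses μ b C h rs) →
    ∃ λ (C : ℚ) → ∀ (h : ℕ) → 1 ≤ h → ∀ Q → IsPrimorial h Q →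
      ∣ m₅ Q h ∣ ^Q b ℚ.≤ (C ^Q b) ℚ.* ι (+ ((∣ Q ∣P * q ^ (2 * h)) ^ b * q ^ (a * h)))
  estimate (C , losses) = ι (+ C) , λ h _ → estimate-primorial C losses h

theorem1p4 : (𝔽 : FiniteField)
    → (coprime? : ∀ A B → Dec (Poly.Coprime 𝔽 A B))
    → (a b : ℕ) → 1 ≤ a → 1 ≤ b
    → ∃ λ (C : ℚ) → ∀ (h : ℕ) → 1 ≤ h → ∀ Q → Poly.IsPrimorial 𝔽 h Q
    → Data.Rational._≤_ (∣ Poly.Counting.m₅ 𝔽 coprime? Q h ∣ ^Q b)
        (Data.Rational._*_ (C ^Q b)
          ((+ ((Poly.∣_∣P 𝔽 Q * Poly.q 𝔽 ^ (2 * h)) ^ b * Poly.q 𝔽 ^ (a * h)) / 1)))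
-- The largest κ is 255, which is `next` applied three times to 1, and it enters the loss bounds as
-- κ² ≤ μ.
theorem1p4 𝔽 coprime? a b 1≤a 1≤b = Estimate.estimate 𝔽 coprime? a b 1≤a (255 * 255) ≤-refl
  (PrimeSums.losses 𝔽 (255 * 255) (s≤s z≤n) b 1≤b)
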